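{- Let $\lambda\in P$, $\lhd\in\mathrm{RO}(\lambda,\Delta^+)$ and $w\in W$. The forgetful map $\tilde\Xi:\mathcal{A}(w,\Gamma)\to\mathrm{IQLS}(\lambda)\times W$, $A\mapsto(\Xi(A),\mathrm{end}(A))$, is injective.
   Context: Let $\mathfrak{g}$ be a finite-dimensional complex simple Lie algebra with root system $\Delta$, positive roots $\Delta^+$, Weyl group $W$ with length function $\ell$ and reflections $s_\alpha$, weight lattice $P$, pairing $\langle\cdot,\cdot\rangle$, $\alpha^\vee$ the coroot of $\alpha$, $\rho=\frac12\sum_{\alpha\in\Delta^+}\alpha$. For $\alpha\in\Delta$, $\operatorname{sgn}(\alpha)=\pm1$ according as $\alpha\in\pm\Delta^+$, and $|\alpha|=\operatorname{sgn}(\alpha)\alpha$. For $\lambda\in P$, $\Delta^+(\lambda)_{>0}$, $\Delta^+(\lambda)_{=0}$, $\Delta^+(\lambda)_{<0}$ are the sets of $\alpha\in\Delta^+$ with $\langle\lambda,\alpha^\vee\rangle>0$, $=0$, $<0$. Quantum Bruhat graph $\mathrm{QBG}(W)$: vertices $W$; an edge $x\xrightarrow{\alpha}y$ ($\alpha\in\Delta^+$) whenever $y=xs_\alpha$ and either $\ell(y)=\ell(x)+1$ (Bruhat edge) or $\ell(y)=\ell(x)-2\langle\rho,\alpha^\vee\rangle+1$ (quantum edge). Reflection orders: a total order $\lhd$ on $\Delta^+$ is a reflection order if whenever $\alpha,\beta,\alpha+\beta\in\Delta^+$, either $\alpha\lhd\alpha+\beta\lhd\beta$ or $\beta\lhd\alpha+\beta\lhd\alpha$;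 $\mathrm{RO}(\lambda,\Delta^+)$ is the set of those with $\alpha\lhd\beta\lhd\gamma$ for $\alpha\in\Delta^+(\lambda)_{<0}$, $\beta\in\Delta^+(\lambda)_{=0}$, $\gamma\in\Delta^+(\lambda)_{>0}$. Fix such $\lhd$. Interpolated QLS paths: for $x,y\in W$, $\sigma\in\mathbb{Q}$, write $x\overset{(\lambda,+)}{\Longrightarrow}_\sigma y$ if there is a directed path $x=x_0\xrightarrow{\gamma_1}x_1\to\cdots\xrightarrow{\gamma_r}x_r=y$ in $\mathrm{QBG}(W)$ ($r\ge0$) with all $\gamma_k\in\Delta^+(\lambda)_{>0}$, $\gamma_{k+1}\lhd\gamma_k$ for all $k$, and $\sigma\langle\lambda,\gamma_k^\vee\rangle\in\mathbb{Z}$ for all $k$; $x\overset{(\lambda,-)}{\Longrightarrow}_\sigma y$ is defined identically with $\Delta^+(\lambda)_{<0}$ in place of $\Delta^+(\lambda)_{>0}$. An interpolated QLS path of shape $\lambda$ is a triple $\eta=(x_1,\dots,x_s;y_1,\dots,y_{s-1};\sigma_0,\dots,\sigma_s)$ ($s\ge1$) with $x_i,y_i\in W$, $x_i\ne x_{i+1}$, $y_i\ne y_{i+1}$, $\sigma_i\in\mathbb{Q}$, $0=\sigma_0<\sigma_1<\dots<\sigma_s=1$, and for $1\le i\le s-1$: $x_{i+1}\overset{(\lambda,-)}{\Longrightarrow}_{\sigma_i}y_i$ and $y_i\overset{(\lambda,+)}{\Longrightarrow}_{\sigma_i}x_i$. $\mathrm{IQLS}(\lambda)$ is the set of these. Affine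 data: real affine coroots $\gamma^\vee+k\tilde\delta$ ($\gamma\in\Delta$, $k\in\mathbb{Z}$, $\tilde\delta$ formal); for $\beta^\vee=\gamma^\vee+k\tilde\delta$ put $\overline{\beta^\vee}=\gamma^\vee$, $\overline\beta=\gamma$, $\deg(\beta^\vee)=k$; it is positive if $k>0$ or ($k=0$, $\gamma\in\Delta^+$), negative otherwise; $t_\lambda(\gamma^\vee+k\tilde\delta)=\gamma^\vee+(k-\langle\lambda,\gamma^\vee\rangle)\tilde\delta$; $\mathrm{Inv}(\lambda)$ is the set of positive real affine coroots $\beta^\vee$ with $t_\lambda(\beta^\vee)$ negative (for these, $\langle\lambda,\overline{\beta^\vee}\rangle>0$ and $\overline\beta\in\Delta^+(\lambda)_{>0}\sqcup(-\Delta^+(\lambda)_{<0})$); put $d(\beta^\vee)=\deg(\beta^\vee)/\langle\lambda,\overline{\beta^\vee}\rangle$. Order $\prec$ on $\Delta^+(\lambda)_{>0}\sqcup(-\Delta^+(\lambda)_{<0})$: elements of $\Delta^+(\lambda)_{>0}$ precede those of $-\Delta^+(\lambda)_{<0}$; $\gamma\prec\gamma'$ iff $\gamma\lhd\gamma'$ on $\Delta^+(\lambda)_{>0}$; $-\alpha\prec-\alpha'$ iff $\alpha\lhd\alpha'$ on $-\Delta^+(\lambda)_{<0}$. Order $<$ on $\mathrm{Inv}(\lambda)$: $\beta^\vee<\beta'^\vee$ iff $d(\beta^\vee)<d(\beta'^\vee)$, or they are equal and $\overline{\beta'}\prec\overline\beta$. Write $\mathrm{Inv}(\lambda)=\{\beta_1^\vee<\dots<\beta_r^\vee\}$,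 $\gamma_k:=\overline{\beta_k}$, $d_k:=d(\beta_k^\vee)$, and $\Gamma:=(\gamma_1,\dots,\gamma_r)$ (the suitable $\lambda$-chain for $\lhd$). Admissible subsets: for $w\in W$, $\mathcal{A}(w,\Gamma)$ is the set of $A=\{j_1<\dots<j_p\}\subseteq\{1,\dots,r\}$ such that $w=u_0\xrightarrow{|\gamma_{j_1}|}u_1\to\cdots\xrightarrow{|\gamma_{j_p}|}u_p$ is a directed path in $\mathrm{QBG}(W)$, where $u_a:=ws_{|\gamma_{j_1}|}\cdots s_{|\gamma_{j_a}|}$; $\mathrm{end}(A):=u_p$. One has $0\le d_{j_1}\le\dots\le d_{j_p}\le1$. The map $\Xi$: let $0<c_1<\dots<c_{t-1}<1$ ($t\ge1$) be the distinct values among $d_{j_1},\dots,d_{j_p}$ lying strictly between $0$ and $1$; put $c_0:=0$, $c_t:=1$. For $1\le a\le t$ let $m_a:=\#\{b\mid d_{j_b}<c_a\}$; for $1\le a\le t-1$ let $n_a:=m_a+\#\{b\mid m_a<b\le m_{a+1},\ \gamma_{j_b}\in-\Delta^+\}$. Then $\Xi(A):=(x_1,\dots,x_t;y_1,\dots,y_{t-1};\sigma_0,\dots,\sigma_t)$ with $x_i:=u_{m_{t+1-i}}$, $y_i:=u_{n_{t-i}}$, $\sigma_i:=1-c_{t-i}$; this lies in $\mathrm{IQLS}(\lambda)$.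
   Formalization: The map is taken into all triples × W instead of IQLS(λ) × W, because Ξ(A) can violate the condition y_i ≠ y_{i+1} (type A₂, pairings −2 and 5, w = e gives y₁ = y₂ = s₁); injectivity is stated on all of A(w,Γ). -}

module Defs where

open import Level using (0ℓ)
open import Data.Nat as ℕ using (ℕ; zero; suc; _∸_)
open import Data.Integer as ℤ using (ℤ; +_; -[1+_]; 0ℤ; _◃_)
open import Data.Rational as ℚ using (ℚ; 0ℚ; 1ℚ; ½; _/_)
import Data.Rational.Properties as ℚₚ
open import Data.Sign as Sign using (Sign)
import Data.Sign.Properties as Signₚ
open import Data.Bool using (if_then_else_)
open import Data.Fin as Fin using (Fin; toℕ; inject₁)
open import Data.Fin.Subset using (Subset; _∈_; _∉_; ⊤; ⊥)
open import Data.Fin.Subset.Properties using (_∈?_)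
open import Data.List as List using (List; _∷ʳ_; _++_; length; take; drop; filter; allFin; deduplicate)
open import Data.List.Relation.Unary.All using (All)
open import Data.List.Relation.Unary.Linked using (Linked)
open import Data.Vec as Vec using (Vec; []; _∷_; zipWith; replicate; lookup; fromList; tabulate; reverse)
import Data.Vec.Relation.Unary.Linked as Vecᴸ
open import Data.Vec.Relation.Binary.Pointwise.Inductive using (Pointwise)
open import Data.Vec.Functional using (foldr)
open import Data.Product using (Σ; ∃; ∃-syntax; _×_; _,_; proj₁; proj₂)
open import Data.Sum using (_⊎_)
open import Function using (_∘_; _on_)
open import Relation.Nullary using (¬_; ⌊_⌋)
open import Relation.Nullary.Decidable using (_×-dec_)
open import Relation.Unary using (Pred)
open import Relation.Binary using (Rel; IsStrictTotalOrder)
open import Relation.Binary.PropositionalEquality using (_≡_; _≢_)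

toℚ : ℤ → ℚ
toℚ z = z / 1

IsInteger : ℚ → Set
IsInteger q = ∃[ z ] q ≡ toℚ z

module _ {n : ℕ} where

  infixl 6 _+ᵥ_ _-ᵥ_
  infixr 7 _•_

  _+ᵥ_ _-ᵥ_ : Vec ℚ n → Vec ℚ n → Vec ℚ n
  _+ᵥ_ = zipWith ℚ._+_
  _-ᵥ_ = zipWith ℚ._-_

  _•_ : ℚ → Vec ℚ n → Vec ℚ n
  c • v = Vec.map (c ℚ.*_) v

  0ᵥ : Vec ℚ n
  0ᵥ = replicate n 0ℚ

  ∑ : ∀ {m} → (Fin m → Vec ℚ n) → Vec ℚ n
  ∑ f = foldr _+ᵥ_ 0ᵥ f

  ⟨_,_⟩ : Vec ℚ n → Vec ℚ n → ℚ
  ⟨ v , f ⟩ = Vec.foldr′ ℚ._+_ 0ℚ (zipWith ℚ._*_ v f)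

-- Root systems of simple Lie algebras, i.e. reduced irreducible
-- crystallographic root systems, spanning the rational space V = ℚ^rank.
-- Coroots live in the dual space, identified with ℚ^rank through the
-- coordinatewise pairing ⟨_,_⟩; no inner product on V is chosen.
record RootSystem : Set where
  field
    rank #Δ : ℕ

  V : Set
  V = Vec ℚ rank

  Root : Set
  Root = Fin #Δ

  field
    root   : Root → V
    coroot : Root → V

  s : Root → V → V
  s α v = v -ᵥ ⟨ v , coroot α ⟩ • root α

  field
    rank-nonZero   : ℕ.NonZero rank
    root-injective : ∀ {α β} → root α ≡ root β → α ≡ β
    spanning       : ∀ v → Σ (Root → ℚ) λ c → v ≡ ∑ λ α → c α • root α
    pairing-self   : ∀ α → ⟨ root α , coroot α ⟩ ≡ toℚ (+ 2)
    integrality    : ∀ α β → IsInteger ⟨ root β , coroot α ⟩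
    reflect        : Root → Root → Root
    root-reflect   : ∀ α β → root (reflect α β) ≡ s α (root β)
    reduced        : ∀ α β c → root β ≡ c • root α → c ≡ 1ℚ ⊎ c ≡ ℚ.- 1ℚ
    irreducible    : ∀ (S : Subset #Δ) →
                     (∀ {α β} → α ∈ S → β ∉ S → ⟨ root α , coroot β ⟩ ≡ 0ℚ) →
                     S ≡ ⊥ ⊎ S ≡ ⊤

  -- s_α(α) = -α
  neg : Root → Root
  neg α = reflect α α

-- A choice of simple roots, equivalently of Δ⁺.
record Base (Φ : RootSystem) : Set where
  open RootSystem Φ
  field
    simple        : Fin rank → Root
    independent   : ∀ (c : Fin rank → ℚ) → ∑ (λ i → c i • root (simple i)) ≡ 0ᵥ → ∀ i → c i ≡ 0ℚ
    sgn           : Root → Sign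
    coeff         : Root → Fin rank → ℕ
    decomposition : ∀ β → root β ≡ ∑ λ i → toℚ (sgn β ◃ coeff β i) • root (simple i)

-- The weight lattice P.
record Weight (Φ : RootSystem) : Set where
  open RootSystem Φ
  field
    vec          : V
    pair         : Root → ℤ
    pair-correct : ∀ α → ⟨ vec , coroot α ⟩ ≡ toℚ (pair α)

module WeylGroup (Φ : RootSystem) where
  open RootSystem Φ

  -- The subgroup of GL(V) generated by the reflections: the word α₁ ⋯ αₖ
  -- stands for s_α₁ ∘ ⋯ ∘ s_αₖ, and two words are equal elements of W when
  -- they act identically on V. In particular x ∷ʳ α is x s_α.
  W : Set
  W = List Root

  act : W → V → V
  act w v = List.foldr s v w

  infix 4 _≈_ _≉_

  _≈_ _≉_ : Rel W 0ℓ
  x ≈ y = ∀ v → act x v ≡ act y v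
  x ≉ y = ¬ x ≈ y

module QuantumBruhatGraph (Φ : RootSystem) (Π : Base Φ) where
  open RootSystem Φ
  open Base Π
  open WeylGroup Φ

  IsPositive IsNegative : Pred Root 0ℓ
  IsPositive α = sgn α ≡ Sign.+
  IsNegative α = sgn α ≡ Sign.-

  ∣_∣ : Root → Root
  ∣ α ∣ with sgn α
  ... | Sign.+ = α
  ... | Sign.- = neg α

  ρ : V
  ρ = ½ • ∑ λ α → if ⌊ sgn α Signₚ.≟ Sign.+ ⌋ then root α else 0ᵥ

  -- ℓ(w) = k, as a (functional) relation.
  HasLength : W → ℕ → Set
  HasLength w k =
    (∃[ is ] List.map simple is ≈ w × length is ≡ k) ×
    (∀ is → List.map simple is ≈ w → k ℕ.≤ length is)

  BruhatStep : W → W → Set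
  BruhatStep x y = ∃[ k ] HasLength x k × HasLength y (k ℕ.+ 1)

  QuantumStep : W → Root → W → Set
  QuantumStep x α y = ∃[ k ] ∃[ l ] HasLength x k × HasLength y l ×
    toℚ (+ l) ≡ toℚ (+ k) ℚ.- toℚ (+ 2) ℚ.* ⟨ ρ , coroot α ⟩ ℚ.+ 1ℚ

  Edge : W → Root → W → Set
  Edge x α y = IsPositive α × y ≈ x ∷ʳ α × (BruhatStep x y ⊎ QuantumStep x α y)

  data Path : W → List Root → W → Set where
    done : ∀ {x y} → x ≈ y → Path x List.[] y
    step : ∀ {x α z αs y} → Edge x α z → Path z αs y → Path x (α List.∷ αs) y

module ReflectionOrders (Φ : RootSystem) (Π : Base Φ) (Λ : Weight Φ) where
  open RootSystem Φ
  open Base Π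
  open Weight Λ
  open QuantumBruhatGraph Φ Π

  Δ⁺ : Set
  Δ⁺ = Σ Root IsPositive

  Δ⁺>0 Δ⁺=0 Δ⁺<0 -Δ⁺<0 : Pred Root 0ℓ
  Δ⁺>0 α  = IsPositive α × 0ℤ ℤ.< pair α
  Δ⁺=0 α  = IsPositive α × pair α ≡ 0ℤ
  Δ⁺<0 α  = IsPositive α × pair α ℤ.< 0ℤ
  -Δ⁺<0 α = IsNegative α × Δ⁺<0 ∣ α ∣

  -- RO(λ, Δ⁺). Only the restriction of _◁_ to positive roots matters.
  record IsReflectionOrder (_◁_ : Rel Root 0ℓ) : Set where
    field
      isStrictTotalOrder : IsStrictTotalOrder {A = Δ⁺} _≡_ (_◁_ on proj₁)
      convex : ∀ {α β γ} → IsPositive α → IsPositive β → IsPositive γ →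
               root γ ≡ root α +ᵥ root β →
               (α ◁ γ × γ ◁ β) ⊎ (β ◁ γ × γ ◁ α)
      neg◁zero : ∀ {α β} → Δ⁺<0 α → Δ⁺=0 β → α ◁ β
      zero◁pos : ∀ {β γ} → Δ⁺=0 β → Δ⁺>0 γ → β ◁ γ
      neg◁pos  : ∀ {α γ} → Δ⁺<0 α → Δ⁺>0 γ → α ◁ γ

module SuitableChains (Φ : RootSystem) (Π : Base Φ) (Λ : Weight Φ)
                      (_◁_ : Rel (RootSystem.Root Φ) 0ℓ) where
  open RootSystem Φ
  open Base Π
  open Weight Λ
  open QuantumBruhatGraph Φ Π
  open ReflectionOrders Φ Π Λ

  -- (γ , k) stands for γ^∨ + k δ̃.
  AffineCoroot : Set
  AffineCoroot = Root × ℤ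

  bar : AffineCoroot → Root
  bar = proj₁

  deg : AffineCoroot → ℤ
  deg = proj₂

  IsPositiveᵃ : Pred AffineCoroot 0ℓ
  IsPositiveᵃ (γ , k) = 0ℤ ℤ.< k ⊎ (k ≡ 0ℤ × IsPositive γ)

  t : AffineCoroot → AffineCoroot
  t (γ , k) = γ , k ℤ.- pair γ

  Inv : Pred AffineCoroot 0ℓ
  Inv β = IsPositiveᵃ β × ¬ IsPositiveᵃ (t β)

  -- deg(β^∨) / ⟨λ, β̄^∨⟩. The denominator is positive on Inv; the value 0ℚ
  -- is a dummy for other affine coroots.
  d : AffineCoroot → ℚ
  d (γ , k) with pair γ
  ... | + suc m  = k / suc m
  ... | + zero   = 0ℚ
  ... | -[1+ _ ] = 0ℚ

  infix 4 _≺_ _<ᴵ_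

  data _≺_ : Rel Root 0ℓ where
    pos≺neg : ∀ {γ γ′} → Δ⁺>0 γ → -Δ⁺<0 γ′ → γ ≺ γ′
    pos≺pos : ∀ {γ γ′} → Δ⁺>0 γ → Δ⁺>0 γ′ → γ ◁ γ′ → γ ≺ γ′
    neg≺neg : ∀ {γ γ′} → -Δ⁺<0 γ → -Δ⁺<0 γ′ → ∣ γ ∣ ◁ ∣ γ′ ∣ → γ ≺ γ′

  _<ᴵ_ : Rel AffineCoroot 0ℓ
  β <ᴵ β′ = d β ℚ.< d β′ ⊎ (d β ≡ d β′ × bar β′ ≺ bar β)

  -- The increasing enumeration β₁ < ⋯ < βᵣ of the finite set Inv(λ).
  record SuitableChain : Set where
    field
      r          : ℕ
      β          : Fin r → AffineCoroot
      β∈Inv      : ∀ j → Inv (β j)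
      β-complete : ∀ b → Inv b → ∃[ j ] β j ≡ b
      β-monotone : ∀ {i j} → i Fin.< j → β i <ᴵ β j

    γ : Fin r → Root
    γ = bar ∘ β

    dᵏ : Fin r → ℚ
    dᵏ = d ∘ β

module InterpolatedQLS (Φ : RootSystem) (Π : Base Φ) (Λ : Weight Φ)
                       (_◁_ : Rel (RootSystem.Root Φ) 0ℓ) where
  open RootSystem Φ
  open Weight Λ
  open WeylGroup Φ
  open QuantumBruhatGraph Φ Π
  open ReflectionOrders Φ Π Λ

  _⇒[_,_]_ : W → Pred Root 0ℓ → ℚ → W → Set
  x ⇒[ S , σ ] y = ∃[ γs ]
    Path x γs y ×
    All S γs ×
    Linked (λ γ γ′ → γ′ ◁ γ) γs ×
    All (λ γ → IsInteger (σ ℚ.* toℚ (pair γ))) γs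

  -- (x₁,…,xₛ ; y₁,…,yₛ₋₁ ; σ₀,…,σₛ) with s = 1 + s-1.
  record Triple : Set where
    field
      s-1 : ℕ
      x   : Vec W (1 ℕ.+ s-1)
      y   : Vec W s-1
      σ   : Vec ℚ (2 ℕ.+ s-1)

  -- IQLS(λ) as a set of triples. Vectors are indexed from 0, whereas x and y
  -- start at x₁ and y₁: for i : Fin s-1, the conditions below concern yᵢ₊₁,
  -- xᵢ₊₁ (at inject₁ i), xᵢ₊₂ (at suc i) and σᵢ₊₁ (at suc (inject₁ i)).
  record IsIQLS (η : Triple) : Set where
    open Triple η
    field
      x-distinct   : Vecᴸ.Linked _≉_ x
      y-distinct   : Vecᴸ.Linked _≉_ y
      σ-start      : Vec.head σ ≡ 0ℚ
      σ-end        : Vec.last σ ≡ 1ℚ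
      σ-increasing : Vecᴸ.Linked ℚ._<_ σ
      x⇒y          : ∀ i → lookup x (Fin.suc i) ⇒[ Δ⁺<0 , lookup σ (Fin.suc (inject₁ i)) ] lookup y i
      y⇒x          : ∀ i → lookup y i ⇒[ Δ⁺>0 , lookup σ (Fin.suc (inject₁ i)) ] lookup x (inject₁ i)

  infix 4 _≈ᵀ_

  record _≈ᵀ_ (η η′ : Triple) : Set where
    open Triple
    field
      x≈ : Pointwise _≈_ (x η) (x η′)
      y≈ : Pointwise _≈_ (y η) (y η′)
      σ≡ : Pointwise _≡_ (σ η) (σ η′)

module AdmissibleSubsets (Φ : RootSystem) (Π : Base Φ) (Λ : Weight Φ)
                         (_◁_ : Rel (RootSystem.Root Φ) 0ℓ)
                         (Γ : SuitableChains.SuitableChain Φ Π Λ _◁_)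
                         (w : WeylGroup.W Φ) where
  open RootSystem Φ
  open Base Π
  open WeylGroup Φ
  open QuantumBruhatGraph Φ Π
  open InterpolatedQLS Φ Π Λ _◁_ using (Triple; _≈ᵀ_)
  open SuitableChains.SuitableChain Γ

  -- j₁ < ⋯ < jₚ
  elements : Subset r → List (Fin r)
  elements A = filter (_∈? A) (allFin r)

  labels : Subset r → List Root
  labels A = List.map (∣_∣ ∘ γ) (elements A)

  u : Subset r → ℕ → W
  u A a = w ++ take a (labels A)

  IsAdmissible : Pred (Subset r) 0ℓ
  IsAdmissible A = ∀ (a : Fin (length (labels A))) →
    Edge (u A (toℕ a)) (List.lookup (labels A) a) (u A (suc (toℕ a)))

  𝒜 : Set
  𝒜 = Σ (Subset r) IsAdmissible

  infix 4 _≈𝒜_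

  _≈𝒜_ : Rel 𝒜 0ℓ
  _≈𝒜_ = _≡_ on proj₁

  end : 𝒜 → W
  end (A , _) = u A (length (labels A))

  module _ (A : Subset r) where

    -- c₁ < ⋯ < cₜ₋₁. No sorting is needed, as d is weakly increasing along
    -- the chain.
    interior : List ℚ
    interior = deduplicate ℚₚ._≟_
      (filter (λ q → (0ℚ ℚₚ.<? q) ×-dec (q ℚₚ.<? 1ℚ)) (List.map dᵏ (elements A)))

    t-1 : ℕ
    t-1 = length interior

    -- c₁,…,cₜ
    c : Vec ℚ (1 ℕ.+ t-1)
    c = fromList interior Vec.∷ʳ 1ℚ

    -- m₁,…,mₜ
    m : Vec ℕ (1 ℕ.+ t-1)
    m = Vec.map (λ q → length (filter (λ j → dᵏ j ℚₚ.<? q) (elements A))) c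

    -- #{ b ∣ p < b ≤ q , γ_{j_b} ∈ -Δ⁺ }
    #negative : ℕ → ℕ → ℕ
    #negative p q = length
      (filter (λ j → sgn (γ j) Signₚ.≟ Sign.-) (take (q ∸ p) (drop p (elements A))))

    -- n₁,…,nₜ₋₁
    n : Vec ℕ t-1
    n = tabulate λ a →
      let mₐ = lookup m (inject₁ a) ; mₐ₊₁ = lookup m (Fin.suc a)
      in mₐ ℕ.+ #negative mₐ mₐ₊₁

  Ξ : 𝒜 → Triple
  Ξ (A , _) = record
    { s-1 = t-1 A
    ; x   = reverse (Vec.map (u A) (m A))
    ; y   = reverse (Vec.map (u A) (n A))
    ; σ   = reverse (Vec.map (λ q → 1ℚ ℚ.- q) (0ℚ ∷ c A))
    }

  -- The first component ranges over all triples: Ξ(A) need not satisfy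
  -- y-distinct. In type A₂ with ⟨λ,α₁^∨⟩ = -2 and ⟨λ,α₂^∨⟩ = 5, for w = e and
  -- A = {-α₁^∨ + δ̃, α₂^∨ + 3δ̃} one gets y₁ = y₂ = s₁. Injectivity does not
  -- depend on the choice of codomain.
  Ξ̃ : 𝒜 → Triple × W
  Ξ̃ A = Ξ A , end A

  infix 4 _≈̃_

  _≈̃_ : Rel (Triple × W) 0ℓ
  (η , x) ≈̃ (η′ , x′) = η ≈ᵀ η′ × x ≈ x′

module Submission where

-- Between consecutive checkpoints u_{m_a}, u_{n_a} recorded by Ξ (and the two
-- ends w, end(A)), all labels have the same value of d and the same sign, so
-- they strictly decrease for ◁. Injectivity therefore amounts to: a path in
-- the quantum Bruhat graph that is monotone for a reflection order is
-- determined by its ends.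
--
-- To prove this, fix a simple affine root a (a simple root, or -θ with θ a
-- highest root) and consider the sign of x⁻¹a along a path. A step x → x s_γ
-- on which the sign falls from + to - is the step x → s_a x, and steps on
-- which the sign is constant are translated to edges by s_a. Hence, if the
-- source is on the + side, deleting the first falling step (target on the -
-- side), or inserting a falling step after the last rise (target on the +
-- side), sends paths u → v to paths s_a u → v, respectively u → s_a v. In a
-- monotone path the place of the inserted label is forced by the order, since
-- s_δ preserves the two sides of δ in each plane of roots; so both operations
-- preserve monotonicity and are injective. They transport uniqueness from the
-- source s_a u to the source u, and because Σ aᵢ αᵢ - θ = 0 the resulting
-- relation on the finite group W is symmetric. It remains to treat u = e,
-- where one raises v to the longest element, then u to v; closed monotone
-- paths are empty, as insertion followed by deletion never lowers the labels.

open import Defs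
open import Level using (Level; 0ℓ)
open import Relation.Binary using (Rel; IsStrictTotalOrder)
open import Function.Definitions using (Injective)
open import Data.Empty using (⊥; ⊥-elim)
open import Data.Fin as Fin using (Fin; zero; suc)
open import Data.List as List using (List; []; _∷_; _++_; length)
open import Data.Nat as ℕ using (ℕ; zero; suc)
open import Data.Product using (∃; ∃-syntax; _×_; _,_; proj₁; proj₂)
open import Data.Sum using (_⊎_; inj₁; inj₂)
open import Data.Unit using (⊤; tt)
open import Function using (_∘_; flip)
open import Relation.Nullary using (¬_; Dec; yes; no)
open import Relation.Binary.Definitions using (Tri; tri<; tri≈; tri>)
open import Relation.Binary.PropositionalEquality hiding (J)

-- Edges are defined through lengths of words, on which left multiplication by the reflection in
-- `-θ` has no simple effect. The sum `J` of products of signs takes the place of length: one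
-- formula for the sign of `s_a β`, linear in `β` up to corrections at `±a`, holds for both kinds of
-- simple affine root, and summing it over all roots makes the effect of `s_a` on `J` explicit. A
-- step that is an edge at `x` then fails to be one at `s_a x` only by 4 times a difference of two
-- signs, so one calculation serves Bruhat and quantum edges alike. The obstacle is that deletion
-- and insertion want the source on the + side. They carry uniqueness from `x` to `s_a x` only if
-- `x⁻¹a` is negative; for simple `a` this leads from longer elements to shorter ones, hence nowhere
-- from the identity, and `-θ` is what leads back. The averaging argument that makes the relation
-- symmetric has to decide a property that quantifies over all paths, so it yields a double
-- negation; this is harmless, because the final claims are a contradiction and a decidable equality
-- of lists.

-- Integer inequalities and finite sums

module IntegerSums where
  open import Data.Integer hiding (suc; pred; neg; _/_; _%_) public
  open import Data.Integer.Properties public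
  open import Data.Integer.Tactic.RingSolver using (solve-∀) public
  open import Data.Fin.Permutation using (permutation)
  open import Data.Fin.Properties using (any?)
  import Algebra.Properties.Semiring.Sum as SemiringSum
  private module S = SemiringSum +-*-semiring

  2ℤ 4ℤ : ℤ
  2ℤ = + 2
  4ℤ = + 4

  0≤+ : ∀ {a b} → 0ℤ ≤ a → 0ℤ ≤ b → 0ℤ ≤ a + b
  0≤+ = +-mono-≤

  0≤* : ∀ {a b} → 0ℤ ≤ a → 0ℤ ≤ b → 0ℤ ≤ a * b
  0≤* {+ a} {+ b} _ _ = subst (0ℤ ≤_) (pos-* a b) (+≤+ ℕ.z≤n)

  0<* : ∀ {a b} → 0ℤ < a → 0ℤ < b → 0ℤ < a * b
  0<* {+ suc a} {+ suc b} _ _ = +<+ (ℕ.s≤s ℕ.z≤n)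
  0<* {+ zero} (+<+ ())
  0<* {+ suc a} {+ zero} _ (+<+ ())

  0<⇒1≤ : ∀ {a} → 0ℤ < a → 1ℤ ≤ a
  0<⇒1≤ {+ suc a} _ = +≤+ (ℕ.s≤s ℕ.z≤n)
  0<⇒1≤ {+ zero} (+<+ ())

  <⇒0<- : ∀ {a b} → a < b → 0ℤ < b - a
  <⇒0<- {a} {b} a<b = subst (_< b - a) (+-inverseʳ a) (+-monoˡ-< (- a) a<b)

  0<-⇒< : ∀ {a b} → 0ℤ < b - a → a < b
  0<-⇒< {a} {b} h = subst₂ _<_ (+-identityˡ a) (e a b) (+-monoˡ-< a h)
    where
    e : ∀ a b → b - a + a ≡ b
    e = solve-∀

  neg⇒0< : ∀ {a} → a < 0ℤ → 0ℤ < - a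
  neg⇒0< {a} h = subst (0ℤ <_) (+-identityˡ (- a)) (<⇒0<- h)

  ≢0⇒0<²  : ∀ {a} → a ≢ 0ℤ → 0ℤ < a * a
  ≢0⇒0<² {+ zero} h = ⊥-elim (h refl)
  ≢0⇒0<² {+ suc a} h = +<+ (ℕ.s≤s ℕ.z≤n)
  ≢0⇒0<² { -[1+ a ]} h = +<+ (ℕ.s≤s ℕ.z≤n)

  0≤² : ∀ a → 0ℤ ≤ a * a
  0≤² (+ zero) = +≤+ ℕ.z≤n
  0≤² (+ suc a) = +≤+ ℕ.z≤n
  0≤² -[1+ a ] = +≤+ ℕ.z≤n

  pos-factor : ∀ {a b} → 0ℤ < a → 0ℤ < a * b → 0ℤ < b
  pos-factor {+ zero} (+<+ ())
  pos-factor {+ suc a} {+ zero} _ h = ⊥-elim (<-irrefl (sym (*-zeroʳ (+ suc a))) h)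
  pos-factor {+ suc a} {+ suc b} _ _ = +<+ (ℕ.s≤s ℕ.z≤n)
  pos-factor {+ suc a} { -[1+ b ]} _ ()

  abstract
    sum : ∀ {n} → (Fin n → ℤ) → ℤ
    sum = S.sum

    sum-[] : (f : Fin 0 → ℤ) → sum f ≡ 0ℤ
    sum-[] f = refl

    sum-suc : ∀ {n} (f : Fin (suc n) → ℤ) → sum f ≡ f zero + sum (f ∘ suc)
    sum-suc f = refl

    sum-cong-≗ : ∀ {n} {f g : Fin n → ℤ} → (∀ i → f i ≡ g i) → sum f ≡ sum g
    sum-cong-≗ = S.sum-cong-≗

    ∑-distrib-+ : ∀ {n} (f g : Fin n → ℤ) → sum (λ i → f i + g i) ≡ sum f + sum g
    ∑-distrib-+ = S.∑-distrib-+

    ∑-comm : ∀ {m n} (f : Fin m → Fin n → ℤ) →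
      sum (λ i → sum (λ j → f i j)) ≡ sum (λ j → sum (λ i → f i j))
    ∑-comm = S.∑-comm

    sum-zero : ∀ {n} (f : Fin n → ℤ) → (∀ i → f i ≡ 0ℤ) → sum f ≡ 0ℤ
    sum-zero {n} f h = trans (sum-cong-≗ h) (S.sum-replicate-zero n)

    sum-nonNeg : ∀ {n} (f : Fin n → ℤ) → (∀ i → 0ℤ ≤ f i) → 0ℤ ≤ sum f
    sum-nonNeg {zero}  f h = ≤-refl
    sum-nonNeg {suc n} f h = 0≤+ (h zero) (sum-nonNeg (f ∘ suc) (h ∘ suc))

    term≤sum : ∀ {n} (f : Fin n → ℤ) → (∀ i → 0ℤ ≤ f i) → ∀ i → f i ≤ sum f
    term≤sum f h zero = subst (_≤ sum f) (+-identityʳ (f zero))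
      (+-monoʳ-≤ (f zero) (sum-nonNeg (f ∘ suc) (h ∘ suc)))
    term≤sum f h (suc i) = ≤-trans (term≤sum (f ∘ suc) (h ∘ suc) i)
      (subst (_≤ sum f) (+-identityˡ _) (+-monoˡ-≤ (sum (f ∘ suc)) (h zero)))

    sum-nonNeg-zero : ∀ {n} (f : Fin n → ℤ) → (∀ i → 0ℤ ≤ f i) → sum f ≡ 0ℤ → ∀ i → f i ≡ 0ℤ
    sum-nonNeg-zero f h e i = ≤-antisym (subst (f i ≤_) e (term≤sum f h i)) (h i)

    sum-neg : ∀ {n} (f : Fin n → ℤ) → sum (λ i → - f i) ≡ - sum f
    sum-neg {zero}  f = refl
    sum-neg {suc n} f = trans (cong (λ y → - f zero + y) (sum-neg (f ∘ suc))) (sym (neg-distrib-+ (f zero) _))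

    sum-minus : ∀ {n} (f g : Fin n → ℤ) → sum (λ i → f i - g i) ≡ sum f - sum g
    sum-minus f g = trans (∑-distrib-+ f (λ i → - g i)) (cong (λ y → sum f + y) (sum-neg g))

    sum-scale : ∀ {n} (a : ℤ) (f : Fin n → ℤ) → sum (λ i → a * f i) ≡ a * sum f
    sum-scale a f = sym (S.*-distribˡ-sum a f)

    sum-single : ∀ {n} (f : Fin n → ℤ) j → (∀ i → i ≢ j → f i ≡ 0ℤ) → sum f ≡ f j
    sum-single f zero h = trans (cong (λ y → f zero + y) (sum-zero (f ∘ suc) (λ i → h (suc i) λ ()))) (+-identityʳ _)
    sum-single f (suc j) h = trans (cong₂ _+_ (h zero λ ()) (sum-single (f ∘ suc) j λ i ne → h (suc i) λ { refl → ne refl })) (+-identityˡ _)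

    sum-involution : ∀ {n} (f : Fin n → ℤ) (σ : Fin n → Fin n) → (∀ i → σ (σ i) ≡ i) →
      sum f ≡ sum (f ∘ σ)
    sum-involution f σ inv = S.sum-permute f (permutation σ σ inv inv)

    sum-mono-≤ : ∀ {n} (f g : Fin n → ℤ) → (∀ i → f i ≤ g i) → sum f ≤ sum g
    sum-mono-≤ f g h = 0≤i-j⇒j≤i (subst (0ℤ ≤_) (sum-minus g f) (sum-nonNeg _ λ i → i≤j⇒0≤j-i (h i)))

    sum-ones : ∀ n → sum {n} (λ _ → 1ℤ) ≡ + n
    sum-ones zero = refl
    sum-ones (suc n) = cong (λ y → 1ℤ + y) (sum-ones n)

    sum-pos⇒term-pos : ∀ {n} (f : Fin n → ℤ) → 0ℤ < sum f → ∃[ i ] 0ℤ < f i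
    sum-pos⇒term-pos {zero} f (+<+ ())
    sum-pos⇒term-pos {suc n} f h with 0ℤ <? f zero
    ... | yes p = zero , p
    ... | no ¬p with sum-pos⇒term-pos (f ∘ suc) (<-≤-trans h (subst (sum f ≤_) (+-identityˡ _) (+-monoˡ-≤ (sum (f ∘ suc)) (≮⇒≥ ¬p))))
    ... | i , q = suc i , q

  *≡0⇒ˡ : ∀ {a b} → a * b ≡ 0ℤ → b ≢ 0ℤ → a ≡ 0ℤ
  *≡0⇒ˡ {a} e ne with i*j≡0⇒i≡0∨j≡0 a e
  ... | inj₁ p = p
  ... | inj₂ p = ⊥-elim (ne p)

  *≡0⇒ʳ : ∀ {a b} → a * b ≡ 0ℤ → a ≢ 0ℤ → b ≡ 0ℤ
  *≡0⇒ʳ {a} e ne with i*j≡0⇒i≡0∨j≡0 a e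
  ... | inj₁ p = ⊥-elim (ne p)
  ... | inj₂ p = p

  ²≡0 : ∀ {a} → a * a ≡ 0ℤ → a ≡ 0ℤ
  ²≡0 {a} e with i*j≡0⇒i≡0∨j≡0 a e
  ... | inj₁ p = p
  ... | inj₂ p = p

  δ : ∀ {n} → Fin n → Fin n → ℤ
  δ j i with i Fin.≟ j
  ... | yes _ = 1ℤ
  ... | no  _ = 0ℤ

  δ-self : ∀ {n} (j : Fin n) → δ j j ≡ 1ℤ
  δ-self j with j Fin.≟ j
  ... | yes _ = refl
  ... | no ne = ⊥-elim (ne refl)

  δ-other : ∀ {n} (j i : Fin n) → i ≢ j → δ j i ≡ 0ℤ
  δ-other j i ne with i Fin.≟ j
  ... | yes e = ⊥-elim (ne e)
  ... | no _ = refl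

  argmax : ∀ {n} (f : Fin n → ℤ) {P : Fin n → Set} → (∀ i → Dec (P i)) → ∀ i → P i →
    ∃[ m ] P m × (∀ k → P k → f k ≤ f m)
  argmax {suc n} f {P} P? i Pi with any? (P? ∘ suc)
  ... | no ¬∃ = i , Pi , λ k Pk → ≤-reflexive (cong f (trans (only k Pk) (sym (only i Pi))))
    where
    only : ∀ k → P k → k ≡ zero
    only zero _ = refl
    only (suc k) Pk = ⊥-elim (¬∃ (k , Pk))
  ... | yes (j , Pj) with argmax (f ∘ suc) (P? ∘ suc) j Pj | P? zero
  ... | m , Pm , h | no ¬P0 = suc m , Pm , λ { zero P0 → ⊥-elim (¬P0 P0) ; (suc k) Pk → h k Pk }
  ... | m , Pm , h | yes P0 with f zero ≤? f (suc m)
  ... | yes le = suc m , Pm , λ { zero _ → le ; (suc k) Pk → h k Pk }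
  ... | no ≰ = zero , P0 , λ { zero _ → ≤-refl ; (suc k) Pk → ≤-trans (h k Pk) (<⇒≤ (≰⇒> ≰)) }

-- Linear algebra over the rationals

module RationalVectors where
  open import Data.Integer as ℤ using (ℤ; +_)
  import Data.Integer.Properties as ℤₚ
  open import Data.Rational hiding (truncate)
  open import Data.Rational.Properties
  import Data.Rational.Unnormalised as ℚᵘ
  import Data.Rational.Unnormalised.Properties as ℚᵘₚ
  open import Data.Rational.Solver using (module +-*-Solver)
  open import Data.Vec as Vec using (Vec; []; _∷_)
  open IntegerSums using (sum; sum-[]; sum-suc)
  open import Algebra using (Ring)
  import Algebra.Properties.Semiring.Sum as SemiringSum
  module ℚΣ = SemiringSum (Ring.semiring +-*-ring)
  open +-*-Solver using (solve; _:+_; _:*_; _:-_; _:=_; :-_; con)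

  toℚᵘ-toℚ : ∀ z → toℚᵘ (toℚ z) ℚᵘ.≃ ℚᵘ.mkℚᵘ z 0
  toℚᵘ-toℚ z = toℚᵘ-fromℚᵘ (ℚᵘ.mkℚᵘ z 0)

  toℚ-injective : ∀ {a b} → toℚ a ≡ toℚ b → a ≡ b
  toℚ-injective {a} {b} e with ℚᵘₚ.≃-trans (ℚᵘₚ.≃-sym (toℚᵘ-toℚ a)) (ℚᵘₚ.≃-trans (ℚᵘₚ.≃-reflexive (cong toℚᵘ e)) (toℚᵘ-toℚ b))
  ... | ℚᵘ.*≡* h = trans (sym (ℤₚ.*-identityʳ a)) (trans h (ℤₚ.*-identityʳ b))

  toℚ-+ : ∀ a b → toℚ (a ℤ.+ b) ≡ toℚ a + toℚ b
  toℚ-+ a b = toℚᵘ-injective (ℚᵘₚ.≃-trans (toℚᵘ-toℚ (a ℤ.+ b)) (ℚᵘₚ.≃-sym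
    (ℚᵘₚ.≃-trans (toℚᵘ-homo-+ (toℚ a) (toℚ b))
    (ℚᵘₚ.≃-trans (ℚᵘₚ.+-cong (toℚᵘ-toℚ a) (toℚᵘ-toℚ b))
    (ℚᵘ.*≡* (cong (ℤ._* + 1) (cong₂ ℤ._+_ (ℤₚ.*-identityʳ a) (ℤₚ.*-identityʳ b))))))))

  toℚ-* : ∀ a b → toℚ (a ℤ.* b) ≡ toℚ a * toℚ b
  toℚ-* a b = toℚᵘ-injective (ℚᵘₚ.≃-trans (toℚᵘ-toℚ (a ℤ.* b)) (ℚᵘₚ.≃-sym
    (ℚᵘₚ.≃-trans (toℚᵘ-homo-* (toℚ a) (toℚ b))
    (ℚᵘₚ.≃-trans (ℚᵘₚ.*-cong (toℚᵘ-toℚ a) (toℚᵘ-toℚ b))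
    (ℚᵘ.*≡* refl)))))

  toℚ-neg : ∀ a → toℚ (ℤ.- a) ≡ - toℚ a
  toℚ-neg a = toℚᵘ-injective (ℚᵘₚ.≃-trans (toℚᵘ-toℚ (ℤ.- a)) (ℚᵘₚ.≃-sym
    (ℚᵘₚ.≃-trans (toℚᵘ-homo‿- (toℚ a))
    (ℚᵘₚ.≃-trans (ℚᵘₚ.-‿cong (toℚᵘ-toℚ a)) (ℚᵘ.*≡* refl)))))

  toℚ-- : ∀ a b → toℚ (a ℤ.- b) ≡ toℚ a - toℚ b
  toℚ-- a b = trans (toℚ-+ a (ℤ.- b)) (cong (λ y → toℚ a + y) (toℚ-neg b))

  toℚ-sum : ∀ {m} (f : Fin m → ℤ) → toℚ (sum f) ≡ ℚΣ.sum (toℚ ∘ f)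
  toℚ-sum {zero}  f = cong toℚ (sum-[] f)
  toℚ-sum {suc m} f = trans (cong toℚ (sum-suc f)) (trans (toℚ-+ (f zero) (sum (f ∘ suc))) (cong (λ y → toℚ (f zero) + y) (toℚ-sum (f ∘ suc))))

  comb : ∀ {n m} → (Fin m → ℚ) → (Fin m → Vec ℚ n) → Vec ℚ n
  comb a v = ∑ λ i → a i • v i

  ⟨-⟩ : ∀ {n} (u v f : Vec ℚ n) → ⟨ u -ᵥ v , f ⟩ ≡ ⟨ u , f ⟩ - ⟨ v , f ⟩
  ⟨-⟩ [] [] [] = refl
  ⟨-⟩ (x ∷ u) (y ∷ v) (z ∷ f) rewrite ⟨-⟩ u v f =
    solve 5 (λ x y z a b → (x :- y) :* z :+ (a :- b) := (x :* z :+ a) :- (y :* z :+ b)) refl x y z ⟨ u , f ⟩ ⟨ v , f ⟩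

  ⟨+⟩ : ∀ {n} (u v f : Vec ℚ n) → ⟨ u +ᵥ v , f ⟩ ≡ ⟨ u , f ⟩ + ⟨ v , f ⟩
  ⟨+⟩ [] [] [] = refl
  ⟨+⟩ (x ∷ u) (y ∷ v) (z ∷ f) rewrite ⟨+⟩ u v f =
    solve 5 (λ x y z a b → (x :+ y) :* z :+ (a :+ b) := (x :* z :+ a) :+ (y :* z :+ b)) refl x y z ⟨ u , f ⟩ ⟨ v , f ⟩

  ⟨•⟩ : ∀ {n} c (v f : Vec ℚ n) → ⟨ c • v , f ⟩ ≡ c * ⟨ v , f ⟩
  ⟨•⟩ c [] [] = sym (*-zeroʳ c)
  ⟨•⟩ c (y ∷ v) (z ∷ f) rewrite ⟨•⟩ c v f =
    solve 4 (λ c y z b → (c :* y) :* z :+ (c :* b) := c :* (y :* z :+ b)) refl c y z ⟨ v , f ⟩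

  ⟨0⟩ : ∀ {n} (f : Vec ℚ n) → ⟨ 0ᵥ , f ⟩ ≡ 0ℚ
  ⟨0⟩ [] = refl
  ⟨0⟩ (z ∷ f) rewrite ⟨0⟩ f | *-zeroˡ z = refl

  ⟨∑⟩ : ∀ {n m} (v : Fin m → Vec ℚ n) (f : Vec ℚ n) → ⟨ ∑ v , f ⟩ ≡ ℚΣ.sum (λ i → ⟨ v i , f ⟩)
  ⟨∑⟩ {m = zero}  v f = ⟨0⟩ f
  ⟨∑⟩ {m = suc m} v f = trans (⟨+⟩ (v zero) _ f) (cong (λ y → ⟨ v zero , f ⟩ + y) (⟨∑⟩ (v ∘ suc) f))

  ⟨comb⟩ : ∀ {n m} (a : Fin m → ℚ) (v : Fin m → Vec ℚ n) f → ⟨ comb a v , f ⟩ ≡ ℚΣ.sum (λ i → a i * ⟨ v i , f ⟩)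
  ⟨comb⟩ a v f = trans (⟨∑⟩ (λ i → a i • v i) f) (ℚΣ.sum-cong-≗ (λ i → ⟨•⟩ (a i) (v i) f))

  ∑-cong : ∀ {n m} {u v : Fin m → Vec ℚ n} → (∀ i → u i ≡ v i) → ∑ u ≡ ∑ v
  ∑-cong {m = zero}  h = refl
  ∑-cong {m = suc m} h = cong₂ _+ᵥ_ (h zero) (∑-cong (h ∘ suc))

  v-v : ∀ {n} (v : Vec ℚ n) → v -ᵥ 1ℚ • v ≡ 0ᵥ
  v-v [] = refl
  v-v (x ∷ v) = cong₂ _∷_ (trans (cong (λ y → x - y) (*-identityˡ x)) (+-inverseʳ x)) (v-v v)

  1•v : ∀ {n} (v : Vec ℚ n) → 1ℚ • v ≡ v
  1•v [] = refl
  1•v (x ∷ v) = cong₂ _∷_ (*-identityˡ x) (1•v v)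

  comb-step : ∀ {n} (a b k : ℚ) (x u v : Vec ℚ n) →
    (a - k * b) • x +ᵥ (u -ᵥ k • v) ≡ (a • x +ᵥ u) -ᵥ k • (b • x +ᵥ v)
  comb-step a b k [] [] [] = refl
  comb-step a b k (x ∷ xs) (u ∷ us) (v ∷ vs) = cong₂ _∷_
    (solve 6 (λ a b k x u v → (a :- k :* b) :* x :+ (u :- k :* v) := (a :* x :+ u) :- k :* (b :* x :+ v)) refl a b k x u v)
    (comb-step a b k xs us vs)

  0-k0 : ∀ {n} k → 0ᵥ {n} ≡ 0ᵥ -ᵥ k • 0ᵥ
  0-k0 {zero} k = refl
  0-k0 {suc n} k = cong₂ _∷_ (solve 1 (λ k → con 0ℚ := con 0ℚ :- k :* con 0ℚ) refl k) (0-k0 k)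

  comb-minus : ∀ {n m} (a b : Fin m → ℚ) k (v : Fin m → Vec ℚ n) →
    comb (λ i → a i - k * b i) v ≡ comb a v -ᵥ k • comb b v
  comb-minus {m = zero}  a b k v = 0-k0 k
  comb-minus {m = suc m} a b k v = trans
    (cong ((a zero - k * b zero) • v zero +ᵥ_) (comb-minus (a ∘ suc) (b ∘ suc) k (v ∘ suc)))
    (comb-step (a zero) (b zero) k (v zero) _ _)

  -ᵥ-comb-step : ∀ {n} (a b k : ℚ) (x u y : Vec ℚ n) →
    (a • x +ᵥ u) -ᵥ (a * b + k) • y ≡ a • (x -ᵥ b • y) +ᵥ (u -ᵥ k • y)
  -ᵥ-comb-step a b k [] [] [] = refl
  -ᵥ-comb-step a b k (x ∷ xs) (u ∷ us) (y ∷ ys) = cong₂ _∷_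
    (solve 6 (λ a b k x u y → (a :* x :+ u) :- (a :* b :+ k) :* y := a :* (x :- b :* y) :+ (u :- k :* y)) refl a b k x u y)
    (-ᵥ-comb-step a b k xs us ys)

  0-0• : ∀ {n} (v : Vec ℚ n) → 0ᵥ ≡ 0ᵥ -ᵥ 0ℚ • v
  0-0• [] = refl
  0-0• (x ∷ v) = cong₂ _∷_ (solve 1 (λ x → con 0ℚ := con 0ℚ :- con 0ℚ :* x) refl x) (0-0• v)

  0• : ∀ {n} (v : Vec ℚ n) → 0ℚ • v ≡ 0ᵥ
  0• [] = refl
  0• (x ∷ v) = cong₂ _∷_ (*-zeroˡ x) (0• v)

  +ᵥ-identityˡ : ∀ {n} (v : Vec ℚ n) → 0ᵥ +ᵥ v ≡ v
  +ᵥ-identityˡ [] = refl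
  +ᵥ-identityˡ (x ∷ v) = cong₂ _∷_ (+-identityˡ x) (+ᵥ-identityˡ v)

  +ᵥ-identityʳ : ∀ {n} (v : Vec ℚ n) → v +ᵥ 0ᵥ ≡ v
  +ᵥ-identityʳ [] = refl
  +ᵥ-identityʳ (x ∷ v) = cong₂ _∷_ (+-identityʳ x) (+ᵥ-identityʳ v)

  comb-zero : ∀ {n m} (a : Fin m → ℚ) (v : Fin m → Vec ℚ n) → (∀ i → a i ≡ 0ℚ) → comb a v ≡ 0ᵥ
  comb-zero {m = zero} a v h = refl
  comb-zero {m = suc m} a v h rewrite h zero | comb-zero (a ∘ suc) (v ∘ suc) (h ∘ suc) | 0• (v zero) = +ᵥ-identityˡ _

  comb-single : ∀ {n m} (a : Fin m → ℚ) (v : Fin m → Vec ℚ n) j → (∀ i → i ≢ j → a i ≡ 0ℚ) → comb a v ≡ a j • v j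
  comb-single a v zero h rewrite comb-zero (a ∘ suc) (v ∘ suc) (λ i → h (suc i) λ ()) = +ᵥ-identityʳ _
  comb-single a v (suc j) h rewrite h zero (λ ()) | 0• (v zero) = trans (+ᵥ-identityˡ _)
    (comb-single (a ∘ suc) (v ∘ suc) j λ i ne → h (suc i) λ { refl → ne refl })

  comb-plus-step : ∀ {n} (a b : ℚ) (x u v : Vec ℚ n) →
    (a + b) • x +ᵥ (u +ᵥ v) ≡ (a • x +ᵥ u) +ᵥ (b • x +ᵥ v)
  comb-plus-step a b [] [] [] = refl
  comb-plus-step a b (x ∷ xs) (u ∷ us) (v ∷ vs) = cong₂ _∷_
    (solve 5 (λ a b x u v → (a :+ b) :* x :+ (u :+ v) := (a :* x :+ u) :+ (b :* x :+ v)) refl a b x u v)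
    (comb-plus-step a b xs us vs)

  comb-plus : ∀ {n m} (a b : Fin m → ℚ) (v : Fin m → Vec ℚ n) →
    comb (λ i → a i + b i) v ≡ comb a v +ᵥ comb b v
  comb-plus {m = zero}  a b v = sym (+ᵥ-identityˡ _)
  comb-plus {m = suc m} a b v = trans
    (cong ((a zero + b zero) • v zero +ᵥ_) (comb-plus (a ∘ suc) (b ∘ suc) (v ∘ suc)))
    (comb-plus-step (a zero) (b zero) (v zero) _ _)

-- Integer coordinates of roots and the action on roots

module Coordinates (Φ : RootSystem) (Π : Base Φ) where
  import Data.Rational as ℚ
  import Data.Rational.Properties as ℚₚ
  import Data.Sign as Sign
  open IntegerSums
  open RationalVectors
  open RootSystem Φ
  open Base Π
  open WeylGroup Φ
  open QuantumBruhatGraph Φ Π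

  Pos Neg : Root → Set
  Pos = IsPositive
  Neg = IsNegative

  abstract
    cf : Root → Fin rank → ℤ
    cf β i = sgn β ◃ coeff β i

    -- The Cartan integer ⟨β, α^∨⟩: additive in `β`, while `α` enters through its coroot.
    c : Root → Root → ℤ
    c β α = proj₁ (integrality α β)

    root-cf : ∀ β → root β ≡ comb (λ i → toℚ (cf β i)) (root ∘ simple)
    root-cf = decomposition

    c-correct : ∀ β α → ⟨ root β , coroot α ⟩ ≡ toℚ (c β α)
    c-correct β α = proj₂ (integrality α β)

    pos-cf : ∀ {β} → Pos β → ∀ i → 0ℤ ≤ cf β i
    pos-cf {β} p i rewrite p | +◃n≡+n (coeff β i) = +≤+ ℕ.z≤n

    neg-cf : ∀ {β} → Neg β → ∀ i → cf β i ≤ 0ℤ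
    neg-cf {β} p i rewrite p | -◃n≡-n (coeff β i) = neg-≤0 where
      neg-≤0 : - + coeff β i ≤ 0ℤ
      neg-≤0 = neg-mono-≤ {+ 0} (+≤+ ℕ.z≤n)

  pos⊎neg : ∀ β → Pos β ⊎ Neg β
  pos⊎neg β with sgn β
  ... | Sign.+ = inj₁ refl
  ... | Sign.- = inj₂ refl

  pos-neg : ∀ {β} → Pos β → Neg β → ⊥
  pos-neg p n with trans (sym p) n
  ... | ()

  comb-injective : ∀ (a b : Fin rank → ℤ) →
    comb (toℚ ∘ a) (root ∘ simple) ≡ comb (toℚ ∘ b) (root ∘ simple) → ∀ i → a i ≡ b i
  comb-injective a b e i = sym (i-j≡0⇒i≡j (b i) (a i) (toℚ-injective (begin
    toℚ (b i - a i)             ≡⟨ toℚ-- (b i) (a i) ⟩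
    toℚ (b i) ℚ.- toℚ (a i)     ≡⟨ cong (λ y → toℚ (b i) ℚ.- y) (ℚₚ.*-identityˡ (toℚ (a i))) ⟨
    d i                         ≡⟨ independent d zero-comb i ⟩
    ℚ.0ℚ                        ∎)))
    where
    open ≡-Reasoning
    d : Fin rank → ℚ.ℚ
    d i = toℚ (b i) ℚ.- ℚ.1ℚ ℚ.* toℚ (a i)
    zero-comb : comb d (root ∘ simple) ≡ 0ᵥ
    zero-comb = begin
      comb d (root ∘ simple)                              ≡⟨ comb-minus (toℚ ∘ b) (toℚ ∘ a) ℚ.1ℚ _ ⟩
      comb (toℚ ∘ b) _ -ᵥ ℚ.1ℚ • comb (toℚ ∘ a) _       ≡⟨ cong (λ y → comb (toℚ ∘ b) _ -ᵥ ℚ.1ℚ • y) e ⟩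
      comb (toℚ ∘ b) _ -ᵥ ℚ.1ℚ • comb (toℚ ∘ b) _       ≡⟨ v-v _ ⟩
      0ᵥ ∎

  cf-injective : ∀ {α β} → (∀ i → cf α i ≡ cf β i) → α ≡ β
  cf-injective {α} {β} h = root-injective (trans (root-cf α) (trans (∑-cong (λ i → cong (λ y → toℚ y • root (simple i)) (h i))) (sym (root-cf β))))

  c-self : ∀ α → c α α ≡ + 2
  c-self α = toℚ-injective (trans (sym (c-correct α α)) (pairing-self α))

  cf-minus : ∀ {α β γ} k → root γ ≡ root β -ᵥ toℚ k • root α → ∀ i → cf γ i ≡ cf β i - k * cf α i
  cf-minus {α} {β} {γ} k e = comb-injective _ _ (begin
    comb (toℚcf γ) (root ∘ simple)         ≡⟨ root-cf γ ⟨
    root γ                                 ≡⟨ e ⟩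
    root β -ᵥ toℚ k • root α               ≡⟨ cong₂ (λ u v → u -ᵥ toℚ k • v) (root-cf β) (root-cf α) ⟩
    comb (toℚcf β) (root ∘ simple) -ᵥ toℚ k • comb (toℚcf α) (root ∘ simple)
      ≡⟨ comb-minus (toℚcf β) (toℚcf α) (toℚ k) (root ∘ simple) ⟨
    comb (λ i → toℚcf β i ℚ.- toℚ k ℚ.* toℚcf α i) (root ∘ simple)
      ≡⟨ ∑-cong (λ i → cong (_• root (simple i)) (trans (cong (λ y → toℚ (cf β i) ℚ.- y) (sym (toℚ-* k (cf α i)))) (sym (toℚ-- (cf β i) _)))) ⟩
    comb (λ i → toℚ (cf β i - k * cf α i)) (root ∘ simple) ∎)
    where
    open ≡-Reasoning
    toℚcf : Root → Fin rank → ℚ.ℚ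
    toℚcf α i = toℚ (cf α i)

  root-reflectℤ : ∀ α β → root (reflect α β) ≡ root β -ᵥ toℚ (c β α) • root α
  root-reflectℤ α β = trans (root-reflect α β) (cong (λ y → root β -ᵥ y • root α) (c-correct β α))

  cf-reflect : ∀ α β i → cf (reflect α β) i ≡ cf β i - c β α * cf α i
  cf-reflect α β = cf-minus {α} {β} (c β α) (root-reflectℤ α β)

  c-expand : ∀ β α → c β α ≡ sum (λ k → cf β k * c (simple k) α)
  c-expand β α = toℚ-injective (begin
    toℚ (c β α)                       ≡⟨ c-correct β α ⟨
    ⟨ root β , coroot α ⟩              ≡⟨ cong (λ y → ⟨ y , coroot α ⟩) (root-cf β) ⟩
    ⟨ comb (toℚ ∘ cf β) (root ∘ simple) , coroot α ⟩ ≡⟨ ⟨comb⟩ (toℚ ∘ cf β) (root ∘ simple) (coroot α) ⟩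
    ℚΣ.sum (λ k → toℚ (cf β k) ℚ.* ⟨ root (simple k) , coroot α ⟩)
      ≡⟨ ℚΣ.sum-cong-≗ (λ k → trans (cong (λ y → toℚ (cf β k) ℚ.* y) (c-correct (simple k) α)) (sym (toℚ-* (cf β k) _))) ⟩
    ℚΣ.sum (λ k → toℚ (cf β k * c (simple k) α)) ≡⟨ toℚ-sum (λ k → cf β k * c (simple k) α) ⟨
    toℚ (sum (λ k → cf β k * c (simple k) α)) ∎)
    where open ≡-Reasoning

  cf-simple : ∀ j i → cf (simple j) i ≡ δ j i
  cf-simple j = comb-injective _ (δ j) (trans (sym (root-cf (simple j))) (sym (trans
    (comb-single (toℚ ∘ δ j) (root ∘ simple) j (λ i ne → cong toℚ (δ-other j i ne)))
    (trans (cong (λ y → toℚ y • root (simple j)) (δ-self j)) (1•v _)))))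

  simple-positive : ∀ j → Pos (simple j)
  simple-positive j with pos⊎neg (simple j)
  ... | inj₁ p = p
  ... | inj₂ n with subst (_≤ 0ℤ) (trans (cf-simple j j) (δ-self j)) (neg-cf n j)
  ... | +≤+ ()

  positive-multiple : ∀ {β} j → Pos β → (∀ i → i ≢ j → cf β i ≡ 0ℤ) → β ≡ simple j
  positive-multiple {β} j p h with reduced (simple j) β (toℚ (cf β j))
      (trans (root-cf β) (comb-single _ _ j (λ i ne → cong toℚ (h i ne))))
  ... | inj₁ e = root-injective (trans (root-cf β) (trans (comb-single _ _ j (λ i ne → cong toℚ (h i ne)))
          (trans (cong (_• root (simple j)) e) (1•v _))))
  ... | inj₂ e with subst (0ℤ ≤_) (toℚ-injective {b = -1ℤ} e) (pos-cf p j)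
  ... | ()

  actR : W → Root → Root
  actR x β = List.foldr reflect β x

  s-comb : ∀ {m} α (a : Fin m → ℚ.ℚ) (v : Fin m → V) → s α (comb a v) ≡ comb a (s α ∘ v)
  s-comb α a v = trans (cong (λ y → comb a v -ᵥ y • root α) (⟨comb⟩ a v (coroot α))) (go a v)
    where
    go : ∀ {m} (a : Fin m → ℚ.ℚ) (v : Fin m → V) →
      comb a v -ᵥ ℚΣ.sum (λ i → a i ℚ.* ⟨ v i , coroot α ⟩) • root α ≡ comb a (s α ∘ v)
    go {zero}  a v = sym (0-0• (root α))
    go {suc m} a v = trans
      (-ᵥ-comb-step (a zero) ⟨ v zero , coroot α ⟩ (ℚΣ.sum (λ i → a (suc i) ℚ.* ⟨ v (suc i) , coroot α ⟩)) (v zero) (comb (a ∘ suc) (v ∘ suc)) (root α))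
      (cong (a zero • s α (v zero) +ᵥ_) (go (a ∘ suc) (v ∘ suc)))

  act-comb : ∀ {m} x (a : Fin m → ℚ.ℚ) (v : Fin m → V) → act x (comb a v) ≡ comb a (act x ∘ v)
  act-comb List.[] a v = refl
  act-comb (α List.∷ x) a v = trans (cong (s α) (act-comb x a v)) (s-comb α a (act x ∘ v))

  act-root : ∀ x β → act x (root β) ≡ root (actR x β)
  act-root List.[] β = refl
  act-root (α List.∷ x) β = trans (cong (s α) (act-root x β)) (sym (root-reflect α (actR x β)))

  infix 4 _~_
  -- Roots span V, so elements of W may be compared on the finite set Δ. A record rather than a bare
  -- function type lets `x` and `y` be inferred.
  record _~_ (x y : W) : Set where
    constructor mk~
    field at~ : ∀ β → actR x β ≡ actR y β
  open _~_ public

  ≈⇒~ : ∀ {x y} → x ≈ y → x ~ y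
  ≈⇒~ {x} {y} h = mk~ λ β → root-injective (trans (sym (act-root x β)) (trans (h (root β)) (act-root y β)))

  ~⇒≈ : ∀ {x y} → x ~ y → x ≈ y
  ~⇒≈ {x} {y} h v with spanning v
  ... | a , refl = trans (act-comb x a root) (trans (∑-cong (λ β → cong (a β •_)
      (trans (act-root x β) (trans (cong root (at~ h β)) (sym (act-root y β)))))) (sym (act-comb y a root)))

-- Invariance of the pairing and sums of roots

module RootTheory (Φ : RootSystem) (Π : Base Φ) where
  import Data.Nat.Properties as ℕₚ
  open import Data.Fin using (toℕ)
  import Data.Fin.Properties as Finₚ
  open IntegerSums
  open RootSystem Φ
  open Base Π
  open WeylGroup Φ
  open Coordinates Φ Π public

  infix 4 _≐_+_·_
  record _≐_+_·_ (γ β : Root) (k : ℤ) (α : Root) : Set where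
    constructor mk
    field at : ∀ i → cf γ i ≡ cf β i + k * cf α i
  open _≐_+_·_

  reflect≐ : ∀ α β → reflect α β ≐ β + (- c β α) · α
  reflect≐ α β = mk λ i → trans (cf-reflect α β i) (e (cf β i) (c β α) (cf α i))
    where
    e : ∀ x y z → x - y * z ≡ x + (- y) * z
    e = solve-∀

  abstract
    c-≐ : ∀ {α β γ k} → γ ≐ β + k · α → ∀ δ → c γ δ ≡ c β δ + k * c α δ
    c-≐ {α} {β} {γ} {k} h δ = begin
      c γ δ ≡⟨ c-expand γ δ ⟩
      sum (λ i → cf γ i * p i) ≡⟨ sum-cong-≗ (λ i → trans (cong (_* p i) (at h i)) (e (cf β i) k (cf α i) (p i))) ⟩
      sum (λ i → cf β i * p i + k * (cf α i * p i)) ≡⟨ ∑-distrib-+ (λ i → cf β i * p i) (λ i → k * (cf α i * p i)) ⟩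
      sum (λ i → cf β i * p i) + sum (λ i → k * (cf α i * p i)) ≡⟨ cong₂ _+_ (sym (c-expand β δ)) (trans (sum-scale k _) (cong (k *_) (sym (c-expand α δ)))) ⟩
      c β δ + k * c α δ ∎
      where
      open ≡-Reasoning
      p : Fin rank → ℤ
      p i = c (simple i) δ
      e : ∀ x k y p → (x + k * y) * p ≡ x * p + k * (y * p)
      e = solve-∀

    c-reflect : ∀ α β δ → c (reflect α β) δ ≡ c β δ - c β α * c α δ
    c-reflect α β δ = trans (c-≐ (reflect≐ α β) δ) (e (c β δ) (c β α) (c α δ))
      where
      e : ∀ x y z → x + (- y) * z ≡ x - y * z
      e = solve-∀

    reflect-≐ : ∀ {α β γ k} δ → γ ≐ β + k · α → reflect δ γ ≐ reflect δ β + k · reflect δ α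
    reflect-≐ {α} {β} {γ} {k} δ h = mk λ i → begin
      cf (reflect δ γ) i ≡⟨ cf-reflect δ γ i ⟩
      cf γ i - c γ δ * cf δ i ≡⟨ cong₂ (λ x y → x - y * cf δ i) (at h i) (c-≐ h δ) ⟩
      cf β i + k * cf α i - (c β δ + k * c α δ) * cf δ i ≡⟨ e (cf β i) k (cf α i) (c β δ) (c α δ) (cf δ i) ⟩
      (cf β i - c β δ * cf δ i) + k * (cf α i - c α δ * cf δ i) ≡⟨ cong₂ (λ x y → x + k * y) (cf-reflect δ β i) (cf-reflect δ α i) ⟨
      cf (reflect δ β) i + k * cf (reflect δ α) i ∎
      where
      open ≡-Reasoning
      e : ∀ b k a cb ca d → b + k * a - (cb + k * ca) * d ≡ (b - cb * d) + k * (a - ca * d)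
      e = solve-∀

    cf-neg : ∀ α i → cf (neg α) i ≡ - cf α i
    cf-neg α i = trans (cf-reflect α α i) (trans (cong (λ y → cf α i - y * cf α i) (c-self α)) (e (cf α i)))
      where
      e : ∀ x → x - + 2 * x ≡ - x
      e = solve-∀

    c-neg : ∀ α δ → c (neg α) δ ≡ - c α δ
    c-neg α δ = trans (c-reflect α α δ) (trans (cong (λ y → c α δ - y * c α δ) (c-self α)) (e (c α δ)))
      where
      e : ∀ x → x - + 2 * x ≡ - x
      e = solve-∀

    reflect-involutive : ∀ α β → reflect α (reflect α β) ≡ β
    reflect-involutive α β = cf-injective λ i → begin
      cf (reflect α (reflect α β)) i ≡⟨ cf-reflect α (reflect α β) i ⟩
      cf (reflect α β) i - c (reflect α β) α * cf α i
        ≡⟨ cong₂ (λ x y → x - y * cf α i) (cf-reflect α β i) (trans (c-reflect α β α) (cong (λ y → c β α - c β α * y) (c-self α))) ⟩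
      cf β i - c β α * cf α i - (c β α - c β α * + 2) * cf α i ≡⟨ e (cf β i) (c β α) (cf α i) ⟩
      cf β i ∎
      where
      open ≡-Reasoning
      e : ∀ b k a → b - k * a - (k - k * + 2) * a ≡ b
      e = solve-∀

    neg-neg : ∀ α → neg (neg α) ≡ α
    neg-neg α = cf-injective λ i → trans (cf-neg (neg α) i) (trans (cong -_ (cf-neg α i)) (neg-involutive (cf α i)))

    reflect-neg : ∀ α β → reflect α (neg β) ≡ neg (reflect α β)
    reflect-neg α β = cf-injective λ i → trans (cf-reflect α (neg β) i)
      (trans (cong₂ (λ x y → x - y * cf α i) (cf-neg β i) (c-neg β α))
      (trans (e (cf β i) (c β α) (cf α i)) (sym (trans (cf-neg (reflect α β) i) (cong -_ (cf-reflect α β i))))))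
      where
      e : ∀ b k a → - b - (- k) * a ≡ - (b - k * a)
      e = solve-∀

  reflect-fixed : ∀ β α → c β α ≡ 0ℤ → reflect α β ≡ β
  reflect-fixed β α e = cf-injective λ i → trans (cf-reflect α β i) (trans (cong (λ y → cf β i - y * cf α i) e) (e₁ (cf β i) (cf α i)))
    where
    e₁ : ∀ b a → b - 0ℤ * a ≡ b
    e₁ = solve-∀

  nonzero : ∀ α → ∃[ i ] cf α i ≢ 0ℤ
  nonzero α = Finₚ.¬∀⟶∃¬ rank (λ i → cf α i ≡ 0ℤ) (λ i → cf α i ≟ 0ℤ)
    λ h → two≢0 (trans (sym (c-self α)) (trans (c-expand α α) (sum-zero _ λ i → trans (cong (_* c (simple i) α) (h i)) (*-zeroˡ (c (simple i) α)))))
    where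
    two≢0 : + 2 ≢ 0ℤ
    two≢0 ()

  -- Two of the first `#Δ + 1` terms are the same root by the pigeonhole principle. This is how
  -- finiteness of Δ excludes translations.
  progression : ∀ (F : ℕ → Root) i b k → (∀ n → cf (F n) i ≡ b + + n * k) → k ≡ 0ℤ
  progression F i b k h = collision (Finₚ.pigeonhole (ℕₚ.n<1+n #Δ) (F ∘ toℕ))
    where
    cancel : ∀ m n k b → (m - n) * k ≡ b + m * k - (b + n * k)
    cancel = solve-∀
    collision : (∃[ m ] ∃[ n ] m Fin.< n × F (toℕ m) ≡ F (toℕ n)) → k ≡ 0ℤ
    collision (m , n , m<n , e) = *≡0⇒ʳ {+ toℕ m - + toℕ n} {k}
      (trans (cancel (+ toℕ m) (+ toℕ n) k b)
        (i≡j⇒i-j≡0 (trans (sym (h (toℕ m))) (trans (cong (λ ρ → cf ρ i) e) (h (toℕ n))))))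
      λ z → ℕₚ.<⇒≢ m<n (+-injective (i-j≡0⇒i≡j _ _ z))

  -- s_α and s_γ s_{s_γ α} s_γ are reflections in the same root, so their
  -- composite is a transvection β ↦ β + g(β) α permuting the finite set Δ.
  c-invariant : ∀ γ β α → c (reflect γ β) (reflect γ α) ≡ c β α
  c-invariant γ β α = i-j≡0⇒i≡j _ _ g≡0
    where
    open ≡-Reasoning
    α′ = reflect γ α
    c′ g : Root → ℤ
    c′ β = c (reflect γ β) α′
    g β = c′ β - c β α
    σ F : Root → Root
    σ β = reflect γ (reflect α′ (reflect γ β))
    F β = reflect α (σ β)
    σ≐ : ∀ β → σ β ≐ β + (- c′ β) · α
    σ≐ β = mk λ i → trans (at (reflect-≐ γ (reflect≐ α′ (reflect γ β))) i)
      (cong₂ (λ x y → cf x i + (- c′ β) * cf y i) (reflect-involutive γ β) (reflect-involutive γ α))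
    F≐ : ∀ β → F β ≐ β + g β · α
    F≐ β = mk λ i → begin
      cf (F β) i ≡⟨ cf-reflect α (σ β) i ⟩
      cf (σ β) i - c (σ β) α * cf α i
        ≡⟨ cong₂ (λ x y → x - y * cf α i) (at (σ≐ β) i) (trans (c-≐ (σ≐ β) α) (cong (λ y → c β α + (- c′ β) * y) (c-self α))) ⟩
      cf β i + (- c′ β) * cf α i - (c β α + (- c′ β) * + 2) * cf α i ≡⟨ e (cf β i) (c′ β) (cf α i) (c β α) ⟩
      cf β i + (c′ β - c β α) * cf α i ∎
      where
      e : ∀ b k a l → b + (- k) * a - (l + (- k) * + 2) * a ≡ b + (k - l) * a
      e = solve-∀
    gF : ∀ β → g (F β) ≡ g β
    gF β = trans (cong₂ _-_
        (trans (c-≐ (reflect-≐ γ (F≐ β)) α′) (cong (λ y → c′ β + g β * y) (c-self α′)))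
        (trans (c-≐ (F≐ β) α) (cong (λ y → c β α + g β * y) (c-self α))))
      (e (c′ β) (g β) (c β α))
      where
      e : ∀ x g y → x + g * + 2 - (y + g * + 2) ≡ x - y
      e = solve-∀
    iter : ℕ → Root → Root
    iter zero β = β
    iter (suc n) β = F (iter n β)
    g-iter : ∀ n β → g (iter n β) ≡ g β
    g-iter zero β = refl
    g-iter (suc n) β = trans (gF (iter n β)) (g-iter n β)
    cf-iter : ∀ i n → cf (iter n β) i ≡ cf β i + + n * (g β * cf α i)
    cf-iter i zero = e (cf β i) (g β * cf α i)
      where
      e : ∀ a x → a ≡ a + + 0 * x
      e = solve-∀
    cf-iter i (suc n) = trans (at (F≐ (iter n β)) i)
      (trans (cong₂ (λ x y → x + y * cf α i) (cf-iter i n) (g-iter n β))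
      (e (cf β i) (+ n) (g β) (cf α i)))
      where
      e : ∀ b n g a → b + n * (g * a) + g * a ≡ b + (+ 1 + n) * (g * a)
      e = solve-∀
    g≡0 : g β ≡ 0ℤ
    g≡0 = *≡0⇒ˡ {g β} {cf α i₀} (progression (λ n → iter n β) i₀ (cf β i₀) (g β * cf α i₀) (cf-iter i₀)) (proj₂ (nonzero α))
      where i₀ = proj₁ (nonzero α)

  -- The canonical W-invariant form, built from the coroots because the root system comes without an
  -- inner product.
  B : Root → Root → ℤ
  B α β = sum λ γ → c α γ * c β γ

  abstract
    B-sym : ∀ α β → B α β ≡ B β α
    B-sym α β = sum-cong-≗ λ γ → *-comm (c α γ) (c β γ)

    B-pos : ∀ α → 0ℤ < B α α
    B-pos α = <-≤-trans (subst (λ y → 0ℤ < y * y) (sym (c-self α)) (+<+ (ℕ.s≤s ℕ.z≤n)))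
      (term≤sum (λ γ → c α γ * c α γ) (λ γ → 0≤² (c α γ)) α)

    -- Reindexing the sum by `s_β` gives (s_β α, s_β β) = (α, β), where s_β β = -β.
    2B : ∀ α β → + 2 * B α β ≡ c α β * B β β
    2B α β = i-j≡0⇒i≡j _ _ (trans (e₁ (B α β) (c α β * B β β)) (i≡j⇒i-j≡0 (begin
      B α β ≡⟨ sum-cong-≗ (λ γ → cong₂ _*_ (c-invariant β α γ) (c-invariant β β γ)) ⟨
      sum (λ γ → c (reflect β α) (reflect β γ) * c (reflect β β) (reflect β γ))
        ≡⟨ sum-involution (λ γ → c (reflect β α) γ * c (reflect β β) γ) (reflect β) (reflect-involutive β) ⟨
      sum (λ γ → c (reflect β α) γ * c (reflect β β) γ)
        ≡⟨ sum-cong-≗ (λ γ → trans (cong₂ _*_ (c-reflect β α γ) (c-neg β γ)) (e (c α γ) (c α β) (c β γ))) ⟩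
      sum (λ γ → c α β * (c β γ * c β γ) - c α γ * c β γ)
        ≡⟨ sum-minus (λ γ → c α β * (c β γ * c β γ)) (λ γ → c α γ * c β γ) ⟩
      sum (λ γ → c α β * (c β γ * c β γ)) - B α β ≡⟨ cong (_- B α β) (sum-scale (c α β) _) ⟩
      c α β * B β β - B α β ∎)))
      where
      open ≡-Reasoning
      e : ∀ x k y → (x - k * y) * (- y) ≡ k * (y * y) - x * y
      e = solve-∀
      e₁ : ∀ x y → + 2 * x - y ≡ x - (y - x)
      e₁ = solve-∀

  IsSum : Root → Root → Root → Set
  IsSum γ α β = ∀ i → cf γ i ≡ cf α i + cf β i

  private
    *neg : ∀ {a b} → 0ℤ < b → a < 0ℤ → a * b < 0ℤ
    *neg {a} {b} 0<b a<0 = 0-⇒ (subst (0ℤ <_) (e a b) (0<* (neg⇒0< a<0) 0<b))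
      where
      e : ∀ a b → - a * b ≡ - (a * b)
      e = solve-∀
      0-⇒ : ∀ {x} → 0ℤ < - x → x < 0ℤ
      0-⇒ {x} h = 0<-⇒< (subst (0ℤ <_) (sym (+-identityˡ (- x))) h)

  -- By `2B` both integers have the sign of the symmetric form.
  c-neg-sym : ∀ α β → c α β < 0ℤ → c β α < 0ℤ
  c-neg-sym α β h with c β α <? 0ℤ
  ... | yes p = p
  ... | no ¬p = ⊥-elim (<-irrefl refl (≤-<-trans (subst (0ℤ ≤_)
      (trans (sym (2B β α)) (trans (cong (+ 2 *_) (B-sym β α)) (2B α β))) (0≤* (≮⇒≥ ¬p) (<⇒≤ (B-pos α))))
      (*neg (B-pos β) h)))

  private
    -1-or-≤-2 : ∀ {a} → a < 0ℤ → a ≡ -1ℤ ⊎ a ≤ - + 2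
    -1-or-≤-2 {+ n} (+<+ ())
    -1-or-≤-2 { -[1+ zero ]} _ = inj₁ refl
    -1-or-≤-2 { -[1+ suc n ]} _ = inj₂ (-≤- (ℕ.s≤s ℕ.z≤n))

  -- If both pairings are at most -2, the invariant form vanishes at
  -- z = α + β, and the composite of s_α and s_β translates α by 2z.
  root-sum : ∀ α β → c α β < 0ℤ → β ≢ neg α → ∃[ γ ] IsSum γ α β
  root-sum α β h ne with -1-or-≤-2 h | -1-or-≤-2 (c-neg-sym α β h)
  ... | inj₁ a | _ = reflect β α , λ i → trans (cf-reflect β α i) (trans (cong (λ y → cf α i - y * cf β i) a) (e (cf α i) (cf β i)))
    where
    e : ∀ x y → x - -1ℤ * y ≡ x + y
    e = solve-∀
  ... | inj₂ _ | inj₁ b = reflect α β , λ i → trans (cf-reflect α β i) (trans (cong (λ y → cf β i - y * cf α i) b) (e (cf α i) (cf β i)))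
    where
    e : ∀ x y → y - -1ℤ * x ≡ x + y
    e = solve-∀
  ... | inj₂ a | inj₂ b = ⊥-elim (ne (cf-injective λ i → trans (e₀ (cf β i) (cf α i)) (trans (cong (_- cf α i) (z≡0 i)) (trans (+-identityˡ _) (sym (cf-neg α i))))))
    where
    open ≡-Reasoning
    e₀ : ∀ b a → b ≡ a + b - a
    e₀ = solve-∀
    z : Root → ℤ
    z γ = c α γ + c β γ
    Q≡ : sum (λ γ → z γ * z γ) ≡ B α α + + 2 * B α β + B β β
    Q≡ = begin
      sum (λ γ → z γ * z γ) ≡⟨ sum-cong-≗ (λ γ → e (c α γ) (c β γ)) ⟩
      sum (λ γ → c α γ * c α γ + + 2 * (c α γ * c β γ) + c β γ * c β γ)
        ≡⟨ ∑-distrib-+ (λ γ → c α γ * c α γ + + 2 * (c α γ * c β γ)) (λ γ → c β γ * c β γ) ⟩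
      sum (λ γ → c α γ * c α γ + + 2 * (c α γ * c β γ)) + B β β
        ≡⟨ cong (_+ B β β) (∑-distrib-+ (λ γ → c α γ * c α γ) (λ γ → + 2 * (c α γ * c β γ))) ⟩
      B α α + sum (λ γ → + 2 * (c α γ * c β γ)) + B β β
        ≡⟨ cong (λ y → B α α + y + B β β) (sum-scale (+ 2) (λ γ → c α γ * c β γ)) ⟩
      B α α + + 2 * B α β + B β β ∎
      where
      e : ∀ a b → (a + b) * (a + b) ≡ a * a + + 2 * (a * b) + b * b
      e = solve-∀
    4Q≤0 : + 2 * sum (λ γ → z γ * z γ) ≤ 0ℤ
    4Q≤0 = 0≤i-j⇒j≤i (subst (0ℤ ≤_) (begin
        (- + 2 - c α β) * B β β + (- + 2 - c β α) * B α α
          ≡⟨ e₁ (c α β) (B β β) (c β α) (B α α) ⟩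
        - + 2 * (B β β + B α α) - c α β * B β β - c β α * B α α
          ≡⟨ cong₂ (λ x y → - + 2 * (B β β + B α α) - x - y) (sym (2B α β)) (trans (sym (2B β α)) (cong (+ 2 *_) (B-sym β α))) ⟩
        - + 2 * (B β β + B α α) - + 2 * B α β - + 2 * B α β
          ≡⟨ e₂ (B α α) (B α β) (B β β) ⟩
        0ℤ - + 2 * (B α α + + 2 * B α β + B β β)
          ≡⟨ cong (λ y → 0ℤ - + 2 * y) Q≡ ⟨
        0ℤ - + 2 * sum (λ γ → z γ * z γ) ∎)
      (0≤+ (0≤* (i≤j⇒0≤j-i a) (<⇒≤ (B-pos β))) (0≤* (i≤j⇒0≤j-i b) (<⇒≤ (B-pos α)))))
      where
      e₁ : ∀ a x b y → (- + 2 - a) * x + (- + 2 - b) * y ≡ - + 2 * (x + y) - a * x - b * y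
      e₁ = solve-∀
      e₂ : ∀ x m y → - + 2 * (y + x) - + 2 * m - + 2 * m ≡ 0ℤ - + 2 * (x + + 2 * m + y)
      e₂ = solve-∀
    Q≡0 : sum (λ γ → z γ * z γ) ≡ 0ℤ
    Q≡0 = ≤-antisym (*-cancelˡ-≤-pos _ 0ℤ (+ 2) 4Q≤0) (sum-nonNeg _ λ γ → 0≤² (z γ))
    z≡0′ : ∀ γ → z γ ≡ 0ℤ
    z≡0′ γ = ²≡0 {z γ} (sum-nonNeg-zero (λ γ → z γ * z γ) (λ γ → 0≤² (z γ)) Q≡0 γ)
    F : ℕ → Root
    F zero = α
    F (suc n) = reflect α (reflect β (F n))
    cF : ∀ n γ → c (F n) γ ≡ c α γ
    cfF : ∀ n i → cf (F n) i ≡ cf α i + + n * (+ 2 * (cf α i + cf β i))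
    cαβ : c α β ≡ - + 2
    cαβ = trans (e′ (c α β) (c β β)) (trans (cong₂ _-_ (z≡0′ β) (c-self β)) refl)
      where
      e′ : ∀ x y → x ≡ x + y - y
      e′ = solve-∀
    cβα : c β α ≡ - + 2
    cβα = trans (e′ (c β α) (c α α)) (trans (cong₂ _-_ (z≡0′ α) (c-self α)) refl)
      where
      e′ : ∀ x y → x ≡ y + x - y
      e′ = solve-∀
    stepF : ∀ n i → cf (F (suc n)) i ≡ cf (F n) i + + 2 * (cf α i + cf β i)
    stepF n i = begin
      cf (F (suc n)) i ≡⟨ cf-reflect α (reflect β (F n)) i ⟩
      cf (reflect β (F n)) i - c (reflect β (F n)) α * cf α i
        ≡⟨ cong₂ (λ x y → x - y * cf α i) (trans (cf-reflect β (F n) i) (cong (λ y → cf (F n) i - y * cf β i) (trans (cF n β) cαβ)))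
            (trans (c-reflect β (F n) α) (cong₂ (λ x y → x - y) (trans (cF n α) (c-self α)) (cong₂ _*_ (trans (cF n β) cαβ) cβα))) ⟩
      cf (F n) i - (- + 2) * cf β i - (+ 2 - (- + 2) * (- + 2)) * cf α i ≡⟨ e (cf (F n) i) (cf β i) (cf α i) ⟩
      cf (F n) i + + 2 * (cf α i + cf β i) ∎
      where
      e : ∀ f b a → f - (- + 2) * b - (+ 2 - (- + 2) * (- + 2)) * a ≡ f + + 2 * (a + b)
      e = solve-∀
    cF zero γ = refl
    cF (suc n) γ = begin
      c (F (suc n)) γ ≡⟨ c-reflect α (reflect β (F n)) γ ⟩
      c (reflect β (F n)) γ - c (reflect β (F n)) α * c α γ
        ≡⟨ cong₂ (λ x y → x - y * c α γ) (trans (c-reflect β (F n) γ) (cong₂ (λ x y → x - y * c β γ) (cF n γ) (trans (cF n β) cαβ)))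
            (trans (c-reflect β (F n) α) (cong₂ (λ x y → x - y) (trans (cF n α) (c-self α)) (cong₂ _*_ (trans (cF n β) cαβ) cβα))) ⟩
      c α γ - (- + 2) * c β γ - (+ 2 - (- + 2) * (- + 2)) * c α γ ≡⟨ e (c β γ) (c α γ) ⟩
      c α γ + + 2 * (c α γ + c β γ) ≡⟨ cong (λ y → c α γ + + 2 * y) (z≡0′ γ) ⟩
      c α γ + + 2 * 0ℤ ≡⟨ +-identityʳ _ ⟩
      c α γ ∎
      where
      e : ∀ b a → a - (- + 2) * b - (+ 2 - (- + 2) * (- + 2)) * a ≡ a + + 2 * (a + b)
      e = solve-∀
    cfF zero i = e (cf α i) (+ 2 * (cf α i + cf β i))
      where
      e : ∀ a x → a ≡ a + + 0 * x
      e = solve-∀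
    cfF (suc n) i = trans (stepF n i) (trans (cong (_+ + 2 * (cf α i + cf β i)) (cfF n i)) (e (cf α i) (+ n) (+ 2 * (cf α i + cf β i))))
      where
      e : ∀ a n x → a + n * x + x ≡ a + (+ 1 + n) * x
      e = solve-∀
    z≡0 : ∀ i → cf α i + cf β i ≡ 0ℤ
    z≡0 i = *≡0⇒ʳ {+ 2} {cf α i + cf β i} (progression F i (cf α i) _ (λ n → cfF n i)) λ ()

-- Signs of roots and simple affine roots

module Signs (Φ : RootSystem) (Π : Base Φ) where
  import Data.Fin.Properties as Finₚ
  open import Relation.Nullary.Decidable using (_⊎-dec_)
  open IntegerSums
  open RootSystem Φ
  open Base Π
  open WeylGroup Φ
  open RootTheory Φ Π public
  open _≐_+_·_ public

  ht : Root → ℤ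
  ht β = sum (cf β)

  sg : Root → ℤ
  sg β = sgn β ◃ 1

  sg-pos : ∀ {β} → Pos β → sg β ≡ 1ℤ
  sg-pos p = cong (_◃ 1) p

  sg-neg : ∀ {β} → Neg β → sg β ≡ -1ℤ
  sg-neg p = cong (_◃ 1) p

  cf-pos : ∀ {β} i → 0ℤ < cf β i → Pos β
  cf-pos {β} i h with pos⊎neg β
  ... | inj₁ p = p
  ... | inj₂ n = ⊥-elim (<-irrefl refl (<-≤-trans h (neg-cf n i)))

  pos-ht : ∀ {β} → Pos β → 0ℤ < ht β
  pos-ht {β} p = <-≤-trans (≤∧≢⇒< (pos-cf p (proj₁ (nonzero β))) (λ e → proj₂ (nonzero β) (sym e)))
    (term≤sum (cf β) (pos-cf p) (proj₁ (nonzero β)))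

  abstract
    ht-≐ : ∀ {α β γ k} → γ ≐ β + k · α → ht γ ≡ ht β + k * ht α
    ht-≐ {α} {β} {γ} {k} h = trans (sum-cong-≗ (at h)) (trans (∑-distrib-+ (cf β) (λ i → k * cf α i)) (cong (λ y → ht β + y) (sum-scale k (cf α))))

    ht-neg : ∀ α → ht (neg α) ≡ - ht α
    ht-neg α = trans (sum-cong-≗ (cf-neg α)) (sum-neg (cf α))

  neg-of-pos : ∀ {α} → Pos α → Neg (neg α)
  neg-of-pos {α} p with pos⊎neg (neg α)
  ... | inj₂ n = n
  ... | inj₁ q = ⊥-elim (<-asym (pos-ht p) (subst (_< 0ℤ) (neg-involutive (ht α)) (neg-mono-< (subst (0ℤ <_) (ht-neg α) (pos-ht q)))))

  pos-of-neg : ∀ {α} → Neg α → Pos (neg α)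
  pos-of-neg {α} n with pos⊎neg (neg α)
  ... | inj₁ p = p
  ... | inj₂ q = ⊥-elim (proj₂ (nonzero α) (≤-antisym (neg-cf n i)
          (subst (0ℤ ≤_) (neg-involutive (cf α i)) (neg-mono-≤ (subst (_≤ 0ℤ) (cf-neg α i) (neg-cf q i))))))
    where i = proj₁ (nonzero α)

  pos-neg⁻ : ∀ {α} → Pos (neg α) → Neg α
  pos-neg⁻ {α} p = subst Neg (neg-neg α) (neg-of-pos p)

  neg-ht : ∀ {β} → Neg β → ht β < 0ℤ
  neg-ht {β} n = subst (_< 0ℤ) (trans (cong -_ (ht-neg β)) (neg-involutive (ht β))) (neg-mono-< (pos-ht (pos-of-neg n)))

  ht-pos : ∀ {β} → 0ℤ ≤ ht β → Pos β
  ht-pos {β} h with pos⊎neg β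
  ... | inj₁ p = p
  ... | inj₂ n = ⊥-elim (<-irrefl refl (<-≤-trans (neg-ht n) h))

  sg-of-neg : ∀ β → sg (neg β) ≡ - sg β
  sg-of-neg β with pos⊎neg β
  ... | inj₁ p = trans (sg-neg (neg-of-pos p)) (cong -_ (sym (sg-pos p)))
  ... | inj₂ n = trans (sg-pos (pos-of-neg n)) (cong -_ (sym (sg-neg n)))

  neg-inj : ∀ {α β} → neg α ≡ neg β → α ≡ β
  neg-inj {α} {β} e = trans (sym (neg-neg α)) (trans (cong neg e) (neg-neg β))

  neg≢ : ∀ α → neg α ≢ α
  neg≢ α e with pos⊎neg α
  ... | inj₁ p = pos-neg p (subst Neg e (neg-of-pos p))
  ... | inj₂ n = pos-neg (subst Pos e (pos-of-neg n)) n

  abstract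
    c-negʳ : ∀ β α → c β (neg α) ≡ - c β α
    c-negʳ β α = begin
      c β (neg α) ≡⟨ cong (λ y → c y (neg α)) (reflect-involutive α β) ⟨
      c (reflect α (reflect α β)) (reflect α α) ≡⟨ c-invariant α (reflect α β) α ⟩
      c (reflect α β) α ≡⟨ c-reflect α β α ⟩
      c β α - c β α * c α α ≡⟨ cong (λ y → c β α - c β α * y) (c-self α) ⟩
      c β α - c β α * + 2 ≡⟨ e (c β α) ⟩
      - c β α ∎
      where
      open ≡-Reasoning
      e : ∀ x → x - x * + 2 ≡ - x
      e = solve-∀

    reflect-by-neg : ∀ α β → reflect (neg α) β ≡ reflect α β
    reflect-by-neg α β = cf-injective λ i → trans (cf-reflect (neg α) β i)
      (trans (cong₂ (λ x y → cf β i - x * y) (c-negʳ β α) (cf-neg α i))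
      (trans (e (cf β i) (c β α) (cf α i)) (sym (cf-reflect α β i))))
      where
      e : ∀ b k a → b - (- k) * (- a) ≡ b - k * a
      e = solve-∀

  -- t = 0 for a simple root a and t = 1 for a = -θ with θ a highest root:
  -- the two kinds of simple affine roots.
  record AffineSimple (a : Root) : Set where
    field
      t : ℤ
      sg-reflect : ∀ β → sg (reflect a β) ≡ sg β + 2ℤ * (t * c β a) - 2ℤ * δ a β + 2ℤ * δ (neg a) β

  δ-neg : ∀ a β → δ a (neg β) ≡ δ (neg a) β
  δ-neg a β with β Fin.≟ neg a
  ... | yes refl = trans (cong (δ a) (neg-neg a)) (δ-self a)
  ... | no ne = δ-other a (neg β) λ e → ne (trans (sym (neg-neg β)) (cong neg e))

  -- Both sides of the sign formula are odd in `β`, since negating `β` exchanges the corrections at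
  -- `a` and `-a`; positive `β` therefore suffice.
  affineSimple : ∀ a t →
    (∀ β → Pos β → sg (reflect a β) ≡ sg β + 2ℤ * (t * c β a) - 2ℤ * δ a β + 2ℤ * δ (neg a) β) →
    AffineSimple a
  affineSimple a t h = record { t = t ; sg-reflect = go }
    where
    open ≡-Reasoning
    e : ∀ s t k x y → - (- s + 2ℤ * (t * - k) - 2ℤ * x + 2ℤ * y) ≡ s + 2ℤ * (t * k) - 2ℤ * y + 2ℤ * x
    e = solve-∀
    go : ∀ β → _
    go β with pos⊎neg β
    ... | inj₁ p = h β p
    ... | inj₂ n = begin
      sg (reflect a β) ≡⟨ cong (λ y → sg (reflect a y)) (neg-neg β) ⟨
      sg (reflect a (neg (neg β))) ≡⟨ cong sg (reflect-neg a (neg β)) ⟩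
      sg (neg (reflect a (neg β))) ≡⟨ sg-of-neg (reflect a (neg β)) ⟩
      - sg (reflect a (neg β)) ≡⟨ cong -_ (h (neg β) (pos-of-neg n)) ⟩
      - (sg (neg β) + 2ℤ * (t * c (neg β) a) - 2ℤ * δ a (neg β) + 2ℤ * δ (neg a) (neg β))
        ≡⟨ cong -_ (cong₂ _+_ (cong₂ (λ x y → x - 2ℤ * y) (cong₂ (λ x y → x + 2ℤ * (t * y)) (sg-of-neg β) (c-neg β a)) (δ-neg a β))
            (cong (2ℤ *_) (trans (δ-neg (neg a) β) (cong (λ y → δ y β) (neg-neg a))))) ⟩
      - (- sg β + 2ℤ * (t * - c β a) - 2ℤ * δ (neg a) β + 2ℤ * δ a β) ≡⟨ e (sg β) t (c β a) (δ (neg a) β) (δ a β) ⟩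
      sg β + 2ℤ * (t * c β a) - 2ℤ * δ a β + 2ℤ * δ (neg a) β ∎

  simple-reflect-pos : ∀ j β → Pos β → β ≢ simple j → Pos (reflect (simple j) β)
  simple-reflect-pos j β p ne = cf-pos i (subst (0ℤ <_) (sym cf-same) (≤∧≢⇒< (pos-cf p i) λ e → proj₂ i∃ (inj₂ (sym e))))
    where
    i∃ : ∃[ i ] ¬ (i ≡ j ⊎ cf β i ≡ 0ℤ)
    i∃ = Finₚ.¬∀⟶∃¬ rank _ (λ i → (i Fin.≟ j) ⊎-dec (cf β i ≟ 0ℤ))
      λ h → ne (positive-multiple j p λ i i≢j → fromInj₂ i i≢j (h i))
      where
      fromInj₂ : ∀ i → i ≢ j → i ≡ j ⊎ cf β i ≡ 0ℤ → cf β i ≡ 0ℤ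
      fromInj₂ i i≢j (inj₁ e) = ⊥-elim (i≢j e)
      fromInj₂ i i≢j (inj₂ e) = e
    i = proj₁ i∃
    cf-same : cf (reflect (simple j) β) i ≡ cf β i
    cf-same = trans (cf-reflect (simple j) β i)
      (trans (cong (λ y → cf β i - c β (simple j) * y) (trans (cf-simple j i) (δ-other j i λ e → proj₂ i∃ (inj₁ e))))
      (e (cf β i) (c β (simple j))))
      where
      e : ∀ x y → x - y * 0ℤ ≡ x
      e = solve-∀

  simple-affineSimple : ∀ j → AffineSimple (simple j)
  simple-affineSimple j = affineSimple (simple j) 0ℤ go
    where
    go : ∀ β → Pos β → sg (reflect (simple j) β) ≡ sg β + 2ℤ * (0ℤ * c β (simple j)) - 2ℤ * δ (simple j) β + 2ℤ * δ (neg (simple j)) β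
    go β p with β Fin.≟ simple j
    ... | yes refl rewrite δ-other (neg (simple j)) (simple j) (λ e → neg≢ _ (sym e))
          | sg-neg (neg-of-pos p) | sg-pos p = refl
    ... | no ne rewrite δ-other (neg (simple j)) β (λ e → pos-neg p (subst Neg (sym e) (neg-of-pos (simple-positive j))))
          | sg-pos (simple-reflect-pos j β p ne) | sg-pos p = refl

  -- Maximal height is asked among the roots with a positive coefficient at `index`: a root β + kθ
  -- with β positive and k > 0 would belong to this family and be higher. Letting `index` vary
  -- yields a θ with a positive coefficient at any prescribed simple root.
  record IsTop (θ : Root) : Set where
    field
      isPos : Pos θ
      index    : Fin rank
      support  : 0ℤ < cf θ index
      maximal  : ∀ γ → 0ℤ < cf γ index → ht γ ≤ ht θ

  top-exists : ∀ j → ∃[ θ ] IsTop θ × 0ℤ < cf θ j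
  top-exists j with argmax ht {λ β → 0ℤ < cf β j} (λ β → 0ℤ <? cf β j) (simple j)
     (subst (0ℤ <_) (sym (trans (cf-simple j j) (δ-self j))) (+<+ (ℕ.s≤s ℕ.z≤n)))
  ... | θ , s , m = θ , record { isPos = cf-pos j s ; index = j ; support = s ; maximal = m } , s

  module Top {θ} (top : IsTop θ) where
    open IsTop top

    overshoot : ∀ {γ β} k → Pos β → γ ≐ β + (+ suc k) · θ → ⊥
    overshoot {γ} {β} k p h = <-irrefl refl (<-≤-trans ht< (maximal γ cf>0))
      where
      cf>0 : 0ℤ < cf γ index
      cf>0 = subst (0ℤ <_) (sym (at h index)) (+-mono-≤-< (pos-cf p index) (0<* {+ suc k} (+<+ (ℕ.s≤s ℕ.z≤n)) support))
      ht< : ht θ < ht γ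
      ht< = 0<-⇒< (subst (0ℤ <_) (trans (e (ht β) (+ k) (ht θ)) (cong (_- ht θ) (sym (ht-≐ h))))
        (+-mono-<-≤ (pos-ht p) (0≤* {+ k} (+≤+ ℕ.z≤n) (<⇒≤ (pos-ht isPos)))))
        where
        e : ∀ b k t → b + k * t ≡ b + (+ 1 + k) * t - t
        e = solve-∀

    -- `root-sum` makes β - θ a root; were it positive, β itself would overshoot θ.
    difference-negative : ∀ β → Pos β → β ≢ θ → 0ℤ < c β θ → ∃[ ψ ] Pos ψ × (∀ i → cf ψ i ≡ cf θ i - cf β i)
    difference-negative β p ne h with root-sum β (neg θ)
        (subst (_< 0ℤ) (sym (c-negʳ β θ)) (neg-mono-< h)) (λ e → ne (sym (neg-inj e)))
    ... | φ , φ= with pos⊎neg φ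
    ... | inj₁ q = ⊥-elim (overshoot 0 q (mk λ i → sym (trans (cong (_+ 1ℤ * cf θ i) (trans (φ= i) (cong (λ y → cf β i + y) (cf-neg θ i)))) (e (cf β i) (cf θ i)))))
      where
      e : ∀ b t → b + - t + 1ℤ * t ≡ b
      e = solve-∀
    ... | inj₂ n = neg φ , pos-of-neg n , λ i → trans (cf-neg φ i) (trans (cong -_ (trans (φ= i) (cong (λ y → cf β i + y) (cf-neg θ i)))) (e (cf β i) (cf θ i)))
      where
      e : ∀ b t → - (b + - t) ≡ t - b
      e = solve-∀

    -- A negative pairing makes s_θ β overshoot θ, and a pairing of at least 2 makes -s_θ β = (θ -
    -- β) + (⟨β, θ^∨⟩ - 1) θ overshoot it.
    pairing-bound : ∀ β → Pos β → β ≢ θ → (c β θ ≡ 0ℤ) ⊎ (c β θ ≡ 1ℤ × Neg (reflect θ β))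
    pairing-bound β p ne = go (c β θ) refl
      where
      go : ∀ k → c β θ ≡ k → (c β θ ≡ 0ℤ) ⊎ (c β θ ≡ 1ℤ × Neg (reflect θ β))
      go (+ zero) e = inj₁ e
      go -[1+ k ] e = ⊥-elim (overshoot k p (mk λ i → trans (cf-reflect θ β i) (trans (cong (λ y → cf β i - y * cf θ i) e) (e₁ (cf β i) (+ suc k) (cf θ i)))))
        where
        e₁ : ∀ b k t → b - (- k) * t ≡ b + k * t
        e₁ = solve-∀
      go (+ suc zero) e with difference-negative β p ne (subst (0ℤ <_) (sym e) (+<+ (ℕ.s≤s ℕ.z≤n)))
      ... | ψ , q , ψ= = inj₂ (e , pos-neg⁻ (subst Pos (cf-injective λ i → trans (ψ= i) (sym (trans (cf-neg (reflect θ β) i)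
              (trans (cong -_ (trans (cf-reflect θ β i) (cong (λ y → cf β i - y * cf θ i) e))) (e₁ (cf β i) (cf θ i)))))) q))
        where
        e₁ : ∀ b t → - (b - 1ℤ * t) ≡ t - b
        e₁ = solve-∀
      go (+ suc (suc k)) e with difference-negative β p ne (subst (0ℤ <_) (sym e) (+<+ (ℕ.s≤s ℕ.z≤n)))
      ... | ψ , q , ψ= = ⊥-elim (overshoot k q (mk λ i → trans (cf-neg (reflect θ β) i)
              (trans (cong -_ (trans (cf-reflect θ β i) (cong (λ y → cf β i - y * cf θ i) e))) (trans (e₁ (cf β i) (+ suc k) (cf θ i))
              (cong (λ y → y + + suc k * cf θ i) (sym (ψ= i)))))))
        where
        e₁ : ∀ b k t → - (b - (+ 1 + k) * t) ≡ t - b + k * t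
        e₁ = solve-∀

    top-affineSimple : AffineSimple (neg θ)
    top-affineSimple = affineSimple (neg θ) 1ℤ go
      where
      go : ∀ β → Pos β → sg (reflect (neg θ) β) ≡ sg β + 2ℤ * (1ℤ * c β (neg θ)) - 2ℤ * δ (neg θ) β + 2ℤ * δ (neg (neg θ)) β
      go β p rewrite reflect-by-neg θ β | c-negʳ β θ | neg-neg θ
             | δ-other (neg θ) β (λ e → pos-neg p (subst Neg (sym e) (neg-of-pos isPos))) with β Fin.≟ θ
      ... | yes refl rewrite c-self θ | sg-neg (neg-of-pos p) | sg-pos p = refl
      ... | no ne with pairing-bound β p ne
      ... | inj₁ e rewrite reflect-fixed β θ e | e | sg-pos p = refl
      ... | inj₂ (e , n) rewrite sg-neg n | e | sg-pos p = refl

-- A substitute for length, and its bounds under reflections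

module Edges (Φ : RootSystem) (Π : Base Φ) where
  open import Data.List using (_∷ʳ_)
  open import Data.List.Properties using (foldr-++; foldl-++)
  open IntegerSums
  open RootSystem Φ hiding (s)
  open Base Π
  open WeylGroup Φ
  open Signs Φ Π public

  -- the action of x⁻¹
  actI : W → Root → Root
  actI x β = List.foldl (flip reflect) β x

  ~-refl : ∀ {x} → x ~ x
  ~-refl = mk~ λ β → refl

  ~-sym : ∀ {x y} → x ~ y → y ~ x
  ~-sym h = mk~ λ β → sym (at~ h β)

  ~-trans : ∀ {x y z} → x ~ y → y ~ z → x ~ z
  ~-trans h k = mk~ λ β → trans (at~ h β) (at~ k β)

  actR-++ : ∀ x y β → actR (x ++ y) β ≡ actR x (actR y β)
  actR-++ x y β = foldr-++ reflect β x y

  actI-++ : ∀ x y β → actI (x ++ y) β ≡ actI y (actI x β)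
  actI-++ x y β = foldl-++ (flip reflect) β x y

  actR-actI : ∀ x β → actR x (actI x β) ≡ β
  actR-actI [] β = refl
  actR-actI (γ ∷ x) β = trans (cong (reflect γ) (actR-actI x (reflect γ β))) (reflect-involutive γ β)

  actI-actR : ∀ x β → actI x (actR x β) ≡ β
  actI-actR [] β = refl
  actI-actR (γ ∷ x) β = trans (cong (actI x) (reflect-involutive γ (actR x β))) (actI-actR x β)

  ~⇒actI : ∀ {x y} → x ~ y → ∀ β → actI x β ≡ actI y β
  ~⇒actI {x} {y} h β = begin
    actI x β                 ≡⟨ cong (actI x) (actR-actI y β) ⟨
    actI x (actR y (actI y β)) ≡⟨ cong (actI x) (at~ h (actI y β)) ⟨
    actI x (actR x (actI y β)) ≡⟨ actI-actR x (actI y β) ⟩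
    actI y β                 ∎
    where open ≡-Reasoning

  actI⇒~ : ∀ {x y} → (∀ β → actI x β ≡ actI y β) → x ~ y
  actI⇒~ {x} {y} h = mk~ λ β → begin
    actR x β                 ≡⟨ actR-actI y (actR x β) ⟨
    actR y (actI y (actR x β)) ≡⟨ cong (actR y) (h (actR x β)) ⟨
    actR y (actI x (actR x β)) ≡⟨ cong (actR y) (actI-actR x β) ⟩
    actR y β                 ∎
    where open ≡-Reasoning

  ~-∷ : ∀ {x y} a → x ~ y → a ∷ x ~ a ∷ y
  ~-∷ a h = mk~ λ β → cong (reflect a) (at~ h β)

  ~-++ʳ : ∀ {x y} z → x ~ y → x ++ z ~ y ++ z
  ~-++ʳ {x} {y} z h = mk~ λ β → trans (actR-++ x z β) (trans (at~ h (actR z β)) (sym (actR-++ y z β)))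

  ~-cancel-∷ : ∀ a x → a ∷ a ∷ x ~ x
  ~-cancel-∷ a x = mk~ λ β → reflect-involutive a (actR x β)

  ~-reflexive : ∀ {x y} → x ≡ y → x ~ y
  ~-reflexive refl = ~-refl

  actR-∷ʳ : ∀ x γ β → actR (x ∷ʳ γ) β ≡ actR x (reflect γ β)
  actR-∷ʳ x γ β = actR-++ x (γ ∷ []) β

  actI-∷ʳ : ∀ x γ β → actI (x ∷ʳ γ) β ≡ reflect γ (actI x β)
  actI-∷ʳ x γ β = actI-++ x (γ ∷ []) β

  actR-neg : ∀ x β → actR x (neg β) ≡ neg (actR x β)
  actR-neg [] β = refl
  actR-neg (γ ∷ x) β = trans (cong (reflect γ) (actR-neg x β)) (reflect-neg γ (actR x β))

  actI-neg : ∀ x β → actI x (neg β) ≡ neg (actI x β)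
  actI-neg [] β = refl
  actI-neg (γ ∷ x) β = trans (cong (actI x) (reflect-neg γ β)) (actI-neg x (reflect γ β))

  actI-∷-self : ∀ a x → actI (a ∷ x) a ≡ neg (actI x a)
  actI-∷-self a x = actI-neg x a

  abstract
    actR-≐ : ∀ {α β γ k} x → γ ≐ β + k · α → actR x γ ≐ actR x β + k · actR x α
    actR-≐ [] h = h
    actR-≐ (δ ∷ x) h = reflect-≐ δ (actR-≐ x h)

    c-actR : ∀ x α β → c (actR x α) (actR x β) ≡ c α β
    c-actR [] α β = refl
    c-actR (γ ∷ x) α β = trans (c-invariant γ (actR x α) (actR x β)) (c-actR x α β)

    c-actI : ∀ x β a → c (actR x β) a ≡ c β (actI x a)
    c-actI x β a = trans (cong (c (actR x β)) (sym (actR-actI x a))) (c-actR x β (actI x a))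

    reflect-conj : ∀ γ α β → reflect (reflect γ α) (reflect γ β) ≡ reflect γ (reflect α β)
    reflect-conj γ α β = cf-injective λ i → trans (cf-reflect (reflect γ α) (reflect γ β) i)
      (trans (cong (λ y → cf (reflect γ β) i - y * cf (reflect γ α) i) (c-invariant γ β α))
      (trans (e (cf (reflect γ β) i) (c β α) (cf (reflect γ α) i)) (sym (at (reflect-≐ γ (reflect≐ α β)) i))))
      where
      e : ∀ x y z → x - y * z ≡ x + (- y) * z
      e = solve-∀

    actR-conj : ∀ x α β → reflect (actR x α) (actR x β) ≡ actR x (reflect α β)
    actR-conj [] α β = refl
    actR-conj (γ ∷ x) α β = trans (reflect-conj γ (actR x α) (actR x β)) (cong (reflect γ) (actR-conj x α β))

    conjugate : ∀ a x → a ∷ x ~ x ∷ʳ actI x a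
    conjugate a x = mk~ λ β → trans (cong (λ y → reflect y (actR x β)) (sym (actR-actI x a)))
      (trans (actR-conj x (actI x a) β) (sym (actR-∷ʳ x (actI x a) β)))

  -- J x = #Δ - 4 ℓ(x) and K γ = 2⟨2ρ , γ^∨⟩.
  J : W → ℤ
  J x = sum λ β → sg (actR x β) * sg β

  K : Root → ℤ
  K γ = sum λ β → sg β * c β γ

  private
    2*inj : ∀ {a b} → 2ℤ * a ≡ 2ℤ * b → a ≡ b
    2*inj {a} {b} = *-cancelˡ-≡ 2ℤ a b

  abstract
    J-cong : ∀ {x y} → x ~ y → J x ≡ J y
    J-cong h = sum-cong-≗ λ β → cong (λ y → sg y * sg β) (at~ h β)

    sum-δ : ∀ a x (f : Root → ℤ) → sum (λ β → δ a (actR x β) * f β) ≡ f (actI x a)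
    sum-δ a x f = trans (sum-single (λ β → δ a (actR x β) * f β) (actI x a) λ β ne →
        trans (cong (_* f β) (δ-other a (actR x β) λ e → ne (trans (sym (actI-actR x β)) (cong (actI x) e)))) (*-zeroˡ (f β)))
      (trans (cong (_* f (actI x a)) (trans (cong (δ a) (actR-actI x a)) (δ-self a))) (*-identityˡ (f (actI x a))))

    -- `K` is linear in the coroot, and the coroot of s_γ η is η^∨ - ⟨γ, η^∨⟩ γ^∨.
    K-reflect : ∀ γ η → K (reflect γ η) ≡ K η - c γ η * K γ
    K-reflect γ η = begin
      K (reflect γ η) ≡⟨ sum-cong-≗ (λ β → trans (cong (sg β *_) (c-split β)) (e (sg β) (c β η) (c β γ) (c γ η))) ⟩
      sum (λ β → sg β * c β η - c γ η * (sg β * c β γ)) ≡⟨ sum-minus _ _ ⟩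
      K η - sum (λ β → c γ η * (sg β * c β γ)) ≡⟨ cong (λ y → K η - y) (sum-scale (c γ η) (λ β → sg β * c β γ)) ⟩
      K η - c γ η * K γ ∎
      where
      open ≡-Reasoning
      c-split : ∀ β → c β (reflect γ η) ≡ c β η - c β γ * c γ η
      c-split β = trans (cong (λ y → c y (reflect γ η)) (sym (reflect-involutive γ β)))
        (trans (c-invariant γ (reflect γ β) η) (c-reflect γ β η))
      e : ∀ s x y z → s * (x - y * z) ≡ s * x - z * (s * y)
      e = solve-∀

    module _ {a : Root} (A : AffineSimple a) where
      open AffineSimple A

      -- `sg-reflect` at xβ, summed against `sg β`: invariance turns ⟨xβ, a^∨⟩ into ⟨β, (x⁻¹a)^∨⟩,
      -- which sums to `K`, and the two corrections pick out β = ±x⁻¹a, contributing equally.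
      J-∷ : ∀ x → J (a ∷ x) ≡ J x + 2ℤ * (t * K (actI x a)) - 4ℤ * sg (actI x a)
      J-∷ x = begin
        J (a ∷ x)
          ≡⟨ sum-cong-≗ (λ β → trans (cong (_* sg β) (sg-reflect (actR x β)))
               (trans (e (sg (actR x β)) t (c (actR x β) a) (δ a (actR x β)) (δ (neg a) (actR x β)) (sg β))
                 (cong (λ y → sg (actR x β) * sg β + 2ℤ * t * (sg β * y) + - 2ℤ * (δ a (actR x β) * sg β) + 2ℤ * (δ (neg a) (actR x β) * sg β)) (c-actI x β a)))) ⟩
        sum (λ β → f₁ β + f₂ β + f₃ β + f₄ β) ≡⟨ ∑-distrib-+ (λ β → f₁ β + f₂ β + f₃ β) f₄ ⟩
        sum (λ β → f₁ β + f₂ β + f₃ β) + sum f₄ ≡⟨ cong (_+ sum f₄) (trans (∑-distrib-+ (λ β → f₁ β + f₂ β) f₃) (cong (_+ sum f₃) (∑-distrib-+ f₁ f₂))) ⟩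
        J x + sum f₂ + sum f₃ + sum f₄
          ≡⟨ cong₂ _+_ (cong₂ _+_ (cong (λ y → J x + y) (sum-scale (2ℤ * t) (λ β → sg β * c β η)))
               (trans (sum-scale (- 2ℤ) (λ β → δ a (actR x β) * sg β)) (cong (- 2ℤ *_) (sum-δ a x sg))))
               (trans (sum-scale 2ℤ (λ β → δ (neg a) (actR x β) * sg β)) (cong (2ℤ *_) (trans (sum-δ (neg a) x sg) (trans (cong sg (actI-neg x a)) (sg-of-neg η))))) ⟩
        J x + 2ℤ * t * K η + - 2ℤ * sg η + 2ℤ * - sg η ≡⟨ e′ (J x) t (K η) (sg η) ⟩
        J x + 2ℤ * (t * K η) - 4ℤ * sg η ∎
        where
        open ≡-Reasoning
        η = actI x a
        f₁ f₂ f₃ f₄ : Root → ℤ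
        f₁ β = sg (actR x β) * sg β
        f₂ β = 2ℤ * t * (sg β * c β (actI x a))
        f₃ β = - 2ℤ * (δ a (actR x β) * sg β)
        f₄ β = 2ℤ * (δ (neg a) (actR x β) * sg β)
        e : ∀ X t k p q s → (X + 2ℤ * (t * k) - 2ℤ * p + 2ℤ * q) * s ≡ X * s + 2ℤ * t * (s * k) + - 2ℤ * (p * s) + 2ℤ * (q * s)
        e = solve-∀
        e′ : ∀ j t k s → j + 2ℤ * t * k + - 2ℤ * s + 2ℤ * - s ≡ j + 2ℤ * (t * k) - 4ℤ * s
        e′ = solve-∀

      -- `sg-reflect` at β = a. The right side is the coefficient of `K` in the definition of an
      -- edge, so a falling step is Bruhat for simple `a` and quantum for `-θ`.
      t-sg : 2ℤ * t ≡ 1ℤ - sg a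
      t-sg = 2*inj (begin
        2ℤ * (2ℤ * t) ≡⟨ e (sg a) t ⟩
        sg a + 2ℤ * (t * 2ℤ) - 2ℤ * 1ℤ + 2ℤ * 0ℤ - sg a + 2ℤ
          ≡⟨ cong₂ (λ p q → sg a + 2ℤ * (t * p) - 2ℤ * q + 2ℤ * 0ℤ - sg a + 2ℤ) (c-self a) (δ-self a) ⟨
        sg a + 2ℤ * (t * c a a) - 2ℤ * δ a a + 2ℤ * 0ℤ - sg a + 2ℤ
          ≡⟨ cong (λ p → sg a + 2ℤ * (t * c a a) - 2ℤ * δ a a + 2ℤ * p - sg a + 2ℤ) (δ-other (neg a) a λ e → neg≢ a (sym e)) ⟨
        sg a + 2ℤ * (t * c a a) - 2ℤ * δ a a + 2ℤ * δ (neg a) a - sg a + 2ℤ ≡⟨ cong (λ y → y - sg a + 2ℤ) (sg-reflect a) ⟨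
        sg (neg a) - sg a + 2ℤ ≡⟨ cong (λ y → y - sg a + 2ℤ) (sg-of-neg a) ⟩
        - sg a - sg a + 2ℤ ≡⟨ e′ (sg a) ⟩
        2ℤ * (1ℤ - sg a) ∎)
        where
        open ≡-Reasoning
        e : ∀ s t → 2ℤ * (2ℤ * t) ≡ s + 2ℤ * (t * 2ℤ) - 2ℤ * 1ℤ + 2ℤ * 0ℤ - s + 2ℤ
        e = solve-∀
        e′ : ∀ s → - s - s + 2ℤ ≡ 2ℤ * (1ℤ - s)
        e′ = solve-∀

    sg≤1 : ∀ β → sg β ≤ 1ℤ
    sg≤1 β with pos⊎neg β
    ... | inj₁ p = ≤-reflexive (sg-pos p)
    ... | inj₂ n = subst (_≤ 1ℤ) (sym (sg-neg n)) -≤+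

    -1≤sg : ∀ β → -1ℤ ≤ sg β
    -1≤sg β with pos⊎neg β
    ... | inj₁ p = subst (-1ℤ ≤_) (sym (sg-pos p)) -≤+
    ... | inj₂ n = ≤-reflexive (sym (sg-neg n))

    sg-mono : ∀ {α β γ k} → γ ≐ β + k · α → Pos α → 0ℤ ≤ k → sg β ≤ sg γ
    sg-mono {α} {β} {γ} {k} h p 0≤k with pos⊎neg β
    ... | inj₂ n = subst (_≤ sg γ) (sym (sg-neg n)) (-1≤sg γ)
    ... | inj₁ q = subst (sg β ≤_) (sym (sg-pos (ht-pos (subst (0ℤ ≤_) (sym (ht-≐ h))
                     (0≤+ (<⇒≤ (pos-ht q)) (0≤* 0≤k (<⇒≤ (pos-ht p)))))))) (sg≤1 β)

    sg-mono⁻ : ∀ {α β γ k} → γ ≐ β + k · α → Pos α → k ≤ 0ℤ → sg γ ≤ sg β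
    sg-mono⁻ {α} {β} {γ} {k} h p k≤0 = sg-mono {k = - k}
      (mk λ i → trans (e (cf β i) k (cf α i)) (cong (_+ - k * cf α i) (sym (at h i)))) p (neg-mono-≤ k≤0)
      where
      e : ∀ b k a → b ≡ b + k * a + - k * a
      e = solve-∀

  module _ (γ : Root) (γ>0 : Pos γ) where

    private
      s s′ k : Root → ℤ
      s β = sg β
      s′ β = sg (reflect γ β)
      k β = c β γ

      k′ : ∀ β → c (reflect γ β) γ ≡ - k β
      k′ β = trans (c-reflect γ β γ) (trans (cong (λ y → k β - k β * y) (c-self γ)) (e (k β)))
        where
        e : ∀ x → x - x * + 2 ≡ - x
        e = solve-∀

      0≤-* : ∀ {a b} → a ≤ 0ℤ → b ≤ 0ℤ → 0ℤ ≤ a * b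
      0≤-* {a} {b} h h′ = subst (0ℤ ≤_) (e a b) (0≤* (neg-mono-≤ h) (neg-mono-≤ h′))
        where
        e : ∀ a b → - a * - b ≡ a * b
        e = solve-∀

      ≤⇒-≤0 : ∀ {a b} → a ≤ b → a - b ≤ 0ℤ
      ≤⇒-≤0 = i≤j⇒i-j≤0

      by-sign : ∀ (f : Root → ℤ) →
        (∀ β → 0ℤ < k β → 0ℤ ≤ f β) → (∀ β → k β < 0ℤ → 0ℤ ≤ f β) → (∀ β → k β ≡ 0ℤ → reflect γ β ≡ β → 0ℤ ≤ f β) →
        ∀ β → 0ℤ ≤ f β
      by-sign f h₊ h₋ h₀ β with <-cmp (k β) 0ℤ
      ... | tri< l _ _ = h₋ β l
      ... | tri≈ _ e _ = h₀ β e (reflect-fixed β γ e)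
      ... | tri> _ _ g = h₊ β g

      x-x* : ∀ {a b} y → a ≡ b → 0ℤ ≤ (a - b) * y
      x-x* {a} y refl = ≤-reflexive (e a y)
        where
        e : ∀ a y → 0ℤ ≡ (a - a) * y
        e = solve-∀

    abstract
      s′≤s : ∀ β → 0ℤ ≤ k β → s′ β ≤ s β
      s′≤s β h = sg-mono⁻ (reflect≐ γ β) γ>0 (neg-mono-≤ h)

      s≤s′ : ∀ β → k β ≤ 0ℤ → s β ≤ s′ β
      s≤s′ β h = sg-mono (reflect≐ γ β) γ>0 (neg-mono-≤ h)

      -- Each β is paired with s_γ β, whose pairing with γ^∨ is the opposite. In this form every
      -- term is non-negative.
      2K : 2ℤ * K γ ≡ sum (λ β → (s β - s′ β) * k β)
      2K = begin
        2ℤ * K γ ≡⟨ e (K γ) ⟩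
        K γ - - K γ ≡⟨ cong (λ y → K γ - - y) (trans (sum-involution (λ β → s β * k β) (reflect γ) (reflect-involutive γ))
              (sum-cong-≗ λ β → trans (cong (s′ β *_) (k′ β)) (e₁ (s′ β) (k β)))) ⟩
        K γ - - sum (λ β → - (s′ β * k β)) ≡⟨ cong (λ y → K γ - y) (trans (cong -_ (sum-neg _)) (neg-involutive _)) ⟩
        K γ - sum (λ β → s′ β * k β) ≡⟨ sum-minus _ _ ⟨
        sum (λ β → s β * k β - s′ β * k β) ≡⟨ sum-cong-≗ (λ β → e₂ (s β) (s′ β) (k β)) ⟩
        sum (λ β → (s β - s′ β) * k β) ∎
        where
        open ≡-Reasoning
        e : ∀ x → 2ℤ * x ≡ x - - x
        e = solve-∀
        e₁ : ∀ x y → x * - y ≡ - (x * y)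
        e₁ = solve-∀
        e₂ : ∀ x y z → x * z - y * z ≡ (x - y) * z
        e₂ = solve-∀

      2≤K : 2ℤ ≤ K γ
      2≤K = *-cancelˡ-≤-pos 2ℤ (K γ) 2ℤ (subst (2ℤ * 2ℤ ≤_) (sym 2K) (subst (_≤ sum (λ β → (s β - s′ β) * k β)) term
        (term≤sum (λ β → (s β - s′ β) * k β) (by-sign (λ β → (s β - s′ β) * k β)
          (λ β h → 0≤* (i≤j⇒0≤j-i (s′≤s β (<⇒≤ h))) (<⇒≤ h))
          (λ β h → 0≤-* (≤⇒-≤0 (s≤s′ β (<⇒≤ h))) (<⇒≤ h))
          (λ β _ e → x-x* (k β) (sym (cong sg e)))) γ)))
        where
        term : (s γ - s′ γ) * k γ ≡ 2ℤ * 2ℤ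
        term rewrite sg-pos γ>0 | sg-neg (neg-of-pos γ>0) | c-self γ = refl

    module _ (x : W) where

      private
        X X′ : Root → ℤ
        X β = sg (actR x β)
        X′ β = sg (actR x (reflect γ β))

        ΔJ : ℤ
        ΔJ = J (x ∷ʳ γ) - J x

      abstract
        -- Symmetrising under β ↦ s_γ β gives products of two sign differences, which can be
        -- estimated term by term through the sign of ⟨β, γ^∨⟩.
        2ΔJ : 2ℤ * ΔJ ≡ - sum (λ β → (X′ β - X β) * (s′ β - s β))
        2ΔJ = begin
          2ℤ * ΔJ ≡⟨ cong (λ y → 2ℤ * (y - J x)) (sum-cong-≗ (λ β → cong (λ y → sg y * s β) (actR-∷ʳ x γ β))) ⟩
          2ℤ * (sum (λ β → X′ β * s β) - J x) ≡⟨ e (sum (λ β → X′ β * s β)) (J x) ⟩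
          - (sum (λ β → X β * s β) - sum (λ β → X′ β * s β) + (J x - sum (λ β → X′ β * s β)))
            ≡⟨ cong -_ (cong₂ (λ p q → J x - sum (λ β → X′ β * s β) + (p - q))
                 (sum-involution (λ β → X β * s β) (reflect γ) (reflect-involutive γ))
                 (trans (sum-involution (λ β → X′ β * s β) (reflect γ) (reflect-involutive γ))
                   (sum-cong-≗ λ β → cong (λ y → sg (actR x y) * s′ β) (reflect-involutive γ β)))) ⟩
          - (J x - sum (λ β → X′ β * s β) + (sum (λ β → X′ β * s′ β) - sum (λ β → X β * s′ β)))
            ≡⟨ cong -_ (cong₂ _+_ (sum-minus _ _) (sum-minus _ _)) ⟨
          - (sum (λ β → X β * s β - X′ β * s β) + sum (λ β → X′ β * s′ β - X β * s′ β))
            ≡⟨ cong -_ (trans (sym (∑-distrib-+ _ _)) (sum-cong-≗ λ β → e₁ (X β) (X′ β) (s β) (s′ β))) ⟩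
          - sum (λ β → (X′ β - X β) * (s′ β - s β)) ∎
          where
          open ≡-Reasoning
          e : ∀ a j → 2ℤ * (a - j) ≡ - (j - a + (j - a))
          e = solve-∀
          e₁ : ∀ X X′ s s′ → X * s - X′ * s + (X′ * s′ - X * s′) ≡ (X′ - X) * (s′ - s)
          e₁ = solve-∀

        -- Adding multiples of γ moves the sign of β and that of xβ in the same direction when γ and
        -- xγ are both positive, so no product in `2ΔJ` is negative, and the one at γ is 4.
        J-∷ʳ-< : Pos (actR x γ) → J (x ∷ʳ γ) < J x
        J-∷ʳ-< p = 0<-⇒< (subst (0ℤ <_) (e (J (x ∷ʳ γ)) (J x)) (neg⇒0< ΔJ<0))
          where
          e : ∀ a b → - (a - b) ≡ b - a
          e = solve-∀
          term : (X′ γ - X γ) * (s′ γ - s γ) ≡ 4ℤ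
          term rewrite actR-neg x γ | sg-neg (neg-of-pos p) | sg-pos p | sg-neg (neg-of-pos γ>0) | sg-pos γ>0 = refl
          4≤ : 4ℤ ≤ sum (λ β → (X′ β - X β) * (s′ β - s β))
          4≤ = subst (_≤ sum (λ β → (X′ β - X β) * (s′ β - s β))) term
            (term≤sum (λ β → (X′ β - X β) * (s′ β - s β)) (by-sign (λ β → (X′ β - X β) * (s′ β - s β))
              (λ β h → 0≤-* (≤⇒-≤0 (sg-mono⁻ (actR-≐ x (reflect≐ γ β)) p (neg-mono-≤ (<⇒≤ h)))) (≤⇒-≤0 (s′≤s β (<⇒≤ h))))
              (λ β h → 0≤* (i≤j⇒0≤j-i (sg-mono (actR-≐ x (reflect≐ γ β)) p (neg-mono-≤ (<⇒≤ h)))) (i≤j⇒0≤j-i (s≤s′ β (<⇒≤ h))))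
              (λ β _ e → x-x* (s′ β - s β) (cong (sg ∘ actR x) e))) γ)
          ΔJ<0 : ΔJ < 0ℤ
          ΔJ<0 = *-cancelˡ-<-nonNeg 2ℤ (subst (_< 0ℤ) (sym 2ΔJ) (neg-mono-< (<-≤-trans (+<+ (ℕ.s≤s ℕ.z≤n)) 4≤)))

        -- In terms of length: ℓ(x) - ℓ(x s_γ) ≤ ⟨2ρ, γ^∨⟩. Comparing `2ΔJ` with `2K` term by term,
        -- a difference of signs is at most 2 in absolute value, hence at most 2|⟨β, γ^∨⟩| unless β
        -- is fixed by s_γ, where the term vanishes.
        J-∷ʳ-≤ : J (x ∷ʳ γ) ≤ J x + 2ℤ * K γ
        J-∷ʳ-≤ = 0≤i-j⇒j≤i (subst (0ℤ ≤_) (e₁ (J (x ∷ʳ γ)) (J x) (K γ)) (neg-mono-≤ bound))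
          where
          open ≡-Reasoning
          e₁ : ∀ a b k → - (a - b - 2ℤ * k) ≡ b + 2ℤ * k - a
          e₁ = solve-∀
          f : Root → ℤ
          f β = (s β - s′ β) * (2ℤ * k β - (X′ β - X β))
          f≥0 : ∀ β → 0ℤ ≤ f β
          f≥0 = by-sign f
            (λ β h → 0≤* (i≤j⇒0≤j-i (s′≤s β (<⇒≤ h))) (i≤j⇒0≤j-i (≤-trans (X′-X≤2 β) (*-monoˡ-≤-nonNeg 2ℤ (0<⇒1≤ h)))))
            (λ β h → 0≤-* (≤⇒-≤0 (s≤s′ β (<⇒≤ h))) (≤⇒-≤0 (≤-trans (*-monoˡ-≤-nonNeg 2ℤ (<⇒≤-1 h)) (-2≤X′-X β))))
            (λ β _ e → x-x* (2ℤ * k β - (X′ β - X β)) (sym (cong sg e)))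
            where
            X′-X≤2 : ∀ β → X′ β - X β ≤ 2ℤ * 1ℤ
            X′-X≤2 β = +-mono-≤ (sg≤1 (actR x (reflect γ β))) (neg-mono-≤ (-1≤sg (actR x β)))
            -2≤X′-X : ∀ β → 2ℤ * -1ℤ ≤ X′ β - X β
            -2≤X′-X β = +-mono-≤ (-1≤sg (actR x (reflect γ β))) (neg-mono-≤ (sg≤1 (actR x β)))
            <⇒≤-1 : ∀ {a} → a < 0ℤ → a ≤ -1ℤ
            <⇒≤-1 { -[1+ n ]} _ = -≤- ℕ.z≤n
            <⇒≤-1 {+ n} (+<+ ())
          Σf : sum f ≡ 2ℤ * (2ℤ * K γ - ΔJ)
          Σf = begin
            sum f ≡⟨ sum-cong-≗ (λ β → e (s β) (s′ β) (k β) (X′ β - X β)) ⟩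
            sum (λ β → 2ℤ * ((s β - s′ β) * k β) + (X′ β - X β) * (s′ β - s β)) ≡⟨ ∑-distrib-+ _ _ ⟩
            sum (λ β → 2ℤ * ((s β - s′ β) * k β)) + sum (λ β → (X′ β - X β) * (s′ β - s β))
              ≡⟨ cong₂ _+_ (trans (sum-scale 2ℤ _) (cong (2ℤ *_) (sym 2K))) (trans (sym (neg-involutive _)) (cong -_ (sym 2ΔJ))) ⟩
            2ℤ * (2ℤ * K γ) + - (2ℤ * ΔJ) ≡⟨ e₂ (K γ) ΔJ ⟩
            2ℤ * (2ℤ * K γ - ΔJ) ∎
            where
            e : ∀ s s′ k d → (s - s′) * (2ℤ * k - d) ≡ 2ℤ * ((s - s′) * k) + d * (s′ - s)
            e = solve-∀
            e₂ : ∀ k d → 2ℤ * (2ℤ * k) + - (2ℤ * d) ≡ 2ℤ * (2ℤ * k - d)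
            e₂ = solve-∀
          bound : ΔJ - 2ℤ * K γ ≤ 0ℤ
          bound = subst (_≤ 0ℤ) (e₃ (K γ) ΔJ) (neg-mono-≤ (*-cancelˡ-≤-pos 0ℤ (2ℤ * K γ - ΔJ) 2ℤ (subst (0ℤ ≤_) Σf (sum-nonNeg f f≥0))))
            where
            e₃ : ∀ k d → - (2ℤ * k - d) ≡ d - 2ℤ * k
            e₃ = solve-∀

-- How a simple affine reflection acts on edges

module Crossings (Φ : RootSystem) (Π : Base Φ) where
  open import Data.List using (_∷ʳ_)
  open IntegerSums
  open RootSystem Φ hiding (s)
  open Base Π
  open WeylGroup Φ
  open Edges Φ Π public

  -- In terms of J, the length grows by 1 along a Bruhat edge and by
  -- 1 - ⟨2ρ , γ^∨⟩ along a quantum edge; the sign of xγ tells them apart.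
  record E (x : W) (γ : Root) : Set where
    constructor edge
    field
      label-pos : Pos γ
      ΔJ≡       : J (x ∷ʳ γ) ≡ J x - 4ℤ + (1ℤ - sg (actR x γ)) * K γ
  open E public

  E-cong : ∀ {x y γ} → x ~ y → E x γ → E y γ
  E-cong {x} {y} {γ} h (edge p e) = edge p (trans (sym (J-cong (~-++ʳ (γ ∷ []) h)))
    (trans e (cong₂ (λ a b → a - 4ℤ + (1ℤ - sg b) * K γ) (J-cong h) (at~ h γ))))

  module _ {a : Root} (A : AffineSimple a) where
    open AffineSimple A

    private
      -- Compare `J-∷` at the two ends, with η = x⁻¹a. By `K-reflect` their `t`-terms differ by a
      -- multiple of `K γ`, which is exactly what the change from sg(xγ) to sg(s_a xγ) absorbs. The
      -- defect 4 (sg η - sg(s_γ η)) alone is left.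
      translated : ∀ {x γ} → E x γ → γ ≢ actI x a → γ ≢ neg (actI x a) →
        sg (actR (a ∷ x) γ) ≡ sg (actR x γ) + 2ℤ * (t * c γ (actI x a)) ×
        J (a ∷ x ∷ʳ γ) ≡ J (a ∷ x) + 4ℤ * sg (actI x a) - 4ℤ * sg (reflect γ (actI x a))
                         - 4ℤ + (1ℤ - sg (actR (a ∷ x) γ)) * K γ
      translated {x} {γ} (edge p h) ne₁ ne₂ = eq₁ , eq₂
        where
        open ≡-Reasoning
        η = actI x a
        eq₁ : sg (actR (a ∷ x) γ) ≡ sg (actR x γ) + 2ℤ * (t * c γ η)
        eq₁ = begin
          sg (reflect a (actR x γ)) ≡⟨ sg-reflect (actR x γ) ⟩
          sg (actR x γ) + 2ℤ * (t * c (actR x γ) a) - 2ℤ * δ a (actR x γ) + 2ℤ * δ (neg a) (actR x γ)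
            ≡⟨ cong₂ (λ p q → sg (actR x γ) + 2ℤ * (t * c (actR x γ) a) - 2ℤ * p + 2ℤ * q)
                 (δ-other a (actR x γ) λ e → ne₁ (trans (sym (actI-actR x γ)) (cong (actI x) e)))
                 (δ-other (neg a) (actR x γ) λ e → ne₂ (trans (sym (actI-actR x γ)) (trans (cong (actI x) e) (actI-neg x a)))) ⟩
          sg (actR x γ) + 2ℤ * (t * c (actR x γ) a) - 2ℤ * 0ℤ + 2ℤ * 0ℤ
            ≡⟨ cong (λ p → sg (actR x γ) + 2ℤ * (t * p) - 2ℤ * 0ℤ + 2ℤ * 0ℤ) (c-actI x γ a) ⟩
          sg (actR x γ) + 2ℤ * (t * c γ η) - 2ℤ * 0ℤ + 2ℤ * 0ℤ ≡⟨ e (sg (actR x γ)) (2ℤ * (t * c γ η)) ⟩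
          sg (actR x γ) + 2ℤ * (t * c γ η) ∎
          where
          e : ∀ x y → x + y - 2ℤ * 0ℤ + 2ℤ * 0ℤ ≡ x + y
          e = solve-∀
        eq₂ : J (a ∷ x ∷ʳ γ) ≡ J (a ∷ x) + 4ℤ * sg η - 4ℤ * sg (reflect γ η) - 4ℤ + (1ℤ - sg (actR (a ∷ x) γ)) * K γ
        eq₂ = begin
          J (a ∷ x ∷ʳ γ) ≡⟨ J-∷ A (x ∷ʳ γ) ⟩
          J (x ∷ʳ γ) + 2ℤ * (t * K (actI (x ∷ʳ γ) a)) - 4ℤ * sg (actI (x ∷ʳ γ) a)
            ≡⟨ cong (λ y → J (x ∷ʳ γ) + 2ℤ * (t * K y) - 4ℤ * sg y) (actI-∷ʳ x γ a) ⟩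
          J (x ∷ʳ γ) + 2ℤ * (t * K (reflect γ η)) - 4ℤ * sg (reflect γ η)
            ≡⟨ cong₂ (λ u v → u + 2ℤ * (t * v) - 4ℤ * sg (reflect γ η)) h (K-reflect γ η) ⟩
          J x - 4ℤ + (1ℤ - sg (actR x γ)) * K γ + 2ℤ * (t * (K η - c γ η * K γ)) - 4ℤ * sg (reflect γ η)
            ≡⟨ e (J x) (sg (actR x γ)) (K γ) t (K η) (c γ η) (sg (reflect γ η)) (sg η) ⟩
          J x + 2ℤ * (t * K η) - 4ℤ * sg η + 4ℤ * sg η - 4ℤ * sg (reflect γ η) - 4ℤ
            + (1ℤ - (sg (actR x γ) + 2ℤ * (t * c γ η))) * K γ
            ≡⟨ cong₂ (λ u v → u + 4ℤ * sg η - 4ℤ * sg (reflect γ η) - 4ℤ + (1ℤ - v) * K γ) (sym (J-∷ A x)) (sym eq₁) ⟩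
          J (a ∷ x) + 4ℤ * sg η - 4ℤ * sg (reflect γ η) - 4ℤ + (1ℤ - sg (actR (a ∷ x) γ)) * K γ ∎
          where
          e : ∀ j s k t κ m s′ σ → j - 4ℤ + (1ℤ - s) * k + 2ℤ * (t * (κ - m * k)) - 4ℤ * s′
            ≡ j + 2ℤ * (t * κ) - 4ℤ * σ + 4ℤ * σ - 4ℤ * s′ - 4ℤ + (1ℤ - (s + 2ℤ * (t * m))) * k
          e = solve-∀

    abstract
      -- For any other label the defect is 8, so `J` at s_a x s_γ is 4 above its value at s_a x, or
      -- 4 above that value plus 2 `K γ`. The two bounds on `J` exclude these according to the sign
      -- of s_a xγ.
      crossing-label : ∀ {x γ} → E x γ → Pos (actI x a) → Neg (reflect γ (actI x a)) → γ ≡ actI x a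
      crossing-label {x} {γ} h p n = decide (γ Fin.≟ actI x a)
        where
        contra : γ ≢ actI x a → Pos (actR (a ∷ x) γ) ⊎ Neg (actR (a ∷ x) γ) → ⊥
        contra ne = λ
          { (inj₁ q) → <-asym (J-∷ʳ-< γ (label-pos h) (a ∷ x) q) (0<-⇒< (subst (0ℤ <_) (sym (diff₁ q)) (+<+ (ℕ.s≤s ℕ.z≤n))))
          ; (inj₂ q) → <-irrefl refl (<-≤-trans (0<-⇒< (subst (0ℤ <_) (sym (diff₂ q)) (+<+ (ℕ.s≤s ℕ.z≤n)))) (J-∷ʳ-≤ γ (label-pos h) (a ∷ x))) }
          where
          eq : J (a ∷ x ∷ʳ γ) ≡ J (a ∷ x) + 4ℤ * sg (actI x a) - 4ℤ * sg (reflect γ (actI x a)) - 4ℤ + (1ℤ - sg (actR (a ∷ x) γ)) * K γ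
          eq = proj₂ (translated h ne (λ e → pos-neg (subst Pos e (label-pos h)) (neg-of-pos p)))
          e₁ : ∀ j k → j + 4ℤ * 1ℤ - 4ℤ * -1ℤ - 4ℤ + (1ℤ - 1ℤ) * k - j ≡ 4ℤ
          e₁ = solve-∀
          diff₁ : Pos (actR (a ∷ x) γ) → J (a ∷ x ∷ʳ γ) - J (a ∷ x) ≡ 4ℤ
          diff₁ q = trans (cong (_- J (a ∷ x)) (trans eq (cong₂ _+_ (cong₂ (λ u v → J (a ∷ x) + 4ℤ * u - 4ℤ * v - 4ℤ) (sg-pos p) (sg-neg n))
                   (cong (λ u → (1ℤ - u) * K γ) (sg-pos q))))) (e₁ (J (a ∷ x)) (K γ))
          e₂ : ∀ j k → j + 4ℤ * 1ℤ - 4ℤ * -1ℤ - 4ℤ + (1ℤ - -1ℤ) * k - (j + 2ℤ * k) ≡ 4ℤ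
          e₂ = solve-∀
          diff₂ : Neg (actR (a ∷ x) γ) → J (a ∷ x ∷ʳ γ) - (J (a ∷ x) + 2ℤ * K γ) ≡ 4ℤ
          diff₂ q = trans (cong (_- (J (a ∷ x) + 2ℤ * K γ)) (trans eq (cong₂ _+_ (cong₂ (λ u v → J (a ∷ x) + 4ℤ * u - 4ℤ * v - 4ℤ) (sg-pos p) (sg-neg n))
                   (cong (λ u → (1ℤ - u) * K γ) (sg-neg q))))) (e₂ (J (a ∷ x)) (K γ))
        decide : Dec (γ ≡ actI x a) → γ ≡ actI x a
        decide (yes e) = e
        decide (no ne) = ⊥-elim (contra ne (pos⊎neg (actR (a ∷ x) γ)))

      private
        flips : ∀ γ {η} → γ ≡ η ⊎ γ ≡ neg η → reflect γ η ≡ neg η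
        flips γ (inj₁ refl) = refl
        flips γ {η} (inj₂ refl) = reflect-by-neg η η

        sg-neg≢ : ∀ η → sg η ≡ sg (neg η) → ⊥
        sg-neg≢ η e with pos⊎neg η
        ... | inj₁ p with trans (sym (sg-pos p)) (trans e (sg-neg (neg-of-pos p)))
        ... | ()
        sg-neg≢ η e | inj₂ n with trans (sym (sg-neg n)) (trans e (sg-pos (pos-of-neg n)))
        ... | ()

      -- Equal signs make the defect zero; they also exclude the labels ±x⁻¹a, for which s_γ negates
      -- x⁻¹a.
      translate-edge : ∀ {x γ} → E x γ → sg (actI x a) ≡ sg (reflect γ (actI x a)) → E (a ∷ x) γ
      translate-edge {x} {γ} h same = edge (label-pos h) (trans eq
          (trans (cong (λ u → J (a ∷ x) + 4ℤ * u - 4ℤ * sg (reflect γ (actI x a)) - 4ℤ + (1ℤ - sg (actR (a ∷ x) γ)) * K γ) same)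
              (e (J (a ∷ x)) (sg (reflect γ (actI x a))) ((1ℤ - sg (actR (a ∷ x) γ)) * K γ))))
        where
        eq : J (a ∷ x ∷ʳ γ) ≡ J (a ∷ x) + 4ℤ * sg (actI x a) - 4ℤ * sg (reflect γ (actI x a)) - 4ℤ + (1ℤ - sg (actR (a ∷ x) γ)) * K γ
        eq = proj₂ (translated h
          (λ e → sg-neg≢ (actI x a) (trans same (cong sg (flips γ (inj₁ e)))))
          (λ e → sg-neg≢ (actI x a) (trans same (cong sg (flips γ (inj₂ e))))))
        e : ∀ j s z → j + 4ℤ * s - 4ℤ * s - 4ℤ + z ≡ j - 4ℤ + z
        e = solve-∀

      crossing-edge : ∀ x → Pos (actI x a) → E x (actI x a)
      crossing-edge x p = edge p (begin
        J (x ∷ʳ η) ≡⟨ J-cong (conjugate a x) ⟨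
        J (a ∷ x) ≡⟨ J-∷ A x ⟩
        J x + 2ℤ * (t * K η) - 4ℤ * sg η ≡⟨ cong (λ y → J x + 2ℤ * (t * K η) - 4ℤ * y) (sg-pos p) ⟩
        J x + 2ℤ * (t * K η) - 4ℤ * 1ℤ ≡⟨ e (J x) t (K η) ⟩
        J x - 4ℤ + 2ℤ * t * K η ≡⟨ cong (λ y → J x - 4ℤ + y * K η) (trans (t-sg A) (cong (λ y → 1ℤ - sg y) (sym (actR-actI x a)))) ⟩
        J x - 4ℤ + (1ℤ - sg (actR x η)) * K η ∎)
        where
        open ≡-Reasoning
        η : Root
        η = actI x a
        e : ∀ j t k → j + 2ℤ * (t * k) - 4ℤ * 1ℤ ≡ j - 4ℤ + 2ℤ * t * k
        e = solve-∀

-- Reflection orders and rank two planes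

module Orders (Φ : RootSystem) (Π : Base Φ) where
  open import Data.List.Relation.Unary.Linked as Linked using (Linked; [-]; _∷_)
  open IntegerSums
  open RootSystem Φ hiding (s)
  open Base Π
  open WeylGroup Φ
  open Crossings Φ Π public

  record ReflOrder (_≺_ : Root → Root → Set) : Set where
    field
      compare : ∀ α β → Pos α → Pos β → Tri (α ≺ β) (α ≡ β) (β ≺ α)
      ≺-trans : ∀ {α β γ} → Pos α → Pos β → Pos γ → α ≺ β → β ≺ γ → α ≺ γ
      convex  : ∀ {α β γ} → Pos α → Pos β → Pos γ → IsSum γ α β →
                (α ≺ γ × γ ≺ β) ⊎ (β ≺ γ × γ ≺ α)

    ≺-asym : ∀ {α β} → Pos α → Pos β → α ≺ β → β ≺ α → ⊥
    ≺-asym {α} {β} p q h k with compare α β p q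
    ... | tri< _ _ ¬k = ¬k k
    ... | tri≈ ¬h _ _ = ¬h h
    ... | tri> ¬h _ _ = ¬h h

    ≺-irrefl : ∀ {α} → Pos α → α ≺ α → ⊥
    ≺-irrefl p h = ≺-asym p p h h

  opposite : ∀ {_≺_} → ReflOrder _≺_ → ReflOrder (flip _≺_)
  opposite O = record
    { compare = λ α β p q → rotate (compare α β p q)
    ; ≺-trans = λ p q r h k → ≺-trans r q p k h
    ; convex = λ p q r s → swap′ (convex p q r s)
    }
    where
    open ReflOrder O
    rotate : ∀ {A B C : Set} → Tri A B C → Tri C B A
    rotate (tri< a ¬b ¬c) = tri> ¬c ¬b a
    rotate (tri≈ ¬a b ¬c) = tri≈ ¬c b ¬a
    rotate (tri> ¬a ¬b c) = tri< c ¬b ¬a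
    swap′ : ∀ {A B C D : Set} → (A × B) ⊎ (C × D) → (D × C) ⊎ (B × A)
    swap′ (inj₁ (a , b)) = inj₂ (b , a)
    swap′ (inj₂ (a , b)) = inj₁ (b , a)

  -- In the plane spanned by two roots, Below δ η says on which side of the
  -- line through δ the root η lies; s_δ preserves the two sides.
  module Sides {_≺_} (O : ReflOrder _≺_) where
    open ReflOrder O

    Below : Root → Root → Set
    Below δ η = (Pos η × η ≺ δ) ⊎ (Neg η × δ ≺ neg η)

    sum-pos : ∀ {α β γ} → Pos α → Pos β → IsSum γ α β → Pos γ
    sum-pos {α} {β} {γ} p q s = ht-pos (subst (0ℤ ≤_) (sym (trans (sum-cong-≗ s) (∑-distrib-+ (cf α) (cf β))))
      (0≤+ (<⇒≤ (pos-ht p)) (<⇒≤ (pos-ht q))))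

    -- Moving along δ does not leave the side of its line. Convexity is applied to whichever of η′ =
    -- η + δ, δ = η′ + (-η), -η = δ + (-η′) involves only positive roots.
    below-add : ∀ {δ η η′} → Pos δ → Below δ η → IsSum η′ η δ → Below δ η′
    below-add {δ} {η} {η′} d (inj₁ (p , η≺δ)) s with sum-pos p d s
    ... | p′ with convex p d p′ s
    ... | inj₁ (_ , η′≺δ) = inj₁ (p′ , η′≺δ)
    ... | inj₂ (δ≺η′ , η′≺η) = ⊥-elim (≺-asym p d η≺δ (≺-trans d p′ p δ≺η′ η′≺η))
    below-add {δ} {η} {η′} d (inj₂ (n , δ≺-η)) s with pos⊎neg η′
    ... | inj₁ p′ with convex {η′} {neg η} {δ} p′ (pos-of-neg n) d
              (λ i → trans (e (cf η i) (cf δ i)) (cong₂ _+_ (sym (s i)) (sym (cf-neg η i))))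
      where
      e : ∀ h d → d ≡ h + d + - h
      e = solve-∀
    ... | inj₁ (η′≺δ , _) = inj₁ (p′ , η′≺δ)
    ... | inj₂ (-η≺δ , _) = ⊥-elim (≺-asym d (pos-of-neg n) δ≺-η -η≺δ)
    below-add {δ} {η} {η′} d (inj₂ (n , δ≺-η)) s | inj₂ n′
        with convex {δ} {neg η′} {neg η} d (pos-of-neg n′) (pos-of-neg n)
              (λ i → trans (cf-neg η i) (trans (e (cf η i) (cf δ i)) (cong (λ y → cf δ i + y) (trans (cong -_ (sym (s i))) (sym (cf-neg η′ i))))))
      where
      e : ∀ h d → - h ≡ d + - (h + d)
      e = solve-∀
    ... | inj₁ (h , k) = inj₂ (n′ , ≺-trans d (pos-of-neg n) (pos-of-neg n′) h k)
    ... | inj₂ (_ , k) = ⊥-elim (≺-asym d (pos-of-neg n) δ≺-η k)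

    below≢ : ∀ {δ η} → Pos δ → Below δ η → η ≢ δ × η ≢ neg δ
    below≢ {δ} d (inj₁ (p , h)) = (λ { refl → ≺-irrefl d h }) , λ { refl → pos-neg p (neg-of-pos d) }
    below≢ {δ} d (inj₂ (n , h)) = (λ { refl → pos-neg d n }) , λ { refl → ≺-irrefl d (subst (δ ≺_) (neg-neg δ) h) }

    -- Here s_δ η = η + nδ is reached by adding δ one step at a time. `root-sum` provides the root η
    -- + δ, whose pairing is 2 - n, and s_δ η = s_δ(η + δ) + δ; so the string is walked from both
    -- ends.
    below-reflect⁻ : ∀ n {δ η} → Pos δ → c η δ ≡ - + n → Below δ η → Below δ (reflect δ η)
    below-reflect⁻ zero {δ} {η} d e b = subst (Below δ) (sym (reflect-fixed η δ e)) b
    below-reflect⁻ (suc zero) {δ} {η} d e b = below-add d b λ i →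
      trans (cf-reflect δ η i) (trans (cong (λ y → cf η i - y * cf δ i) e) (e₁ (cf η i) (cf δ i)))
      where
      e₁ : ∀ h d → h - -1ℤ * d ≡ h + d
      e₁ = solve-∀
    below-reflect⁻ (suc (suc n)) {δ} {η} d e b =
      below-add d (below-reflect⁻ n d cη₁ (below-add d b s)) λ i → begin
        cf (reflect δ η) i ≡⟨ cf-reflect δ η i ⟩
        cf η i - c η δ * cf δ i ≡⟨ e₁ (cf η i) (c η δ) (cf δ i) ⟩
        cf η i + cf δ i - (c η δ + + 2) * cf δ i + cf δ i
          ≡⟨ cong₂ (λ x y → x - y * cf δ i + cf δ i) (sym (s i)) (sym cη₁′) ⟩
        cf η₁ i - c η₁ δ * cf δ i + cf δ i ≡⟨ cong (_+ cf δ i) (cf-reflect δ η₁ i) ⟨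
        cf (reflect δ η₁) i + cf δ i ∎
      where
      open ≡-Reasoning
      sumroot : ∃[ γ ] IsSum γ η δ
      sumroot = root-sum η δ (subst (_< 0ℤ) (sym e) -<+) λ { refl → proj₂ (below≢ d b) (sym (neg-neg η)) }
      η₁ : Root
      η₁ = proj₁ sumroot
      s : IsSum η₁ η δ
      s = proj₂ sumroot
      cη₁′ : c η₁ δ ≡ c η δ + + 2
      cη₁′ = trans (c-≐ {δ} {η} {η₁} {1ℤ} (mk λ i → trans (s i) (cong (λ y → cf η i + y) (sym (*-identityˡ (cf δ i)))))  δ) (cong (λ y → c η δ + 1ℤ * y) (c-self δ))
      cη₁ : c η₁ δ ≡ - + n
      cη₁ = trans cη₁′ (trans (cong (_+ + 2) e) (e₂ (+ n)))
        where
        e₂ : ∀ n → - (+ 2 + n) + + 2 ≡ - n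
        e₂ = solve-∀
      e₁ : ∀ h k d → h - k * d ≡ h + d - (k + + 2) * d + d
      e₁ = solve-∀

  module Reflections {_≺_} (O : ReflOrder _≺_) where
    open ReflOrder O
    open Sides O public
    private module Op = Sides (opposite O)

    above-or-below : ∀ {δ η} → Pos δ → η ≢ δ → η ≢ neg δ → Below δ η ⊎ Op.Below δ η
    above-or-below {δ} {η} d ne₁ ne₂ with pos⊎neg η
    ... | inj₁ p with compare η δ p d
    ... | tri< h _ _ = inj₁ (inj₁ (p , h))
    ... | tri≈ _ e _ = ⊥-elim (ne₁ e)
    ... | tri> _ _ h = inj₂ (inj₁ (p , h))
    above-or-below {δ} {η} d ne₁ ne₂ | inj₂ n with compare δ (neg η) d (pos-of-neg n)
    ... | tri< h _ _ = inj₁ (inj₂ (n , h))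
    ... | tri≈ _ e _ = ⊥-elim (ne₂ (trans (sym (neg-neg η)) (cong neg (sym e))))
    ... | tri> _ _ h = inj₂ (inj₂ (n , h))

    not-both : ∀ {δ η} → Pos δ → Below δ η → Op.Below δ η → ⊥
    not-both d (inj₁ (p , h)) (inj₁ (_ , k)) = ≺-asym p d h k
    not-both d (inj₁ (p , h)) (inj₂ (n , k)) = pos-neg p n
    not-both d (inj₂ (n , h)) (inj₁ (p , k)) = pos-neg p n
    not-both d (inj₂ (n , h)) (inj₂ (_ , k)) = ≺-asym d (pos-of-neg n) h k

    abstract
      -- For a positive pairing: if s_δ η were on the other side, then, its own pairing being
      -- negative, the previous lemma for the opposite order would put η = s_δ s_δ η there too.
      below-reflect : ∀ {δ η} → Pos δ → Below δ η → Below δ (reflect δ η)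
      below-reflect {δ} {η} d b = go (c η δ) refl
        where
        ζ : Root
        ζ = reflect δ η
        go : ∀ k → c η δ ≡ k → Below δ ζ
        go (+ zero) e = below-reflect⁻ 0 d e b
        go -[1+ n ] e = below-reflect⁻ (suc n) d e b
        go (+ suc n) e with above-or-below {δ} {ζ} d
            (λ ζ≡δ → proj₂ (below≢ d b) (trans (sym (reflect-involutive δ η)) (cong (reflect δ) ζ≡δ)))
            (λ ζ≡-δ → proj₁ (below≢ d b) (trans (sym (reflect-involutive δ η)) (trans (cong (reflect δ) ζ≡-δ) (reflect-involutive δ δ))))
        ... | inj₁ b′ = b′
        ... | inj₂ o = ⊥-elim (not-both d b (subst (Op.Below δ) (reflect-involutive δ η)
              (Op.below-reflect⁻ (suc n) d cζ o)))
          where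
          cζ : c ζ δ ≡ - + suc n
          cζ = trans (c-reflect δ η δ) (trans (cong₂ (λ x y → x - x * y) e (c-self δ)) (e₁ (+ suc n)))
            where
            e₁ : ∀ x → x - x * + 2 ≡ - x
            e₁ = solve-∀

    infix 4 _<<_
    _<<_ : Root → Root → Set
    α << β = Pos α × Pos β × α ≺ β

    <<-trans : ∀ {α β γ} → α << β → β << γ → α << γ
    <<-trans (p , q , h) (_ , r , k) = p , r , ≺-trans p q r h k

    <<-irrefl : ∀ {α} → α << α → ⊥
    <<-irrefl (p , _ , h) = ≺-irrefl p h

    reflect-pos-below : ∀ {η δ} → η << δ → Pos (reflect δ η) → reflect δ η << δ
    reflect-pos-below {η} {δ} (p , d , h) q with below-reflect d (inj₁ (p , h))
    ... | inj₁ (_ , k) = q , d , k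
    ... | inj₂ (n , _) = ⊥-elim (pos-neg q n)

    reflect-neg-above : ∀ {η δ} → η << δ → Neg (reflect δ η) → δ << neg (reflect δ η)
    reflect-neg-above {η} {δ} (p , d , h) n with below-reflect d (inj₁ (p , h))
    ... | inj₁ (q , _) = ⊥-elim (pos-neg q n)
    ... | inj₂ (_ , k) = d , pos-of-neg n , k

    Increasing : List Root → Set
    Increasing = Linked _<<_

    increasing-drop : ∀ {α β L} → Increasing (α ∷ β ∷ L) → Increasing (α ∷ L)
    increasing-drop (h ∷ [-]) = [-]
    increasing-drop (h ∷ k ∷ l) = <<-trans h k ∷ l

    increasing-lower : ∀ {α β L} → α << β → Increasing (β ∷ L) → Increasing (α ∷ L)
    increasing-lower h [-] = [-]
    increasing-lower h (k ∷ l) = <<-trans h k ∷ l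

    increasing-tail : ∀ {α L} → Increasing (α ∷ L) → Increasing L
    increasing-tail = Linked.tail

-- Deletion and insertion on monotone paths

module Paths (Φ : RootSystem) (Π : Base Φ) {_≺_ : RootSystem.Root Φ → RootSystem.Root Φ → Set}
             (O : Orders.ReflOrder Φ Π _≺_) where
  open import Data.List using (_∷ʳ_)
  open import Data.List.Properties using (++-assoc; ++-identityʳ)
  open import Data.List.Relation.Unary.Linked using ([]; [-]; _∷_)
  open IntegerSums
  open RootSystem Φ hiding (s)
  open Base Π
  open WeylGroup Φ
  open Orders Φ Π public
  open ReflOrder O public
  open Reflections O public

  Chain : W → List Root → Set
  Chain x []      = ⊤
  Chain x (γ ∷ L) = E x γ × Chain (x ∷ʳ γ) L

  Chain-cong : ∀ {x y} L → x ~ y → Chain x L → Chain y L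
  Chain-cong []      h _       = tt
  Chain-cong (γ ∷ L) h (e , k) = E-cong h e , Chain-cong L (~-++ʳ (γ ∷ []) h) k

  ∷ʳ-++ : ∀ (x : W) γ L → (x ∷ʳ γ) ++ L ~ x ++ γ ∷ L
  ∷ʳ-++ x γ L = ~-reflexive (++-assoc x (γ ∷ []) L)

  -- Deleting the first label at which the path crosses from the positive to
  -- the negative side of η.
  data Del : Root → List Root → List Root → Set where
    here  : ∀ {η L} → Del η (η ∷ L) L
    there : ∀ {η δ L M} → Pos (reflect δ η) → Del (reflect δ η) L M → Del η (δ ∷ L) (δ ∷ M)

  StaysPos : Root → List Root → Set
  StaysPos η []      = Pos η
  StaysPos η (δ ∷ L) = Pos η × StaysPos (reflect δ η) L

  staysPos-head : ∀ {η L} → StaysPos η L → Pos η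
  staysPos-head {L = []}    p       = p
  staysPos-head {L = _ ∷ _} (p , _) = p

  -- Inserting a label η where the path is on the positive side for good.
  data Ins : Root → List Root → List Root → Set where
    here  : ∀ {η L} → Pos η → StaysPos η L → Ins η L (η ∷ L)
    there : ∀ {η δ L M} → Ins (reflect δ η) L M → Ins η (δ ∷ L) (δ ∷ M)

  -- If one list loses its head η and the other a later label, then η lies below the common next
  -- label, and `Del-below` refutes the later deletion.
  Del-unique : ∀ {η L L′ M} → Pos η → Increasing L → Increasing L′ → Del η L M → Del η L′ M → L ≡ L′
  -- The running label starts below all labels to come and stays there by `reflect-pos-below`,
  -- whereas a deletion requires it to occur among them.
  Del-below : ∀ {η L M} → Increasing (η ∷ L) → Del η L M → ⊥
  Del-below (h ∷ _) here = <<-irrefl h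
  Del-below (h ∷ l) (there p d) = Del-below (increasing-lower (reflect-pos-below h p) l) d
  Del-unique p l l′ here here = refl
  Del-unique p l l′ (there _ d) (there q d′) = cong (_ ∷_) (Del-unique q (increasing-tail l) (increasing-tail l′) d d′)
  Del-unique p (h ∷ l) l′ here (there q d) = ⊥-elim (Del-below (increasing-lower (reflect-pos-below h q) l′) d)
  Del-unique p l (h ∷ l′) (there q d) here = ⊥-elim (Del-below (increasing-lower (reflect-pos-below h q) l) d)

  Ins-staysPos : ∀ {η L M} → Neg η → Ins η L M → StaysPos (neg η) M → ⊥
  Ins-staysPos n (here p _) _ = pos-neg p n
  Ins-staysPos {η} n (there {δ = δ} i) (_ , s) with pos⊎neg (reflect δ η)
  ... | inj₂ n′ = Ins-staysPos n′ i (subst (λ y → StaysPos y _) (reflect-neg δ η) s)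
  ... | inj₁ p′ = pos-neg (staysPos-head s) (subst Neg (sym (reflect-neg δ η)) (neg-of-pos p′))

  -- An insertion at the head says that η stays positive along the rest of `M`; a later one starts
  -- that rest with -η and says that it becomes positive somewhere.
  Ins-unique : ∀ {η L L′ M} → Ins η L M → Ins η L′ M → L ≡ L′
  Ins-unique (here _ _) (here _ _) = refl
  Ins-unique (there i) (there j) = cong (_ ∷_) (Ins-unique i j)
  Ins-unique {η} (here p s) (there j) = ⊥-elim (Ins-staysPos (neg-of-pos p) j (subst (λ y → StaysPos y _) (sym (neg-neg η)) s))
  Ins-unique {η} (there j) (here p s) = ⊥-elim (Ins-staysPos (neg-of-pos p) j (subst (λ y → StaysPos y _) (sym (neg-neg η)) s))

  module _ {a : Root} (A : AffineSimple a) where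

    private
      step≡ : ∀ x δ {η} → actI x a ≡ η → actI (x ∷ʳ δ) a ≡ reflect δ η
      step≡ x δ e = trans (actI-∷ʳ x δ a) (cong (reflect δ) e)

      crossing : ∀ {x δ η} → actI x a ≡ η → E x δ → Pos η → Neg (reflect δ η) → δ ≡ η
      crossing refl h p n = crossing-label A h p n

      same-pos : ∀ {x δ η} → actI x a ≡ η → E x δ → Pos η → Pos (reflect δ η) → E (a ∷ x) δ
      same-pos refl h p q = translate-edge A h (trans (sg-pos p) (sym (sg-pos q)))

      cross~ : ∀ x {η} → actI x a ≡ η → x ∷ʳ η ~ a ∷ x
      cross~ x refl = ~-sym (conjugate a x)

    -- A fall would carry the running label itself, which remains strictly below every label to
    -- come.
    stays : ∀ x η L → actI x a ≡ η → Pos η → Chain x L → Increasing (η ∷ L) → StaysPos η L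
    stays x η [] e p _ _ = p
    stays x η (δ ∷ L) e p (h , k) (lt ∷ l) with pos⊎neg (reflect δ η)
    ... | inj₂ n = ⊥-elim (<<-irrefl (subst (η <<_) (crossing e h p n) lt))
    ... | inj₁ q = p , stays (x ∷ʳ δ) (reflect δ η) L (step≡ x δ e) q k (increasing-lower (reflect-pos-below lt q) l)

    translate : ∀ x η L → actI x a ≡ η → Chain x L → StaysPos η L → Chain (a ∷ x) L
    translate x η [] e _ _ = tt
    translate x η (δ ∷ L) e (h , k) (p , s) = same-pos e h p (staysPos-head s) , translate (x ∷ʳ δ) (reflect δ η) L (step≡ x δ e) k s

    -- Edges before the fall are translated by s_a. The fall has label η = x⁻¹a, and x s_η = s_a x,
    -- so the path behind it is kept. The clause about lower bounds `p` lets the caller put its own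
    -- label back in front.
    delete : ∀ x η L → actI x a ≡ η → Pos η → Chain x L → Increasing L → Neg (actI (x ++ L) a) →
      ∃[ M ] Del η L M × Chain (a ∷ x) M × Increasing M × (∀ p → Increasing (p ∷ L) → Increasing (p ∷ M)) ×
             (a ∷ x) ++ M ~ x ++ L
    delete x η [] e p _ _ n = ⊥-elim (pos-neg p (subst Neg (trans (cong (λ y → actI y a) (++-identityʳ x)) e) n))
    delete x η (δ ∷ L) e p (h , k) l n with pos⊎neg (reflect δ η)
    ... | inj₂ q with crossing e h p q
    ... | refl = L , here , Chain-cong L (cross~ x e) k , increasing-tail l , (λ _ → increasing-drop) ,
                 ~-trans (~-++ʳ L (~-sym (cross~ x e))) (∷ʳ-++ x δ L)
    delete x η (δ ∷ L) e p (h , k) l n | inj₁ q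
      with delete (x ∷ʳ δ) (reflect δ η) L (step≡ x δ e) q k (increasing-tail l)
             (subst Neg (~⇒actI (~-sym (∷ʳ-++ x δ L)) a) n)
    ... | M , d , k′ , _ , lM , end = δ ∷ M , there q d , (same-pos e h p q , k′) , lM δ l ,
            (λ { p (lt ∷ l′) → lt ∷ lM δ l′ }) ,
            ~-trans (~-sym (∷ʳ-++ (a ∷ x) δ M)) (~-trans end (∷ʳ-++ x δ L))

    private
      Inserted : W → Root → List Root → List Root → Set
      Inserted x η L M = Ins η L M × Chain x M × x ++ M ~ a ∷ (x ++ L)

      insert-here : ∀ x η L → actI x a ≡ η → Pos η → Chain x L → StaysPos η L → Inserted x η L (η ∷ L)
      insert-here x η L e p k s = here p s ,
        (subst (E x) e (crossing-edge A x (subst Pos (sym e) p)) , Chain-cong L (~-sym (cross~ x e)) (translate x η L e k s)) ,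
        ~-trans (~-sym (∷ʳ-++ x η L)) (~-++ʳ L (cross~ x e))

      insert-there : ∀ x η δ L M → E x δ → Inserted (x ∷ʳ δ) (reflect δ η) L M → Inserted x η (δ ∷ L) (δ ∷ M)
      insert-there x η δ L M h (i , k , end) = there i , (h , k) ,
        ~-trans (~-sym (∷ʳ-++ x δ M)) (~-trans end (~-∷ a (∷ʳ-++ x δ L)))

    mutual
      -- The next label δ decides. If η is smaller, no fall can follow and η goes here; if they are
      -- equal, δ is a fall and a rise must be awaited; if η is larger, δ is no fall, and s_δ η is
      -- again above δ by the opposite order.
      insert⁺ : ∀ x η L → actI x a ≡ η → Pos η → Chain x L → Increasing L → Pos (actI (x ++ L) a) →
        ∃[ M ] Inserted x η L M × Increasing M × (∀ p → p << η → Increasing (p ∷ L) → Increasing (p ∷ M))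
      insert⁺ x η [] e p k l f = η ∷ [] , insert-here x η [] e p k p , [-] , λ _ lt _ → lt ∷ [-]
      insert⁺ x η (δ ∷ L) e p k l f with compare η δ p (label-pos (proj₁ k))
      ... | tri< lt _ _ = η ∷ δ ∷ L , insert-here x η (δ ∷ L) e p k (stays x η (δ ∷ L) e p k l′) , l′ , λ _ lt′ _ → lt′ ∷ l′
        where
        l′ : Increasing (η ∷ δ ∷ L)
        l′ = (p , label-pos (proj₁ k) , lt) ∷ l
      ... | tri≈ _ refl _ with insert⁻ (x ∷ʳ δ) (neg δ) L (step≡ x δ e) (neg-of-pos p) (proj₂ k)
             (subst (λ y → Increasing (y ∷ L)) (sym (neg-neg δ)) l) (subst Pos (~⇒actI (~-sym (∷ʳ-++ x δ L)) a) f)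
      ... | M , ins , lM = δ ∷ M , insert-there x η δ L M (proj₁ k) ins , lM δ l , λ { _ _ (lt ∷ l′) → lt ∷ lM δ l′ }
      insert⁺ x η (δ ∷ L) e p k l f | tri> _ _ gt with pos⊎neg (reflect δ η)
      ... | inj₂ n = ⊥-elim (≺-irrefl p (subst (_≺ η) (crossing e (proj₁ k) p n) gt))
      ... | inj₁ q with insert⁺ (x ∷ʳ δ) (reflect δ η) L (step≡ x δ e) q (proj₂ k) (increasing-tail l)
             (subst Pos (~⇒actI (~-sym (∷ʳ-++ x δ L)) a) f)
      ... | M , ins , _ , lM = δ ∷ M , insert-there x η δ L M (proj₁ k) ins , lM δ δ<η′ l , λ { _ _ (lt ∷ l′) → lt ∷ lM δ δ<η′ l′ }
        where
        module Op = Reflections (opposite O)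
        δ<η′ : δ << reflect δ η
        δ<η′ with Op.reflect-pos-below (p , label-pos (proj₁ k) , gt) q
        ... | r , s , t = s , r , t

      -- While the running label is negative, its negative stays below all labels to come; at the
      -- rise across δ it therefore reappears above δ, so a later insertion keeps the order.
      insert⁻ : ∀ x η L → actI x a ≡ η → Neg η → Chain x L → Increasing (neg η ∷ L) → Pos (actI (x ++ L) a) →
        ∃[ M ] Inserted x η L M × (∀ p → Increasing (p ∷ L) → Increasing (p ∷ M))
      insert⁻ x η [] e n k l f = ⊥-elim (pos-neg f (subst Neg (sym (trans (cong (λ y → actI y a) (++-identityʳ x)) e)) n))
      insert⁻ x η (δ ∷ L) e n (h , k) (lt ∷ l) f with pos⊎neg (reflect δ η)
      ... | inj₁ q with insert⁺ (x ∷ʳ δ) (reflect δ η) L (step≡ x δ e) q k (increasing-tail l)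
             (subst Pos (~⇒actI (~-sym (∷ʳ-++ x δ L)) a) f)
      ... | M , ins , _ , lM = δ ∷ M , insert-there x η δ L M h ins , λ { _ (lt′ ∷ l′) → lt′ ∷ lM δ δ<η′ l′ }
        where
        flip-sign : neg (reflect δ (neg η)) ≡ reflect δ η
        flip-sign = trans (cong neg (reflect-neg δ η)) (neg-neg (reflect δ η))
        δ<η′ : δ << reflect δ η
        δ<η′ = subst (δ <<_) flip-sign (reflect-neg-above lt (subst Neg (sym (reflect-neg δ η)) (neg-of-pos q)))
      insert⁻ x η (δ ∷ L) e n (h , k) (lt ∷ l) f | inj₂ q
        with insert⁻ (x ∷ʳ δ) (reflect δ η) L (step≡ x δ e) q k
             (increasing-lower (subst (_<< δ) (reflect-neg δ η) (reflect-pos-below lt (subst Pos (sym (reflect-neg δ η)) (pos-of-neg q)))) l)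
             (subst Pos (~⇒actI (~-sym (∷ʳ-++ x δ L)) a) f)
      ... | M , ins , lM = δ ∷ M , insert-there x η δ L M h ins , λ { _ (lt′ ∷ l′) → lt′ ∷ lM δ l′ }

-- Symmetry of the transport relation, and reduced words

module Transport (Φ : RootSystem) (Π : Base Φ) where
  import Data.Nat.Properties as ℕₚ
  open import Data.Fin using (finToFun; funToFin; combine)
  open import Data.Fin.Properties using (finToFun-funToFin; funToFin-finToFin)
  open import Data.List.Properties using (map-++)
  open IntegerSums

  -- Summing over the elements with a given property requires deciding it; under a double negation
  -- finitely many cases can be decided at once.
  ¬¬-decide : ∀ {n} (P : Fin n → Set) → ¬ ¬ (∀ i → Dec (P i))
  ¬¬-decide {zero}  P k = k λ ()
  ¬¬-decide {suc n} P k = ¬¬-decide (P ∘ suc) λ d →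
    k λ { zero → no λ p → k λ { zero → yes p ; (suc i) → d i } ; (suc i) → d i }

  funToFin-cong : ∀ {m n} (f g : Fin m → Fin n) → (∀ i → f i ≡ g i) → funToFin f ≡ funToFin g
  funToFin-cong {zero}  f g h = refl
  funToFin-cong {suc m} f g h = cong₂ combine (h zero) (funToFin-cong (f ∘ suc) (g ∘ suc) (h ∘ suc))

  open RootSystem Φ hiding (s)
  open Base Π
  open WeylGroup Φ
  open Crossings Φ Π

  abstract
    cf-actI : ∀ {m} x (b : Fin m → ℤ) (τ : Fin m → Root) β → (∀ k → cf β k ≡ sum (λ i → b i * cf (τ i) k)) →
      ∀ k → cf (actI x β) k ≡ sum (λ i → b i * cf (actI x (τ i)) k)
    cf-actI [] b τ β h = h
    cf-actI (γ ∷ x) b τ β h = cf-actI x b (reflect γ ∘ τ) (reflect γ β) λ k → begin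
      cf (reflect γ β) k ≡⟨ cf-reflect γ β k ⟩
      cf β k - c β γ * cf γ k ≡⟨ cong₂ (λ x y → x - y * cf γ k) (h k) c≡ ⟩
      sum (λ i → b i * cf (τ i) k) - sum (λ i → b i * c (τ i) γ) * cf γ k
        ≡⟨ cong (λ y → sum (λ i → b i * cf (τ i) k) - y) (trans (*-comm (sum _) (cf γ k)) (sym (sum-scale (cf γ k) _))) ⟩
      sum (λ i → b i * cf (τ i) k) - sum (λ i → cf γ k * (b i * c (τ i) γ)) ≡⟨ sum-minus _ _ ⟨
      sum (λ i → b i * cf (τ i) k - cf γ k * (b i * c (τ i) γ))
        ≡⟨ sum-cong-≗ (λ i → trans (e (b i) (cf (τ i) k) (cf γ k) (c (τ i) γ)) (cong (b i *_) (sym (cf-reflect γ (τ i) k)))) ⟩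
      sum (λ i → b i * cf (reflect γ (τ i)) k) ∎
      where
      open ≡-Reasoning
      e : ∀ b t g c → b * t - g * (b * c) ≡ b * (t - c * g)
      e = solve-∀
      p : Fin rank → ℤ
      p k = c (simple k) γ
      e₁ : ∀ b t p → b * t * p ≡ b * (t * p)
      e₁ = solve-∀
      c≡ : c β γ ≡ sum (λ i → b i * c (τ i) γ)
      c≡ = begin
        c β γ ≡⟨ c-expand β γ ⟩
        sum (λ k → cf β k * p k) ≡⟨ sum-cong-≗ (λ k → trans (cong (_* p k) (h k)) (trans (*-comm (sum _) (p k)) (sym (sum-scale (p k) _)))) ⟩
        sum (λ k → sum (λ i → p k * (b i * cf (τ i) k))) ≡⟨ ∑-comm (λ k i → p k * (b i * cf (τ i) k)) ⟩
        sum (λ i → sum (λ k → p k * (b i * cf (τ i) k)))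
          ≡⟨ sum-cong-≗ (λ i → trans (sum-cong-≗ λ k → trans (*-comm (p k) (b i * cf (τ i) k)) (e₁ (b i) (cf (τ i) k) (p k)))
               (trans (sum-scale (b i) _) (cong (b i *_) (sym (c-expand (τ i) γ))))) ⟩
        sum (λ i → b i * c (τ i) γ) ∎

    ht-actI : ∀ x β → ht (actI x β) ≡ sum (λ i → cf β i * ht (actI x (simple i)))
    ht-actI x β = begin
      ht (actI x β) ≡⟨ sum-cong-≗ (cf-actI x (cf β) simple β base) ⟩
      sum (λ k → sum (λ i → cf β i * cf (actI x (simple i)) k)) ≡⟨ ∑-comm (λ k i → cf β i * cf (actI x (simple i)) k) ⟩
      sum (λ i → sum (λ k → cf β i * cf (actI x (simple i)) k)) ≡⟨ sum-cong-≗ (λ i → sum-scale (cf β i) _) ⟩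
      sum (λ i → cf β i * ht (actI x (simple i))) ∎
      where
      open ≡-Reasoning
      base : ∀ k → cf β k ≡ sum (λ i → cf β i * cf (simple i) k)
      base k = sym (trans (sum-single (λ i → cf β i * cf (simple i) k) k λ i ne →
          trans (cong (cf β i *_) (trans (cf-simple i k) (δ-other i k λ e → ne (sym e)))) (*-zeroʳ (cf β i)))
        (trans (cong (cf β k *_) (trans (cf-simple k k) (δ-self k))) (*-identityʳ (cf β k))))

  -- Sum ht(x⁻¹a) over the finite set of all x with G x. Elements x, s_a x both
  -- satisfying G cancel, the others contribute positively, and Σ aᵢαᵢ - θ = 0
  -- forces all these sums to vanish.
  module _ (G : W → Set) (G-cong : ∀ {x y} → x ~ y → G x → G y)
           (G-up : ∀ {a} → AffineSimple a → ∀ x → Neg (actI x a) → G x → G (a ∷ x)) where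

    private
      -- All self-maps of Δ are numbered, so that W itself need not be enumerated; `S` singles out
      -- those that are x⁻¹ for some x satisfying `G`. Composing with s_a on the right, as `σ` does,
      -- turns x⁻¹ into (s_a x)⁻¹.
      N : ℕ
      N = #Δ ℕ.^ #Δ

      fn : Fin N → Root → Root
      fn = finToFun

      S : Fin N → Set
      S p = ∃[ x ] (∀ β → fn p β ≡ actI x β) × G x

      σ : Root → Fin N → Fin N
      σ a p = funToFin (fn p ∘ reflect a)

      fn-σ : ∀ a p β → fn (σ a p) β ≡ fn p (reflect a β)
      fn-σ a p β = finToFun-funToFin (fn p ∘ reflect a) β

      σ-involutive : ∀ a p → σ a (σ a p) ≡ p
      σ-involutive a p = trans (funToFin-cong _ (fn p) λ β → trans (fn-σ a p (reflect a β)) (cong (fn p) (reflect-involutive a β)))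
        (funToFin-finToFin {#Δ} {#Δ} p)

      val : ∀ {P : Set} → Dec P → ℤ → ℤ
      val (yes _) z = z
      val (no _)  z = 0ℤ

      module WithDec (D : ∀ p → Dec (S p)) where

        f g : Root → Fin N → ℤ
        f a p = val (D p) (ht (fn p a))
        g a p = f a p + f a (σ a p)

        F : Root → ℤ
        F a = sum (f a)

        2F : ∀ a → 2ℤ * F a ≡ sum (g a)
        2F a = trans (e (F a)) (trans (cong (λ y → F a + y) (sum-involution (f a) (σ a) (σ-involutive a))) (sym (∑-distrib-+ (f a) (f a ∘ σ a))))
          where
          e : ∀ x → 2ℤ * x ≡ x + x
          e = solve-∀

        module _ {a} (A : AffineSimple a) where

          lonely : ∀ p → S p → ¬ S (σ a p) → 0ℤ < ht (fn p a)
          lonely p (x , e , Gx) ¬S with pos⊎neg (actI x a)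
          ... | inj₁ q = subst (λ y → 0ℤ < ht y) (sym (e a)) (pos-ht q)
          ... | inj₂ n = ⊥-elim (¬S (a ∷ x , (λ β → trans (fn-σ a p β) (e (reflect a β))) , G-up A x n Gx))

          g-cases : ∀ p (d : Dec (S p)) (d′ : Dec (S (σ a p))) → 0ℤ ≤ val d (ht (fn p a)) + val d′ (ht (fn (σ a p) a))
          g-cases p (no _) (no _) = ≤-refl
          g-cases p (yes s) (no ¬s) = subst (0ℤ ≤_) (sym (+-identityʳ (ht (fn p a)))) (<⇒≤ (lonely p s ¬s))
          g-cases p (no ¬s) (yes s) = subst (0ℤ ≤_) (sym (+-identityˡ (ht (fn (σ a p) a))))
            (<⇒≤ (lonely (σ a p) s (λ s′ → ¬s (subst S (σ-involutive a p) s′))))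
          g-cases p (yes (x , e , _)) (yes _) = ≤-reflexive (sym (trans (cong (λ y → ht (fn p a) + y) (begin
            ht (fn (σ a p) a) ≡⟨ cong ht (fn-σ a p a) ⟩
            ht (fn p (neg a)) ≡⟨ cong ht (e (neg a)) ⟩
            ht (actI x (neg a)) ≡⟨ cong ht (actI-neg x a) ⟩
            ht (neg (actI x a)) ≡⟨ ht-neg (actI x a) ⟩
            - ht (actI x a) ≡⟨ cong (λ y → - ht y) (e a) ⟨
            - ht (fn p a) ∎)) (+-inverseʳ (ht (fn p a)))))
            where open ≡-Reasoning

          g-nonNeg : ∀ p → 0ℤ ≤ g a p
          g-nonNeg p = g-cases p (D p) (D (σ a p))

          F-nonNeg : 0ℤ ≤ F a
          F-nonNeg = *-cancelˡ-≤-pos 0ℤ (F a) 2ℤ (subst (0ℤ ≤_) (sym (2F a)) (sum-nonNeg (g a) g-nonNeg))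

          closed-of-zero : F a ≡ 0ℤ → ∀ x → G x → G (a ∷ x)
          closed-of-zero F≡0 x Gx = conclude (D p) (D (σ a p))
              (sum-nonNeg-zero (g a) g-nonNeg (trans (sym (2F a)) (cong (2ℤ *_) F≡0)) p)
            where
            p : Fin N
            p = funToFin (actI x)
            fn-p : ∀ β → fn p β ≡ actI x β
            fn-p = finToFun-funToFin (actI x)
            conclude : (d : Dec (S p)) (d′ : Dec (S (σ a p))) → val d (ht (fn p a)) + val d′ (ht (fn (σ a p) a)) ≡ 0ℤ → G (a ∷ x)
            conclude (no ¬s) _ _ = ⊥-elim (¬s (x , fn-p , Gx))
            conclude (yes _) (yes (y , e , Gy)) _ = G-cong
              (actI⇒~ λ β → trans (sym (e β)) (trans (fn-σ a p β) (fn-p (reflect a β)))) Gy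
            conclude (yes s) (no ¬s) z = ⊥-elim (<-irrefl (sym (trans (sym (+-identityʳ _)) z)) (lonely p s ¬s))

        f-linear : ∀ β p → f (neg β) p + sum (λ i → cf β i * f (simple i) p) ≡ 0ℤ
        f-linear β p = cases (D p)
          where
          cases : (d : Dec (S p)) → val d (ht (fn p (neg β))) + sum (λ i → cf β i * val d (ht (fn p (simple i)))) ≡ 0ℤ
          cases (no _) = trans (+-identityˡ _) (sum-zero _ λ i → *-zeroʳ (cf β i))
          cases (yes (x , e , _)) = trans (cong₂ _+_
              (trans (cong ht (trans (e (neg β)) (actI-neg x β))) (ht-neg (actI x β)))
              (trans (sum-cong-≗ λ i → cong (λ y → cf β i * ht y) (e (simple i))) (sym (ht-actI x β))))
            (+-inverseˡ (ht (actI x β)))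

        F-linear : ∀ β → F (neg β) + sum (λ i → cf β i * F (simple i)) ≡ 0ℤ
        F-linear β = begin
          F (neg β) + sum (λ i → cf β i * F (simple i))
            ≡⟨ cong (λ y → F (neg β) + y) (trans (sum-cong-≗ λ i → sym (sum-scale (cf β i) (f (simple i)))) (∑-comm (λ i p → cf β i * f (simple i) p))) ⟩
          F (neg β) + sum (λ p → sum (λ i → cf β i * f (simple i) p)) ≡⟨ ∑-distrib-+ _ _ ⟨
          sum (λ p → f (neg β) p + sum (λ i → cf β i * f (simple i) p)) ≡⟨ sum-zero _ (f-linear β) ⟩
          0ℤ ∎
          where open ≡-Reasoning

        F-simple : ∀ j → F (simple j) ≡ 0ℤ
        -- θ is chosen with a positive coefficient at j, so that the vanishing of the j-th term
        -- gives that of `F (simple j)`.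
        F-simple j with top-exists j
        ... | θ , top , θj>0 = *≡0⇒ʳ {cf θ j} (sum-nonNeg-zero h h≥0 sum≡0 j) λ e → <-irrefl (sym e) θj>0
          where
          h : Fin rank → ℤ
          h i = cf θ i * F (simple i)
          h≥0 : ∀ i → 0ℤ ≤ h i
          h≥0 i = 0≤* (pos-cf (IsTop.isPos top) i) (F-nonNeg (simple-affineSimple i))
          Fθ≥0 : 0ℤ ≤ F (neg θ)
          Fθ≥0 = F-nonNeg (Top.top-affineSimple top)
          sum≡0 : sum h ≡ 0ℤ
          sum≡0 = ≤-antisym (subst (sum h ≤_) (F-linear θ) (subst (_≤ F (neg θ) + sum h) (+-identityˡ (sum h)) (+-monoˡ-≤ (sum h) Fθ≥0)))
                    (sum-nonNeg h h≥0)

    transport : ∀ j x → G x → ¬ ¬ G (simple j ∷ x)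
    transport j x Gx k = ¬¬-decide S λ D → k (WithDec.closed-of-zero D (simple-affineSimple j) (WithDec.F-simple D j) x Gx)

  word : List (Fin rank) → W
  word = List.map simple

  -- Induction on the height: (β, β) > 0 forces some simple α occurring in β to satisfy (α, β) > 0;
  -- then s_α β is lower and, unless β = α, still positive, and s_β is the conjugate of its
  -- reflection by s_α.
  reflection-word : ∀ n β → Pos β → ht β ≤ + n → ∃ (λ is → word is ~ (β ∷ []))
  reflection-word zero β p h = ⊥-elim (<-irrefl refl (<-≤-trans (pos-ht p) h))
  reflection-word (suc n) β p h = found (sum-pos⇒term-pos (λ k → cf β k * B (simple k) β) (subst (0ℤ <_) B-expand (B-pos β)))
    where
    open ≡-Reasoning
    B-expand : B β β ≡ sum (λ k → cf β k * B (simple k) β)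
    B-expand = begin
      B β β ≡⟨ sum-cong-≗ (λ γ → trans (cong (_* c β γ) (c-expand β γ)) (trans (*-comm (sum _) (c β γ)) (sym (sum-scale (c β γ) _)))) ⟩
      sum (λ γ → sum (λ k → c β γ * (cf β k * c (simple k) γ))) ≡⟨ ∑-comm (λ γ k → c β γ * (cf β k * c (simple k) γ)) ⟩
      sum (λ k → sum (λ γ → c β γ * (cf β k * c (simple k) γ)))
        ≡⟨ sum-cong-≗ (λ k → trans (sum-cong-≗ λ γ → e (c β γ) (cf β k) (c (simple k) γ)) (sum-scale (cf β k) _)) ⟩
      sum (λ k → cf β k * B (simple k) β) ∎
      where
      e : ∀ x y z → x * (y * z) ≡ y * (z * x)
      e = solve-∀
    found : (∃[ k ] 0ℤ < cf β k * B (simple k) β) → ∃ (λ is → word is ~ (β ∷ []))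
    found (k , q) with β Fin.≟ simple k
    ... | yes refl = k ∷ [] , ~-refl
    ... | no ne with reflection-word n β′ β′>0 ht≤
      where
      α = simple k
      β′ = reflect α β
      β′>0 : Pos β′
      β′>0 = simple-reflect-pos k β p ne
      cf>0 : 0ℤ < cf β k
      cf>0 = ≤∧≢⇒< (pos-cf p k) λ e → <-irrefl (sym (trans (cong (_* B α β) (sym e)) (*-zeroˡ (B α β)))) q
      c>0 : 0ℤ < c β α
      c>0 = pos-factor (B-pos α) (subst (0ℤ <_) (trans (cong (2ℤ *_) (B-sym α β)) (trans (2B β α) (*-comm (c β α) (B α α))))
              (0<* {2ℤ} (+<+ (ℕ.s≤s ℕ.z≤n)) (pos-factor cf>0 q)))
      ht≤ : ht β′ ≤ + n
      ht≤ = 0≤i-j⇒j≤i (subst (0ℤ ≤_) (trans (e₂ (+ n) (ht β) (c β α * ht α)) (cong (λ y → + n - y) (sym (trans (ht-≐ (reflect≐ α β)) (e₃ (ht β) (c β α) (ht α))))))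
              (0≤+ (i≤j⇒0≤j-i h) (i≤j⇒0≤j-i (0<⇒1≤ (0<* c>0 (pos-ht (simple-positive k)))))))
        where
        e₂ : ∀ n h x → (+ 1 + n) - h + (x - 1ℤ) ≡ n - (h - x)
        e₂ = solve-∀
        e₃ : ∀ h c a → h + (- c) * a ≡ h - c * a
        e₃ = solve-∀
    ... | is , w = k ∷ is List.++ (k ∷ []) , ~-trans (~-∷ (simple k) (~-trans (~-reflexive (map-++ simple is (k ∷ []))) (~-++ʳ (simple k ∷ []) w)))
          (mk~ λ v → trans (sym (reflect-conj (simple k) (reflect (simple k) β) (reflect (simple k) v)))
            (cong₂ reflect (reflect-involutive (simple k) β) (reflect-involutive (simple k) v)))

  simple-word : ∀ x → ∃ (λ is → word is ~ x)
  simple-word [] = [] , ~-refl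
  simple-word (β ∷ x) = join (proj₁ (letter β)) (proj₁ (simple-word x)) (proj₂ (letter β)) (proj₂ (simple-word x))
    where
    positive-letter : ∀ β → Pos β → ∃ (λ is → word is ~ (β ∷ []))
    positive-letter β p = reflection-word ∣ ht β ∣ β p (≤-reflexive (sym (0≤i⇒+∣i∣≡i (<⇒≤ (pos-ht p)))))
    letter : ∀ β → ∃ (λ is → word is ~ (β ∷ []))
    letter β with pos⊎neg β
    ... | inj₁ p = positive-letter β p
    ... | inj₂ n = proj₁ (positive-letter (neg β) (pos-of-neg n)) ,
                   ~-trans (proj₂ (positive-letter (neg β) (pos-of-neg n))) (mk~ λ v → reflect-by-neg β v)
    join : ∀ js is → word js ~ β ∷ [] → word is ~ x → ∃ (λ ks → word ks ~ (β ∷ x))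
    join js is k h = js ++ is , ~-trans (~-reflexive (map-++ simple js is)) (~-trans (~-++ʳ (word is) k) (~-∷ β h))

  Reduced : List (Fin rank) → Set
  Reduced []       = ⊤
  Reduced (i ∷ is) = Pos (actI (word is) (simple i)) × Reduced is

  exchange : ∀ is β → Pos β → Neg (actI (word is) β) → ∃[ js ] β ∷ word is ~ word js × suc (length js) ≡ length is
  exchange [] β p n = ⊥-elim (pos-neg p n)
  exchange (k ∷ is) β p n with β Fin.≟ simple k
  ... | yes refl = is , ~-cancel-∷ (simple k) (word is) , refl
  ... | no ne with exchange is (reflect (simple k) β) (simple-reflect-pos k β p ne) n
  ... | js , h , l = k ∷ js , ~-trans (mk~ λ v → trans (cong (λ y → reflect y (reflect (simple k) (actR (word is) v))) (sym (reflect-involutive (simple k) β)))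
                         (reflect-conj (simple k) (reflect (simple k) β) (actR (word is) v))) (~-∷ (simple k) h) , cong suc l

  -- `n` is fuel: the word returned by `exchange` is shorter but not structurally smaller.
  reduce : ∀ n is → length is ℕ.≤ n → ∃[ js ] Reduced js × word js ~ word is × length js ℕ.≤ length is
  reduce n [] _ = [] , tt , ~-refl , ℕ.z≤n
  reduce (suc n) (i ∷ is) (ℕ.s≤s l) with reduce n is l
  ... | js , r , h , l′ with pos⊎neg (actI (word js) (simple i))
  ... | inj₁ p = i ∷ js , (p , r) , ~-∷ (simple i) h , ℕ.s≤s l′
  ... | inj₂ q with exchange js (simple i) (simple-positive i) q
  ... | ks , h′ , e with reduce n ks (ℕₚ.≤-trans (ℕₚ.n≤1+n _) (ℕₚ.≤-trans (ℕₚ.≤-reflexive e) (ℕₚ.≤-trans l′ l)))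
  ... | ms , r″ , h″ , l″ = ms , r″ , ~-trans h″ (~-trans (~-sym h′) (~-∷ (simple i) h)) ,
         ℕₚ.≤-trans l″ (ℕₚ.≤-trans (ℕₚ.n≤1+n _) (ℕₚ.≤-trans (ℕₚ.≤-reflexive e) (ℕₚ.≤-trans l′ (ℕₚ.n≤1+n _))))

  reduced-word : ∀ x → ∃ (λ is → Reduced is × word is ~ x)
  reduced-word x with simple-word x
  ... | is , h with reduce (length is) is ℕₚ.≤-refl
  ... | js , r , h′ , _ = js , r , ~-trans h′ h

  abstract
    J-[] : J [] ≡ + #Δ
    J-[] = trans (sum-cong-≗ sq) (sum-ones #Δ)
      where
      sq : ∀ β → sg β * sg β ≡ 1ℤ
      sq β with pos⊎neg β
      ... | inj₁ p rewrite sg-pos p = refl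
      ... | inj₂ n rewrite sg-neg n = refl

  J-simple : ∀ j x → J (simple j ∷ x) ≡ J x - 4ℤ * sg (actI x (simple j))
  J-simple j x = trans (J-∷ (simple-affineSimple j) x) (e (J x) (K (actI x (simple j))) (sg (actI x (simple j))))
    where
    e : ∀ j k s → j + 2ℤ * (0ℤ * k) - 4ℤ * s ≡ j - 4ℤ * s
    e = solve-∀

  J-reduced : ∀ is → Reduced is → J (word is) ≡ + #Δ - 4ℤ * + length is
  J-reduced [] _ = trans J-[] (sym (+-identityʳ (+ #Δ)))
  J-reduced (i ∷ is) (p , r) = trans (J-simple i (word is)) (trans (cong₂ (λ x y → x - 4ℤ * y) (J-reduced is r) (sg-pos p)) (e (+ #Δ) (+ length is)))
    where
    e : ∀ n l → n - 4ℤ * l - 4ℤ * 1ℤ ≡ n - 4ℤ * (+ 1 + l)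
    e = solve-∀

  open QuantumBruhatGraph Φ Π using (HasLength)

  -- Reducing a word of minimal length can neither lengthen nor shorten it, and `J` counts the
  -- letters of a reduced word.
  J-length : ∀ {x k} → HasLength x k → J x ≡ + #Δ - 4ℤ * + k
  J-length {x} {k} ((is , is≈x , len) , minimal) with reduce (length is) is ℕₚ.≤-refl
  ... | js , r , h , l = trans (J-cong (~-sym js~x)) (trans (J-reduced js r)
          (cong (λ y → + #Δ - 4ℤ * + y) (ℕₚ.≤-antisym (subst (length js ℕ.≤_) len l) (minimal js (~⇒≈ js~x)))))
    where
    js~x : word js ~ x
    js~x = ~-trans h (≈⇒~ is≈x)

-- Uniqueness of monotone paths

module Uniqueness (Φ : RootSystem) (Π : Base Φ) {_≺_ : RootSystem.Root Φ → RootSystem.Root Φ → Set}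
             (O : Orders.ReflOrder Φ Π _≺_) where
  import Data.Nat.Properties as ℕₚ
  open import Data.Fin.Properties using (any?)
  open import Data.List.Properties using (≡-dec)
  open import Data.List.Relation.Unary.Linked using ([]; _∷_)
  import Data.Sign as Sign
  import Data.Sign.Properties as Signₚ
  open import Relation.Nullary.Decidable using (decidable-stable)
  open IntegerSums
  open RootSystem Φ hiding (s)
  open Base Π
  open WeylGroup Φ
  open Paths Φ Π O public
  open Transport Φ Π public

  pos? : ∀ β → Dec (Pos β)
  pos? β = sgn β Signₚ.≟ Sign.+

  neg? : ∀ β → Dec (Neg β)
  neg? β = sgn β Signₚ.≟ Sign.-

  _<<?_ : ∀ α β → Dec (α << β)
  α <<? β with pos? α | pos? β
  ... | no ¬p | _ = no λ { (p , _) → ¬p p }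
  ... | yes _ | no ¬q = no λ { (_ , q , _) → ¬q q }
  ... | yes p | yes q with compare α β p q
  ... | tri< h _ _ = yes (p , q , h)
  ... | tri≈ ¬h _ _ = no λ { (_ , _ , h) → ¬h h }
  ... | tri> ¬h _ _ = no λ { (_ , _ , h) → ¬h h }

  indicator : ∀ {P : Set} → Dec P → ℤ
  indicator (yes _) = 1ℤ
  indicator (no _)  = 0ℤ

  rank< : Root → ℤ
  rank< δ = sum λ β → indicator (β <<? δ)

  abstract
    rank<-mono : ∀ {α β} → α << β → rank< α + 1ℤ ≤ rank< β
    rank<-mono {α} {β} h = 0≤i-j⇒j≤i (subst (0ℤ ≤_) (trans (cong (_- 1ℤ) (sum-minus _ _)) (e (rank< β) (rank< α)))
        (i≤j⇒0≤j-i (subst (_≤ sum d) term (term≤sum d d≥0 α))))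
      where
      e : ∀ a b → a - b - 1ℤ ≡ a - (b + 1ℤ)
      e = solve-∀
      d : Root → ℤ
      d γ = indicator (γ <<? β) - indicator (γ <<? α)
      d≥0 : ∀ γ → 0ℤ ≤ d γ
      d≥0 γ with γ <<? β | γ <<? α
      ... | yes _ | yes _ = ≤-refl
      ... | yes _ | no _ = +≤+ ℕ.z≤n
      ... | no ¬k | yes k = ⊥-elim (¬k (<<-trans k h))
      ... | no _ | no _ = ≤-refl
      term : d α ≡ 1ℤ
      term with α <<? β | α <<? α
      ... | yes _ | no _ = refl
      ... | yes _ | yes k = ⊥-elim (<<-irrefl k)
      ... | no ¬k | _ = ⊥-elim (¬k h)

    rank<-bound : ∀ δ → rank< δ ≤ + #Δ
    rank<-bound δ = subst (rank< δ ≤_) (sum-ones #Δ) (sum-mono-≤ _ _ λ β → le (β <<? δ))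
      where
      le : ∀ {P : Set} (d : Dec P) → indicator d ≤ 1ℤ
      le (yes _) = ≤-refl
      le (no _) = +≤+ ℕ.z≤n

  -- The potential that bounds the argument for loops: the sum of the positions of the labels in the
  -- order.
  weight : List Root → ℤ
  weight []      = 0ℤ
  weight (δ ∷ L) = rank< δ + weight L

  weight-bound : ∀ L → weight L ≤ + length L * + #Δ
  weight-bound [] = ≤-refl
  weight-bound (δ ∷ L) = subst (weight (δ ∷ L) ≤_) (e (+ #Δ) (+ length L)) (+-mono-≤ (rank<-bound δ) (weight-bound L))
    where
    e : ∀ n l → n + l * n ≡ (+ 1 + l) * n
    e = solve-∀

  Ins-length : ∀ {η L M} → Ins η L M → length M ≡ suc (length L)
  Ins-length (here _ _) = refl
  Ins-length (there i) = cong suc (Ins-length i)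

  Del-length : ∀ {η L M} → Del η L M → length L ≡ suc (length M)
  Del-length here = refl
  Del-length (there _ d) = cong suc (Del-length d)

  -- The inserted label lies above the label before it, hence above `p`.
  Ins-weight : ∀ {η L M p} → Ins η L M → Increasing (p ∷ M) → weight L + (rank< p + 1ℤ) ≤ weight M
  Ins-weight {η} {L} {M} {p} (here _ _) (lt ∷ _) = subst (weight L + (rank< p + 1ℤ) ≤_) (+-comm (weight L) (rank< η))
    (+-monoʳ-≤ (weight L) (rank<-mono lt))
  Ins-weight {p = p} (there {δ = δ} {L} {M} i) (lt ∷ l) = ≤-trans
    (≤-reflexive (+-assoc (rank< δ) (weight L) (rank< p + 1ℤ)))
    (+-monoʳ-≤ (rank< δ) (≤-trans (+-monoʳ-≤ (weight L) (≤-trans (rank<-mono lt) (i≤i+j (rank< δ) 1ℤ))) (Ins-weight i l)))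

  -- The label inserted is at least as large as the one deleted.
  InsDel-weight : ∀ {η L M M′} → Pos η → Ins η L M → Increasing M → Del η M M′ → weight L ≤ weight M′
  InsDel-weight p (here _ _) l here = ≤-refl
  InsDel-weight p (here _ _) l (there q _) = ⊥-elim (pos-neg q (neg-of-pos p))
  InsDel-weight {η} p (there {L = L} i) l here = ≤-trans (≤-reflexive (+-comm (rank< η) (weight L)))
    (≤-trans (+-monoʳ-≤ (weight L) (i≤i+j (rank< η) 1ℤ)) (Ins-weight i l))
  InsDel-weight p (there {δ = δ} i) l (there q d) = +-monoʳ-≤ (rank< δ) (InsDel-weight q i (increasing-tail l) d)

  -- With η already at the head, monotonicity forces the insertion to come later, while the deletion
  -- takes the head because s_η η is negative.
  InsDel-weight-< : ∀ {η L M M′} → Pos η → Ins η (η ∷ L) M → Increasing M → Del η M M′ → weight (η ∷ L) + 1ℤ ≤ weight M′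
  InsDel-weight-< p (here _ _) (lt ∷ _) d = ⊥-elim (<<-irrefl lt)
  InsDel-weight-< {η} {L} p (there i) l here = ≤-trans (≤-reflexive (e (rank< η) (weight L))) (Ins-weight i l)
    where
    e : ∀ r w → r + w + 1ℤ ≡ w + (r + 1ℤ)
    e = solve-∀
  InsDel-weight-< p (there i) l (there q _) = ⊥-elim (pos-neg q (neg-of-pos p))

  module _ {a : Root} (A : AffineSimple a) where

    -- Insertion moves the end of a closed path at x to s_a x, which is on the negative side;
    -- deletion then moves its start there as well.
    record RoundTrip (x : W) (L : List Root) : Set where
      field
        M M′       : List Root
        ins        : Ins (actI x a) L M
        increasing : Increasing M
        del        : Del (actI x a) M M′
        chain′     : Chain (a ∷ x) M′
        increasing′ : Increasing M′
        end′       : (a ∷ x) ++ M′ ~ a ∷ x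

    roundTrip : ∀ x L → Pos (actI x a) → Chain x L → Increasing L → x ++ L ~ x → RoundTrip x L
    roundTrip x L p k l end with insert⁺ A x (actI x a) L refl p k l (subst Pos (~⇒actI (~-sym end) a) p)
    ... | M , (i , kM , endM) , lM , _ with delete A x (actI x a) M refl p kM lM
            (subst Neg (sym (trans (~⇒actI (~-trans endM (~-∷ a end)) a) (actI-∷-self a x))) (neg-of-pos p))
    ... | M′ , d , k′ , l′ , _ , end′ = record
      { M = M ; M′ = M′ ; ins = i ; increasing = lM ; del = d ; chain′ = k′ ; increasing′ = l′
      ; end′ = ~-trans end′ (~-trans endM (~-∷ a end)) }

  actI-∷-pos : ∀ a x → Neg (actI x a) → Pos (actI (a ∷ x) a)
  actI-∷-pos a x n = subst Pos (sym (actI-∷-self a x)) (pos-of-neg n)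

  everywhere : (G : W → Set) → (∀ {x y} → x ~ y → G x → G y) →
    (∀ {a} → AffineSimple a → ∀ x → Neg (actI x a) → G x → G (a ∷ x)) →
    G [] → ∀ x → ¬ ¬ G x
  everywhere G cong-G up base x ¬Gx with simple-word x
  ... | is , h = go is (¬Gx ∘ cong-G h)
    where
    go : ∀ is → ¬ ¬ G (word is)
    go [] k = k base
    go (i ∷ is) k = go is λ g → transport G cong-G up i (word is) g k

  inverted-simple : ∀ δ → Pos δ → ∃[ j ] Neg (reflect δ (simple j))
  inverted-simple δ p with any? (λ j → neg? (reflect δ (simple j)))
  ... | yes r = r
  ... | no ¬r = ⊥-elim (pos-neg (ht-pos (subst (0ℤ ≤_) (sym (ht-actI (δ ∷ []) δ))
      (sum-nonNeg _ λ i → 0≤* (pos-cf p i) (<⇒≤ (pos-ht (is-pos i)))))) (neg-of-pos p))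
    where
    is-pos : ∀ i → Pos (reflect δ (simple i))
    is-pos i with pos⊎neg (reflect δ (simple i))
    ... | inj₁ q = q
    ... | inj₂ n = ⊥-elim (¬r (i , n))

  -- A round trip keeps the length `suc k` of a loop and never lowers its weight, which is at most
  -- `suc k` times `#Δ`. The number `m` bounds the room left, for an induction on `m` over all
  -- sources at once.
  NoLoop : ℕ → ℕ → W → Set
  NoLoop m k x = ∀ L → length L ≡ suc k → Chain x L → Increasing L → x ++ L ~ x →
    + suc k * + #Δ < weight L + + m → ⊥

  NoLoop-cong : ∀ m k {x y} → x ~ y → NoLoop m k x → NoLoop m k y
  NoLoop-cong m k h g L len ch l end w = g L len (Chain-cong L (~-sym h) ch) l
    (~-trans (~-++ʳ L h) (~-trans end (~-sym h))) w

  NoLoop-up : ∀ m k {a} → AffineSimple a → ∀ x → Neg (actI x a) → NoLoop m k x → NoLoop m k (a ∷ x)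
  NoLoop-up m k {a} A x n g L len ch l end w = NoLoop-cong m k (~-sym (~-cancel-∷ a x)) g M′
      (ℕₚ.suc-injective (trans (sym (Del-length del)) (trans (Ins-length ins) (cong suc len)))) chain′ increasing′ end′
      (<-≤-trans w (+-monoˡ-≤ (+ m) (InsDel-weight (actI-∷-pos a x n) ins increasing del)))
    where
    open RoundTrip (roundTrip A (a ∷ x) L (actI-∷-pos a x n) ch l end)

  noLoop : ∀ m k x → NoLoop m k x
  noLoop zero k x L len ch l end w = <-irrefl refl (<-≤-trans w (subst₂ _≤_ (sym (+-identityʳ (weight L))) (cong (λ n → + n * + #Δ) len) (weight-bound L)))
  noLoop (suc m) k x L len ch l end w = everywhere (NoLoop (suc m) k) (NoLoop-cong (suc m) k) (NoLoop-up (suc m) k) base x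
      λ g → g L len ch l end w
    where
    base : NoLoop (suc m) k []
    -- At the identity the first step falls across a simple root made negative by s_δ, so δ is that
    -- simple root; the round trip then gains weight strictly, which pays for lowering `m`.
    base (δ ∷ L) len ch l end w with inverted-simple δ (label-pos (proj₁ ch))
    ... | j , n with crossing-label (simple-affineSimple j) (proj₁ ch) (simple-positive j) n
    ... | refl = noLoop m k (simple j ∷ []) M′
          (ℕₚ.suc-injective (trans (sym (Del-length del)) (trans (Ins-length ins) (cong suc len)))) chain′ increasing′ end′
          (<-≤-trans w (≤-trans (≤-reflexive (e (weight (simple j ∷ L)) (+ m))) (+-monoˡ-≤ (+ m) (InsDel-weight-< (simple-positive j) ins increasing del))))
      where
      open RoundTrip (roundTrip (simple-affineSimple j) [] (simple j ∷ L) (simple-positive j) ch l end)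
      e : ∀ w m → w + (+ 1 + m) ≡ w + 1ℤ + m
      e = solve-∀

  loop-empty : ∀ x L → Chain x L → Increasing L → x ++ L ~ x → L ≡ []
  loop-empty x [] _ _ _ = refl
  loop-empty x L@(_ ∷ L′) ch l end = ⊥-elim (noLoop (suc ∣ z ∣) (length L′) x L refl ch l end
      (0<-⇒< (subst (0ℤ <_) (e (+ suc (length L′) * + #Δ) (weight L) (+ ∣ z ∣)) (+-mono-<-≤ {0ℤ} {1ℤ} (+<+ (ℕ.s≤s ℕ.z≤n)) (i≤j⇒0≤j-i z≤∣z∣)))))
    where
    z : ℤ
    z = + suc (length L′) * + #Δ - weight L
    z≤∣z∣ : z ≤ + ∣ z ∣
    z≤∣z∣ = i≤+∣i∣ z
      where
      i≤+∣i∣ : ∀ i → i ≤ + ∣ i ∣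
      i≤+∣i∣ (+ n) = ≤-refl
      i≤+∣i∣ -[1+ n ] = -≤+
    e : ∀ b w a → 1ℤ + (a - (b - w)) ≡ w + (+ 1 + a) - b
    e = solve-∀

  UniqueTo : W → W → Set
  UniqueTo v x = ∀ L M → Chain x L → Chain x M → Increasing L → Increasing M → x ++ L ~ v → x ++ M ~ v → L ≡ M

  UniqueFrom : W → Set
  UniqueFrom x = ∀ L M → Chain x L → Chain x M → Increasing L → Increasing M → x ++ L ~ x ++ M → L ≡ M

  UniqueTo-delete : ∀ {a} → AffineSimple a → ∀ x v → Pos (actI x a) → Neg (actI v a) → UniqueTo v (a ∷ x) → UniqueTo v x
  UniqueTo-delete {a} A x v p n u L M kL kM lL lM eL eM
    with delete A x (actI x a) L refl p kL lL (subst Neg (~⇒actI (~-sym eL) a) n)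
       | delete A x (actI x a) M refl p kM lM (subst Neg (~⇒actI (~-sym eM) a) n)
  ... | L′ , d , kL′ , lL′ , _ , eL′ | M′ , d′ , kM′ , lM′ , _ , eM′
    = Del-unique p lL lM d (subst (Del (actI x a) M) (sym (u L′ M′ kL′ kM′ lL′ lM′ (~-trans eL′ eL) (~-trans eM′ eM))) d′)

  UniqueTo-insert : ∀ {a} → AffineSimple a → ∀ x v → Pos (actI x a) → Pos (actI v a) → UniqueTo (a ∷ v) x → UniqueTo v x
  UniqueTo-insert {a} A x v p q u L M kL kM lL lM eL eM
    with insert⁺ A x (actI x a) L refl p kL lL (subst Pos (~⇒actI (~-sym eL) a) q)
       | insert⁺ A x (actI x a) M refl p kM lM (subst Pos (~⇒actI (~-sym eM) a) q)
  ... | L′ , (i , kL′ , eL′) , lL′ , _ | M′ , (i′ , kM′ , eM′) , lM′ , _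
    = Ins-unique i (subst (Ins (actI x a) M) (sym (u L′ M′ kL′ kM′ lL′ lM′ (~-trans eL′ (~-∷ a eL)) (~-trans eM′ (~-∷ a eM)))) i′)

  UniqueTo-self : ∀ v x → x ~ v → UniqueTo v x
  UniqueTo-self v x h L M kL kM lL lM eL eM = trans (loop-empty x L kL lL (~-trans eL (~-sym h)))
    (sym (loop-empty x M kM lM (~-trans eM (~-sym h))))

  -- If v is the longest element, deletion moves the source up a reduced word
  -- of v until it meets v.
  unique-longest : ∀ v → (∀ j → Neg (actI v (simple j))) → UniqueTo v []
  unique-longest v h with reduced-word v
  ... | is , r , e = go is r (UniqueTo-self v (word is) e)
    where
    go : ∀ is → Reduced is → UniqueTo v (word is) → UniqueTo v []
    go [] _ u = u
    go (i ∷ is) (p , r) u = go is r (UniqueTo-delete (simple-affineSimple i) (word is) v p (h i) u)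

  J-lower : ∀ x → 0ℤ ≤ J x + + #Δ
  J-lower x = subst (0ℤ ≤_) (trans (∑-distrib-+ _ _) (cong (λ y → J x + y) (sum-ones #Δ)))
    (sum-nonNeg _ λ β → term-nonNeg (pos⊎neg (actR x β)) (pos⊎neg β))
    where
    term-nonNeg : ∀ {α β} → Pos α ⊎ Neg α → Pos β ⊎ Neg β → 0ℤ ≤ sg α * sg β + 1ℤ
    term-nonNeg (inj₁ p) (inj₁ q) rewrite sg-pos p | sg-pos q = +≤+ ℕ.z≤n
    term-nonNeg (inj₁ p) (inj₂ q) rewrite sg-pos p | sg-neg q = +≤+ ℕ.z≤n
    term-nonNeg (inj₂ p) (inj₁ q) rewrite sg-neg p | sg-pos q = +≤+ ℕ.z≤n
    term-nonNeg (inj₂ p) (inj₂ q) rewrite sg-neg p | sg-neg q = +≤+ ℕ.z≤n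

  -- Raising v by a simple reflection lowers `J` by 4, and `J v + #Δ` is never negative. When no
  -- simple reflection raises v, it is the longest element.
  unique-from-identity : ∀ n v → J v + + #Δ < + n → UniqueTo v []
  unique-from-identity zero v h = ⊥-elim (<-irrefl refl (<-≤-trans h (J-lower v)))
  unique-from-identity (suc n) v h with any? (λ j → pos? (actI v (simple j)))
  ... | yes (j , p) = UniqueTo-insert (simple-affineSimple j) [] v (simple-positive j) p
        (unique-from-identity n (simple j ∷ v) (0<-⇒< (subst (0ℤ <_) (sym eq) (+-mono-<-≤ (<⇒0<- h) (+≤+ {0} {3} ℕ.z≤n)))))
    where
    e : ∀ n d j → n - (j - 4ℤ * 1ℤ + d) ≡ + 1 + n - (j + d) + + 3
    e = solve-∀
    eq : + n - (J (simple j ∷ v) + + #Δ) ≡ + suc n - (J v + + #Δ) + + 3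
    eq = trans (cong (λ y → + n - (y + + #Δ)) (trans (J-simple j v) (cong (λ y → J v - 4ℤ * y) (sg-pos p)))) (e (+ n) (+ #Δ) (J v))
  ... | no ¬p = unique-longest v λ j → is-neg j (pos⊎neg (actI v (simple j)))
    where
    is-neg : ∀ j → Pos (actI v (simple j)) ⊎ Neg (actI v (simple j)) → Neg (actI v (simple j))
    is-neg j (inj₁ p) = ⊥-elim (¬p (j , p))
    is-neg j (inj₂ n) = n

  UniqueFrom-cong : ∀ {x y} → x ~ y → UniqueFrom x → UniqueFrom y
  UniqueFrom-cong h u L M kL kM lL lM e = u L M (Chain-cong L (~-sym h) kL) (Chain-cong M (~-sym h) kM) lL lM
    (~-trans (~-++ʳ L h) (~-trans e (~-sym (~-++ʳ M h))))

  UniqueFrom⇒UniqueTo : ∀ {x} v → UniqueFrom x → UniqueTo v x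
  UniqueFrom⇒UniqueTo v u L M kL kM lL lM eL eM = u L M kL kM lL lM (~-trans eL (~-sym eM))

  UniqueFrom-up : ∀ {a} → AffineSimple a → ∀ x → Neg (actI x a) → UniqueFrom x → UniqueFrom (a ∷ x)
  UniqueFrom-up {a} A x n u L M kL kM lL lM e = go (pos⊎neg (actI v a)) L M kL kM lL lM ~-refl (~-sym e)
    where
    v : W
    v = (a ∷ x) ++ L
    p : Pos (actI (a ∷ x) a)
    p = actI-∷-pos a x n
    u′ : ∀ v → UniqueTo v (a ∷ a ∷ x)
    u′ v = UniqueFrom⇒UniqueTo v (UniqueFrom-cong (~-sym (~-cancel-∷ a x)) u)
    go : Pos (actI v a) ⊎ Neg (actI v a) → UniqueTo v (a ∷ x)
    go (inj₂ n) = UniqueTo-delete A (a ∷ x) v p n (u′ v)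
    -- A target on the positive side is first moved by insertion to s_a v, on the negative side,
    -- where deletion applies.
    go (inj₁ q) = UniqueTo-insert A (a ∷ x) v p q
      (UniqueTo-delete A (a ∷ x) (a ∷ v) p (subst Neg (sym (actI-∷-self a v)) (neg-of-pos q)) (u′ (a ∷ v)))

  unique : ∀ x → UniqueFrom x
  -- Decidable equality of lists removes the double negation produced by `transport`.
  unique x L M kL kM lL lM e = decidable-stable (≡-dec Fin._≟_ L M) λ ne →
    everywhere UniqueFrom UniqueFrom-cong UniqueFrom-up base x λ u → ne (u L M kL kM lL lM e)
    where
    base : UniqueFrom []
    base L M kL kM lL lM e = unique-from-identity (suc ∣ z ∣) L bound L M kL kM lL lM ~-refl (~-sym e)
      where
      z : ℤ
      z = J L + + #Δ
      bound : z < + suc ∣ z ∣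
      bound = subst (_< + suc ∣ z ∣) (0≤i⇒+∣i∣≡i (J-lower L)) (+<+ (ℕₚ.n<1+n ∣ z ∣))

-- From edges defined by length to edges defined by signs

module FrozenEdges (Φ : RootSystem) (Π : Base Φ) where
  open import Data.Bool using (Bool; true; false; if_then_else_)
  import Data.Rational as ℚ
  import Data.Rational.Properties as ℚₚ
  open import Data.List using (_∷ʳ_)
  import Data.Sign as Sign
  import Data.Sign.Properties as Signₚ
  open import Relation.Nullary using (⌊_⌋)
  open import Relation.Binary.PropositionalEquality.WithK using (≡-irrelevant)
  open IntegerSums
  open RationalVectors
  open RootSystem Φ hiding (s)
  open Base Π
  open WeylGroup Φ
  open QuantumBruhatGraph Φ Π hiding (∣_∣)
  open Orders Φ Π
  open Transport Φ Π

  private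
    isPos : Root → Bool
    isPos β = ⌊ sgn β Signₚ.≟ Sign.+ ⌋

    -- The integer ⟨2ρ, α^∨⟩.
    H : Root → ℤ
    H α = sum λ β → if isPos β then c β α else 0ℤ

    sum-c : ∀ α → sum (λ β → c β α) ≡ 0ℤ
    sum-c α = 2x≡0 (trans (sum-involution (λ β → c β α) neg neg-neg) (trans (sum-cong-≗ λ β → c-neg β α) (sum-neg _)))
      where
      2x≡0 : ∀ {x} → x ≡ - x → x ≡ 0ℤ
      2x≡0 {+ zero} _ = refl

    K≡2H : ∀ α → K α ≡ 2ℤ * H α
    K≡2H α = sym (begin
      2ℤ * H α ≡⟨ sum-scale 2ℤ _ ⟨
      sum (λ β → 2ℤ * (if isPos β then c β α else 0ℤ)) ≡⟨ sum-cong-≗ (λ β → term β (pos⊎neg β)) ⟩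
      sum (λ β → sg β * c β α + c β α) ≡⟨ ∑-distrib-+ _ _ ⟩
      K α + sum (λ β → c β α) ≡⟨ cong (λ y → K α + y) (sum-c α) ⟩
      K α + 0ℤ ≡⟨ +-identityʳ (K α) ⟩
      K α ∎)
      where
      open ≡-Reasoning
      e₁ : ∀ x → 2ℤ * x ≡ 1ℤ * x + x
      e₁ = solve-∀
      e₂ : ∀ x → 0ℤ ≡ -1ℤ * x + x
      e₂ = solve-∀
      term : ∀ β → Pos β ⊎ Neg β → 2ℤ * (if isPos β then c β α else 0ℤ) ≡ sg β * c β α + c β α
      term β (inj₁ p) rewrite sg-pos p | p = e₁ (c β α)
      term β (inj₂ n) rewrite sg-neg n | n = e₂ (c β α)

    2ρ : ∀ α → toℚ (+ 2) ℚ.* ⟨ ρ , coroot α ⟩ ≡ toℚ (H α)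
    2ρ α = begin
      toℚ (+ 2) ℚ.* ⟨ ρ , coroot α ⟩ ≡⟨ cong (toℚ (+ 2) ℚ.*_) (⟨•⟩ ℚ.½ (∑ f) (coroot α)) ⟩
      toℚ (+ 2) ℚ.* (ℚ.½ ℚ.* ⟨ ∑ f , coroot α ⟩) ≡⟨ 2*½ ⟨ ∑ f , coroot α ⟩ ⟩
      ⟨ ∑ f , coroot α ⟩ ≡⟨ ⟨∑⟩ f (coroot α) ⟩
      ℚΣ.sum (λ β → ⟨ f β , coroot α ⟩) ≡⟨ ℚΣ.sum-cong-≗ (λ β → term β (isPos β)) ⟩
      ℚΣ.sum (λ β → toℚ (if isPos β then c β α else 0ℤ)) ≡⟨ toℚ-sum (λ β → if isPos β then c β α else 0ℤ) ⟨
      toℚ (H α) ∎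
      where
      open ≡-Reasoning
      2*½ : ∀ z → toℚ (+ 2) ℚ.* (ℚ.½ ℚ.* z) ≡ z
      2*½ z = trans (sym (ℚₚ.*-assoc (toℚ (+ 2)) ℚ.½ z)) (ℚₚ.*-identityˡ z)
      f : Root → V
      f β = if isPos β then root β else 0ᵥ
      term : ∀ β b → ⟨ if b then root β else 0ᵥ , coroot α ⟩ ≡ toℚ (if b then c β α else 0ℤ)
      term β true  = c-correct β α
      term β false = ⟨0⟩ (coroot α)

    length-sub : ∀ {x y k l} → HasLength x k → HasLength y l → J y ≡ J x - 4ℤ * (+ l - + k)
    length-sub {x} {y} {k} {l} h h′ = trans (J-length {y} h′) (trans (e (+ #Δ) (+ k) (+ l)) (cong (λ y → y - 4ℤ * (+ l - + k)) (sym (J-length {x} h))))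
      where
      e : ∀ n k l → n - 4ℤ * l ≡ n - 4ℤ * k - 4ℤ * (l - k)
      e = solve-∀

    sg-label : ∀ x α → Pos α → (sg (actR x α) ≡ 1ℤ × J (x ∷ʳ α) < J x) ⊎ (sg (actR x α) ≡ -1ℤ × J x < J (x ∷ʳ α))
    sg-label x α p with pos⊎neg (actR x α)
    ... | inj₁ q = inj₁ (sg-pos q , J-∷ʳ-< α p x q)
    ... | inj₂ n = inj₂ (sg-neg n , subst (_< J (x ∷ʳ α)) (J-cong back)
            (J-∷ʳ-< α p (x ∷ʳ α) (subst Pos (sym (trans (actR-∷ʳ x α α) (actR-neg x α))) (pos-of-neg n))))
      where
      back : x ∷ʳ α ∷ʳ α ~ x
      back = mk~ λ β → trans (actR-∷ʳ (x ∷ʳ α) α β) (trans (actR-∷ʳ x α (reflect α β)) (cong (actR x) (reflect-involutive α β)))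

  -- The lengths must be matched with the sign of xα. A Bruhat step lowers `J`, so xα is positive; a
  -- quantum step changes `J` by 2 `K α` - 4, which is not negative since `K α` is at least 2, so xα
  -- is negative.
  Edge⇒E : ∀ {x α y} → Edge x α y → E x α
  Edge⇒E {x} {α} {y} (p , y≈ , inj₁ (k , hx , hy)) = edge p (go (sg-label x α p))
    where
    e₀ : ∀ j k → j - 4ℤ * (k + 1ℤ - k) ≡ j - 4ℤ
    e₀ = solve-∀
    ΔJ : J (x ∷ʳ α) ≡ J x - 4ℤ
    ΔJ = trans (J-cong (~-sym (≈⇒~ {y} {x ∷ʳ α} y≈))) (trans (length-sub {x} {y} hx hy) (e₀ (J x) (+ k)))
    e₁ : ∀ j κ → j - 4ℤ ≡ j - 4ℤ + (1ℤ - 1ℤ) * κ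
    e₁ = solve-∀
    j-4<j : J x - 4ℤ < J x
    j-4<j = 0<-⇒< (subst (0ℤ <_) (e₂ (J x)) (+<+ (ℕ.s≤s ℕ.z≤n)))
      where
      e₂ : ∀ j → 4ℤ ≡ j - (j - 4ℤ)
      e₂ = solve-∀
    go : _ → J (x ∷ʳ α) ≡ J x - 4ℤ + (1ℤ - sg (actR x α)) * K α
    go (inj₁ (e , _)) = trans ΔJ (trans (e₁ (J x) (K α)) (cong (λ s → J x - 4ℤ + (1ℤ - s) * K α) (sym e)))
    go (inj₂ (_ , lt)) = ⊥-elim (<-asym j-4<j (subst (J x <_) ΔJ lt))
  Edge⇒E {x} {α} {y} (p , y≈ , inj₂ (k , l , hx , hy , q)) = edge p (go (sg-label x α p))
    where
    l≡ : + l ≡ + k - H α + 1ℤ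
    l≡ = toℚ-injective (trans q (trans (cong (λ y → toℚ (+ k) ℚ.- y ℚ.+ ℚ.1ℚ) (2ρ α))
      (trans (cong (ℚ._+ ℚ.1ℚ) (sym (toℚ-- (+ k) (H α)))) (sym (toℚ-+ (+ k - H α) 1ℤ)))))
    e₀ : ∀ j k h → j - 4ℤ * (k - h + 1ℤ - k) ≡ j - 4ℤ + 2ℤ * (2ℤ * h)
    e₀ = solve-∀
    ΔJ : J (x ∷ʳ α) ≡ J x - 4ℤ + 2ℤ * K α
    ΔJ = trans (J-cong (~-sym (≈⇒~ {y} {x ∷ʳ α} y≈))) (trans (length-sub {x} {y} hx hy)
      (trans (cong (λ y → J x - 4ℤ * (y - + k)) l≡) (trans (e₀ (J x) (+ k) (H α)) (cong (λ y → J x - 4ℤ + 2ℤ * y) (sym (K≡2H α))))))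
    go : _ → J (x ∷ʳ α) ≡ J x - 4ℤ + (1ℤ - sg (actR x α)) * K α
    go (inj₂ (e , _)) = trans ΔJ (cong (λ s → J x - 4ℤ + (1ℤ - s) * K α) (sym e))
    go (inj₁ (_ , lt)) = ⊥-elim (<-irrefl refl (<-≤-trans lt (subst (J x ≤_) (sym ΔJ) (0≤i-j⇒j≤i (subst (0ℤ ≤_) (e₂ (J x) (K α)) (0≤* {2ℤ} (+≤+ ℕ.z≤n) (i≤j⇒0≤j-i (2≤K α p))))))))
      where
      e₂ : ∀ j k → 2ℤ * (k - 2ℤ) ≡ j - 4ℤ + 2ℤ * k - j
      e₂ = solve-∀

  module _ (Λ : Weight Φ) {_◁_ : Rel Root 0ℓ} where
    open ReflectionOrders Φ Π Λ

    -- Labels decrease along the chain, so the reversed order is the one in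
    -- which paths are increasing.
    reversed : IsReflectionOrder _◁_ → ReflOrder (flip _◁_)
    reversed R = record
      { compare = λ α β p q → reverse-tri (compare (α , p) (β , q))
      ; ≺-trans = λ {α} {β} {γ} p q r h k → <ᴼ.trans {γ , r} {β , q} {α , p} k h
      ; convex = λ p q r s → cases (convex p q r (root≡ s))
      }
      where
      open IsReflectionOrder R
      module <ᴼ = IsStrictTotalOrder isStrictTotalOrder
      open <ᴼ using (compare)
      reverse-tri : ∀ {α β} {p : Pos α} {q : Pos β} → Tri (α ◁ β) ((α , p) ≡ (β , q)) (β ◁ α) → Tri (β ◁ α) (α ≡ β) (α ◁ β)
      reverse-tri (tri< a ¬b ¬c) = tri> ¬c (λ { refl → ¬b (cong (_ ,_) (≡-irrelevant _ _)) }) a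
      reverse-tri (tri≈ ¬a b ¬c) = tri≈ ¬c (cong proj₁ b) ¬a
      reverse-tri (tri> ¬a ¬b c) = tri< c (λ { refl → ¬b (cong (_ ,_) (≡-irrelevant _ _)) }) ¬a
      cases : ∀ {A B C D : Set} → (A × B) ⊎ (C × D) → (D × C) ⊎ (B × A)
      cases (inj₁ (a , b)) = inj₂ (b , a)
      cases (inj₂ (a , b)) = inj₁ (b , a)
      root≡ : ∀ {α β γ} → IsSum γ α β → root γ ≡ root α +ᵥ root β
      root≡ {α} {β} {γ} h = trans (root-cf γ) (trans (∑-cong (λ i → cong (_• root (simple i)) (trans (cong toℚ (h i)) (toℚ-+ (cf α i) (cf β i)))))
        (trans (comb-plus (toℚ ∘ cf α) (toℚ ∘ cf β) (root ∘ simple)) (sym (cong₂ _+ᵥ_ (root-cf α) (root-cf β)))))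

-- Sorted lists, reversed vectors and fractions

module ListsAndThresholds where
  import Data.Nat.Properties as ℕₚ
  open import Data.Integer as ℤ using (ℤ; +_)
  import Data.Integer.Properties as ℤₚ
  open import Data.Rational as ℚ using (ℚ; 0ℚ; 1ℚ; _/_)
  import Data.Rational.Properties as ℚₚ
  import Data.Rational.Unnormalised as ℚᵘ
  import Data.Rational.Unnormalised.Properties as ℚᵘₚ
  open import Data.Rational.Solver using (module +-*-Solver)
  open import Data.List using (filter; take; drop; deduplicate)
  open import Data.List.Relation.Unary.All as All using (All; []; _∷_)
  import Data.List.Relation.Unary.All.Properties as Allₚ
  open import Data.List.Relation.Unary.AllPairs as AllPairs using (AllPairs; []; _∷_)
  import Data.List.Relation.Unary.AllPairs.Properties as AllPairsₚ
  open import Data.Vec as Vec using (Vec; []; _∷_; _∷ʳ_; fromList; reverse)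
  open import Data.Vec.Properties using (reverse-∷)
  open import Data.Vec.Relation.Binary.Pointwise.Inductive using (Pointwise; []; _∷_)
  open import Relation.Nullary using (¬?)
  open import Relation.Unary using (Decidable)
  open +-*-Solver using (solve; _:+_; _:-_; _:=_; con)

  module _ {a : Level} {A : Set a} where

    take-++-length : ∀ (xs ys : List A) → take (length xs) (xs ++ ys) ≡ xs
    take-++-length []       ys = refl
    take-++-length (x ∷ xs) ys = cong (x ∷_) (take-++-length xs ys)

    drop-++-length : ∀ (xs ys : List A) → drop (length xs) (xs ++ ys) ≡ ys
    drop-++-length []       ys = refl
    drop-++-length (x ∷ xs) ys = drop-++-length xs ys

    module _ {p} {P : A → Set p} (P? : Decidable P) where

      filter-split : ∀ {r} {R : A → A → Set r} → (∀ {x y} → R x y → P y → P x) →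
        ∀ {xs} → AllPairs R xs → filter P? xs ++ filter (¬? ∘ P?) xs ≡ xs
      filter-split down [] = refl
      filter-split down {x ∷ xs} (r ∷ rs) with P? x
      ... | yes _ = cong (x ∷_) (filter-split down rs)
      ... | no ¬px = cong₂ _++_ {u = x ∷ filter (¬? ∘ P?) xs} (Listₚ.filter-none P? none) (cong (x ∷_) (Listₚ.filter-all (¬? ∘ P?) none))
        where
        import Data.List.Properties as Listₚ
        none : All (λ y → ¬ P y) xs
        none = All.map (λ rxy py → ¬px (down rxy py)) r

    filter-filter : ∀ {p q} {P : A → Set p} {Q : A → Set q} (P? : Decidable P) (Q? : Decidable Q) →
      (∀ {x} → P x → Q x) → ∀ xs → filter P? (filter Q? xs) ≡ filter P? xs
    filter-filter P? Q? P⊆Q [] = refl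
    filter-filter P? Q? P⊆Q (x ∷ xs) with Q? x
    ... | yes qx with P? x
    ... | yes _ = cong (x ∷_) (filter-filter P? Q? P⊆Q xs)
    ... | no _  = filter-filter P? Q? P⊆Q xs
    filter-filter P? Q? P⊆Q (x ∷ xs) | no ¬qx with P? x
    ... | yes px = ⊥-elim (¬qx (P⊆Q px))
    ... | no _   = filter-filter P? Q? P⊆Q xs

  deduplicate-increasing : ∀ {xs} → AllPairs ℚ._≤_ xs → AllPairs ℚ._<_ (deduplicate ℚₚ._≟_ xs)
  deduplicate-increasing [] = []
  deduplicate-increasing {x ∷ xs} (r ∷ rs) =
    All.map (λ { (x≤y , x≢y) → ℚₚ.≰⇒> λ y≤x → x≢y (ℚₚ.≤-antisym x≤y y≤x) })
      (All.zip (Allₚ.filter⁺ (¬? ∘ (x ℚₚ.≟_)) (Allₚ.deduplicate⁺ ℚₚ._≟_ r) , Allₚ.all-filter (¬? ∘ (x ℚₚ.≟_)) (deduplicate ℚₚ._≟_ xs)))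
    ∷ AllPairsₚ.filter⁺ (¬? ∘ (x ℚₚ.≟_)) (deduplicate-increasing rs)

  module _ {a b r} {A : Set a} {B : Set b} {R : A → B → Set r} where

    Pointwise-∷ʳ⁻ : ∀ {m n} {xs : Vec A m} {ys : Vec B n} {x y} → m ≡ n →
      Pointwise R (xs ∷ʳ x) (ys ∷ʳ y) → Pointwise R xs ys × R x y
    Pointwise-∷ʳ⁻ {xs = []}     {[]}     _ (r ∷ []) = [] , r
    Pointwise-∷ʳ⁻ {xs = _ ∷ xs} {_ ∷ ys} e (r ∷ rs) with Pointwise-∷ʳ⁻ {xs = xs} {ys} (ℕₚ.suc-injective e) rs
    ... | rs′ , r′ = r ∷ rs′ , r′

    Pointwise-reverse⁻ : ∀ {m n} (xs : Vec A m) (ys : Vec B n) → m ≡ n →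
      Pointwise R (reverse xs) (reverse ys) → Pointwise R xs ys
    Pointwise-reverse⁻ [] [] _ _ = []
    Pointwise-reverse⁻ (x ∷ xs) (y ∷ ys) e rs with Pointwise-∷ʳ⁻ {xs = reverse xs} {reverse ys} (ℕₚ.suc-injective e)
        (subst₂ (Pointwise R) (reverse-∷ x xs) (reverse-∷ y ys) rs)
    ... | rs′ , r = r ∷ Pointwise-reverse⁻ xs ys (ℕₚ.suc-injective e) rs′

  1-injective : ∀ {p q} → 1ℚ ℚ.- p ≡ 1ℚ ℚ.- q → p ≡ q
  1-injective {p} {q} e = trans (1-1- p) (trans (cong (λ y → 1ℚ ℚ.- y) e) (sym (1-1- q)))
    where
    1-1- : ∀ p → p ≡ 1ℚ ℚ.- (1ℚ ℚ.- p)
    1-1- = solve 1 (λ p → p := con 1ℚ :- (con 1ℚ :- p)) refl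

  fromList-injective : ∀ (cs ds : List ℚ) →
    Pointwise _≡_ (Vec.map (λ q → 1ℚ ℚ.- q) (fromList cs ∷ʳ 1ℚ)) (Vec.map (λ q → 1ℚ ℚ.- q) (fromList ds ∷ʳ 1ℚ)) → cs ≡ ds
  fromList-injective [] [] _ = refl
  fromList-injective [] (d ∷ []) (_ ∷ ())
  fromList-injective [] (d ∷ _ ∷ ds) (_ ∷ ())
  fromList-injective (c ∷ []) [] (_ ∷ ())
  fromList-injective (c ∷ _ ∷ cs) [] (_ ∷ ())
  fromList-injective (c ∷ cs) (d ∷ ds) (e ∷ es) = cong₂ _∷_ (1-injective e) (fromList-injective cs ds es)

  module _ (k : ℤ) (m : ℕ) where

    private
      /≃ : ℚ.toℚᵘ (k / suc m) ℚᵘ.≃ ℚᵘ.mkℚᵘ k m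
      /≃ = ℚₚ.toℚᵘ-fromℚᵘ (ℚᵘ.mkℚᵘ k m)

    0≤/ : ℤ.0ℤ ℤ.≤ k → 0ℚ ℚ.≤ k / suc m
    0≤/ h = ℚₚ.toℚᵘ-cancel-≤ (ℚᵘₚ.≤-respʳ-≃ (ℚᵘₚ.≃-sym /≃)
      (ℚᵘ.*≤* (subst₂ ℤ._≤_ (sym (ℤₚ.*-zeroˡ (+ suc m))) (sym (ℤₚ.*-identityʳ k)) h)))

    /≤1 : k ℤ.≤ + suc m → k / suc m ℚ.≤ 1ℚ
    /≤1 h = ℚₚ.toℚᵘ-cancel-≤ (ℚᵘₚ.≤-respˡ-≃ (ℚᵘₚ.≃-sym /≃)
      (ℚᵘ.*≤* (subst₂ ℤ._≤_ (sym (ℤₚ.*-identityʳ k)) (sym (ℤₚ.*-identityˡ (+ suc m))) h)))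

    /≡0 : k / suc m ≡ 0ℚ → k ≡ ℤ.0ℤ
    /≡0 e with ℚᵘₚ.≃-trans (ℚᵘₚ.≃-sym /≃) (ℚᵘₚ.≃-reflexive (cong ℚ.toℚᵘ e))
    ... | ℚᵘ.*≡* h = trans (sym (ℤₚ.*-identityʳ k)) (trans h (ℤₚ.*-zeroˡ (+ suc m)))

    /≡1 : k / suc m ≡ 1ℚ → k ≡ + suc m
    /≡1 e with ℚᵘₚ.≃-trans (ℚᵘₚ.≃-sym /≃) (ℚᵘₚ.≃-reflexive (cong ℚ.toℚᵘ e))
    ... | ℚᵘ.*≡* h = trans (sym (ℤₚ.*-identityʳ k)) (trans h (ℤₚ.*-identityˡ (+ suc m)))

-- Recovering an admissible subset from its checkpoints

module Recovery (Φ : RootSystem) (Π : Base Φ) (Λ : Weight Φ) (_◁_ : Rel (RootSystem.Root Φ) 0ℓ)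
                (R : ReflectionOrders.IsReflectionOrder Φ Π Λ _◁_)
                (Γ : SuitableChains.SuitableChain Φ Π Λ _◁_) (w : WeylGroup.W Φ) where
  open import Data.Nat using (_∸_)
  import Data.Nat.Properties as ℕₚ
  open import Data.Fin using (inject₁)
  import Data.Fin.Properties as Finₚ
  import Data.Fin.Subset as Subset
  open import Data.Fin.Subset.Properties using (_∈?_; ⊆-antisym)
  open import Data.Integer as ℤ using (+_; -[1+_]; 0ℤ)
  import Data.Integer.Properties as ℤₚ
  open import Data.Rational as ℚ using (ℚ; 0ℚ; 1ℚ)
  import Data.Rational.Properties as ℚₚ
  open import Data.Sign as Sign using (Sign)
  import Data.Sign.Properties as Signₚ
  open import Data.List using (take; drop; filter; allFin)
  import Data.List.Properties as Listₚ
  open import Data.List.Membership.Propositional using (_∈_)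
  open import Data.List.Membership.Propositional.Properties using (∈-deduplicate⁺; ∈-filter⁺; ∈-filter⁻; ∈-map⁺; ∈-allFin)
  open import Data.List.Relation.Unary.All as All using (All; []; _∷_)
  import Data.List.Relation.Unary.All.Properties as Allₚ
  open import Data.List.Relation.Unary.Any using (here; there)
  open import Data.List.Relation.Unary.AllPairs as AllPairs using (AllPairs; []; _∷_)
  import Data.List.Relation.Unary.AllPairs.Properties as AllPairsₚ
  open import Data.List.Relation.Unary.Linked using ([]; [-]; _∷_)
  open import Data.Vec as Vec using (Vec; []; _∷_; _∷ʳ_; fromList; reverse; lookup; tabulate)
  open import Data.Vec.Relation.Unary.Any as VecAny using () renaming (Any to VecAny; here to hereᵛ; there to thereᵛ)
  open import Data.Vec.Relation.Binary.Pointwise.Inductive as VecPw using (Pointwise; []; _∷_)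
  open import Function using (id)
  open import Relation.Nullary using (¬?)
  open import Relation.Nullary.Decidable using (_×-dec_)
  open ListsAndThresholds
  open RootSystem Φ hiding (s)
  open Base Π
  open Weight Λ
  open WeylGroup Φ
  open QuantumBruhatGraph Φ Π using (∣_∣; Edge)
  open ReflectionOrders Φ Π Λ
  open SuitableChains Φ Π Λ _◁_ hiding (bar; deg; t)
  open SuitableChain Γ
  open AdmissibleSubsets Φ Π Λ _◁_ Γ w
  open FrozenEdges Φ Π
  open Uniqueness Φ Π (reversed Λ R) using
    (_~_; mk~; ~-refl; ~-sym; ~-trans; ~-reflexive; ≈⇒~; Pos; Neg; pos⊎neg; pos-neg; pos-of-neg; neg-neg; E; E-cong;
     Chain; Chain-cong; Increasing; _<<_; <<-irrefl; unique; ∷ʳ-++; label-pos; ≺-irrefl)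

  ∣∣-pos : ∀ {α} → Pos α → ∣ α ∣ ≡ α
  ∣∣-pos {α} p with sgn α
  ... | Sign.+ = refl

  private
    Label : Fin r → Root
    Label j = ∣ γ j ∣

    0≤degree : ∀ b → IsPositiveᵃ b → 0ℤ ℤ.≤ proj₂ b
    0≤degree b (inj₁ h)       = ℤₚ.<⇒≤ h
    0≤degree b (inj₂ (e , _)) = ℤₚ.≤-reflexive (sym e)

    0<p⇒ : ∀ j → ∃[ m ] pair (γ j) ≡ + suc m
    0<p⇒ j = go (pair (γ j)) refl (β∈Inv j)
      where
      go : ∀ z → pair (γ j) ≡ z → Inv (β j) → ∃[ m ] pair (γ j) ≡ + suc m
      go (+ suc m) e _ = m , e
      go (+ zero) e (inj₁ 0<k , ¬p) = ⊥-elim (¬p (inj₁ (subst (λ z → 0ℤ ℤ.< proj₂ (β j) ℤ.- z) (sym e) (subst (0ℤ ℤ.<_) (sym (ℤₚ.+-identityʳ _)) 0<k))))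
      go (+ zero) e (inj₂ (k≡0 , p) , ¬p) = ⊥-elim (¬p (inj₂ (cong₂ ℤ._-_ k≡0 e , p)))
      go -[1+ m ] e (k , ¬p) = ⊥-elim (¬p (inj₁ (subst (λ z → 0ℤ ℤ.< proj₂ (β j) ℤ.- z) (sym e) (ℤₚ.+-mono-≤-< (0≤degree (β j) k) (ℤ.+<+ (ℕ.s≤s ℕ.z≤n))))))

    d-unfold : ∀ b m → pair (proj₁ b) ≡ + suc m → d b ≡ proj₂ b ℚ./ suc m
    d-unfold (γ , k) m e with pair γ
    d-unfold (γ , k) m refl | .(+ suc m) = refl

    degree-bounds : ∀ j m → pair (γ j) ≡ + suc m → 0ℤ ℤ.≤ proj₂ (β j) × proj₂ (β j) ℤ.≤ + suc m
    degree-bounds j m e with β∈Inv j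
    ... | h , ¬p = 0≤degree (β j) h , upper
      where
      upper : proj₂ (β j) ℤ.≤ + suc m
      upper = ℤₚ.i-j≤0⇒i≤j (subst (λ z → proj₂ (β j) ℤ.- z ℤ.≤ 0ℤ) e (ℤₚ.≮⇒≥ (λ l → ¬p (inj₁ l))))

  0≤d : ∀ j → 0ℚ ℚ.≤ dᵏ j
  0≤d j with 0<p⇒ j
  ... | m , e = subst (0ℚ ℚ.≤_) (sym (d-unfold (β j) m e)) (0≤/ _ m (proj₁ (degree-bounds j m e)))

  d≤1 : ∀ j → dᵏ j ℚ.≤ 1ℚ
  d≤1 j with 0<p⇒ j
  ... | m , e = subst (ℚ._≤ 1ℚ) (sym (d-unfold (β j) m e)) (/≤1 _ m (proj₂ (degree-bounds j m e)))

  d≡0⇒pos : ∀ j → dᵏ j ≡ 0ℚ → Pos (γ j)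
  d≡0⇒pos j h with 0<p⇒ j
  ... | m , e with proj₁ (β∈Inv j)
  ... | inj₂ (_ , p) = p
  ... | inj₁ 0<k = ⊥-elim (ℤₚ.<-irrefl (sym (/≡0 _ m (trans (sym (d-unfold (β j) m e)) h))) 0<k)

  -- If d = 1, the translate by t_λ has degree 0, and it is not a positive coroot. Hence the stretch
  -- beyond the last threshold has a single sign.
  d≡1⇒neg : ∀ j → dᵏ j ≡ 1ℚ → Neg (γ j)
  d≡1⇒neg j h with 0<p⇒ j | pos⊎neg (γ j)
  ... | _ | inj₂ n = n
  ... | m , e | inj₁ p = ⊥-elim (proj₂ (β∈Inv j) (inj₂ (ℤₚ.i≡j⇒i-j≡0 {proj₂ (β j)} {pair (γ j)} (trans (/≡1 (proj₂ (β j)) m (trans (sym (d-unfold (β j) m e)) h)) (sym e)) , p)))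

  d-mono : ∀ {i j} → i Fin.< j → dᵏ i ℚ.≤ dᵏ j
  d-mono i<j with β-monotone i<j
  ... | inj₁ h = ℚₚ.<⇒≤ h
  ... | inj₂ (h , _) = ℚₚ.≤-reflexive h

  private
    <⇒≺ : ∀ {i j} → i Fin.< j → dᵏ i ≡ dᵏ j → γ j ≺ γ i
    <⇒≺ i<j e with β-monotone i<j
    ... | inj₁ h = ⊥-elim (ℚₚ.<-irrefl e h)
    ... | inj₂ (_ , h) = h

    ≺⇒<< : ∀ {α α′} → sgn α ≡ sgn α′ → α ≺ α′ → ∣ α′ ∣ << ∣ α ∣
    ≺⇒<< e (pos≺neg (p , _) (n , _)) = ⊥-elim (pos-neg p (trans e n))
    ≺⇒<< e (pos≺pos (p , _) (q , _) h) = subst Pos (sym (∣∣-pos q)) q , subst Pos (sym (∣∣-pos p)) p ,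
      subst₂ _◁_ (sym (∣∣-pos p)) (sym (∣∣-pos q)) h
    ≺⇒<< e (neg≺neg (_ , p , _) (_ , q , _) h) = q , p , h

    -- At equal d the chain runs against `≺`, so its negative roots come first; this is why `n` is
    -- obtained from `m` by counting negative roots.
    neg-down : ∀ {i j} → i Fin.< j → dᵏ i ≡ dᵏ j → Neg (γ j) → Neg (γ i)
    neg-down i<j e n with <⇒≺ i<j e
    ... | pos≺neg (p , _) _ = ⊥-elim (pos-neg p n)
    ... | pos≺pos (p , _) _ _ = ⊥-elim (pos-neg p n)
    ... | neg≺neg _ (n′ , _) _ = n′

  Homogeneous : ℚ → Sign → Fin r → Set
  Homogeneous q s j = dᵏ j ≡ q × sgn (γ j) ≡ s

  -- Uniqueness of paths recovers absolute values of roots only. Within one value of d and one sign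
  -- these are strictly monotone along the chain, so they determine the positions.
  label-injective : ∀ {q s i j} → Homogeneous q s i → Homogeneous q s j → Label i ≡ Label j → i ≡ j
  label-injective {i = i} {j} (d , s) (d′ , s′) e with Finₚ.<-cmp i j
  ... | tri≈ _ h _ = h
  ... | tri< h _ _ = ⊥-elim (<<-irrefl (subst (_ <<_) (sym e) (≺⇒<< (trans s′ (sym s)) (<⇒≺ h (trans d (sym d′))))))
  ... | tri> _ _ h = ⊥-elim (<<-irrefl (subst (_ <<_) e (≺⇒<< (trans s (sym s′)) (<⇒≺ h (trans d′ (sym d))))))

  labels-injective : ∀ {q s} xs ys → All (Homogeneous q s) xs → All (Homogeneous q s) ys →
    List.map Label xs ≡ List.map Label ys → xs ≡ ys
  labels-injective [] [] _ _ _ = refl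
  labels-injective (x ∷ xs) (y ∷ ys) (h ∷ hs) (k ∷ ks) e = cong₂ _∷_
    (label-injective h k (Listₚ.∷-injectiveˡ e)) (labels-injective xs ys hs ks (Listₚ.∷-injectiveʳ e))

  labels-increasing : ∀ {q s} xs → AllPairs Fin._<_ xs → All (Homogeneous q s) xs → Increasing (List.map Label xs)
  labels-increasing [] _ _ = []
  labels-increasing (x ∷ []) _ _ = [-]
  labels-increasing (x ∷ y ∷ xs) ((x<y ∷ _) ∷ l) ((d , s) ∷ h@((d′ , s′) ∷ _)) =
    ≺⇒<< (trans s′ (sym s)) (<⇒≺ x<y (trans d (sym d′))) ∷ labels-increasing (y ∷ xs) l h

  chain-of-prefixes : ∀ x L → (∀ (a : Fin (length L)) → E (x ++ take (Fin.toℕ a) L) (List.lookup L a)) → Chain x L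
  chain-of-prefixes x [] h = tt
  chain-of-prefixes x (δ ∷ L) h = E-cong (~-reflexive (Listₚ.++-identityʳ x)) (h zero) ,
    chain-of-prefixes (x ++ δ ∷ []) L λ a → E-cong (~-sym (∷ʳ-++ x δ (take (Fin.toℕ a) L))) (h (suc a))

  Chain-++⁻ : ∀ x L M → Chain x (L ++ M) → Chain x L × Chain (x ++ L) M
  Chain-++⁻ x [] M h = tt , Chain-cong M (~-reflexive (sym (Listₚ.++-identityʳ x))) h
  Chain-++⁻ x (δ ∷ L) M (e , h) with Chain-++⁻ (x ++ δ ∷ []) L M h
  ... | k , k′ = (e , k) , Chain-cong M (∷ʳ-++ x δ L) k′

  record Selection : Set where
    field
      els     : List (Fin r)
      sorted  : AllPairs Fin._<_ els
      isChain : Chain w (List.map Label els)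
  open Selection

  selection : 𝒜 → Selection
  selection (A , adm) = record
    { els = elements A
    ; sorted = AllPairsₚ.filter⁺ (_∈? A) (AllPairsₚ.tabulate⁺-< id)
    ; isChain = chain-of-prefixes w (labels A) λ a →
        Edge⇒E {u A (Fin.toℕ a)} {List.lookup (labels A) a} {u A (suc (Fin.toℕ a))} (adm a)
    }

  vertex : List (Fin r) → W
  vertex xs = w ++ List.map Label xs

  AllPairs-++⁻ : ∀ (F S : List (Fin r)) {T} → AllPairs Fin._<_ (F ++ S ++ T) → AllPairs Fin._<_ S
  AllPairs-++⁻ [] [] _ = []
  AllPairs-++⁻ [] (x ∷ S) (h ∷ l) = Allₚ.++⁻ˡ S h ∷ AllPairs-++⁻ [] S l
  AllPairs-++⁻ (x ∷ F) S (_ ∷ l) = AllPairs-++⁻ F S l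

  segment-chain : ∀ (X : Selection) F S T → els X ≡ F ++ S ++ T → Chain (vertex F) (List.map Label S)
  segment-chain X F S T e = proj₁ (Chain-++⁻ (vertex F) (List.map Label S) (List.map Label T)
    (proj₂ (Chain-++⁻ w (List.map Label F) (List.map Label S ++ List.map Label T)
      (subst (Chain w) (trans (cong (List.map Label) e) (trans (Listₚ.map-++ Label F (S ++ T)) (cong (List.map Label F ++_) (Listₚ.map-++ Label S T)))) (isChain X)))))

  segment-unique : ∀ (X Y : Selection) q s F S S′ T T′ → els X ≡ F ++ S ++ T → els Y ≡ F ++ S′ ++ T′ →
    All (Homogeneous q s) S → All (Homogeneous q s) S′ → vertex (F ++ S) ~ vertex (F ++ S′) → S ≡ S′
  segment-unique X Y q s F S S′ T T′ e e′ h h′ v = labels-injective S S′ h h′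
    (unique (vertex F) (List.map Label S) (List.map Label S′) (segment-chain X F S T e) (segment-chain Y F S′ T′ e′)
      (labels-increasing S (AllPairs-++⁻ F S (subst (AllPairs Fin._<_) e (sorted X))) h)
      (labels-increasing S′ (AllPairs-++⁻ F S′ (subst (AllPairs Fin._<_) e′ (sorted Y))) h′)
      (~-trans (~-reflexive (end≡ S)) (~-trans v (~-reflexive (sym (end≡ S′))))))
    where
    end≡ : ∀ S → vertex F ++ List.map Label S ≡ vertex (F ++ S)
    end≡ S = trans (Listₚ.++-assoc w (List.map Label F) (List.map Label S)) (cong (w ++_) (sym (Listₚ.map-++ Label F S)))

  below : ℚ → List (Fin r) → List (Fin r)
  below q = filter (λ j → dᵏ j ℚₚ.<? q)

  notBelow : ℚ → List (Fin r) → List (Fin r)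
  notBelow q = filter (λ j → ¬? (dᵏ j ℚₚ.<? q))

  negative? : ∀ j → Dec (Neg (γ j))
  negative? j = sgn (γ j) Signₚ.≟ Sign.-

  module _ (X : Selection) where

    count : ℚ → ℕ
    count q = length (below q (els X))

    prefix : ℕ → W
    prefix k = w ++ take k (List.map Label (els X))

    #neg : ℕ → ℕ → ℕ
    #neg p q = length (filter negative? (take (q ∸ p) (drop p (els X))))

    -- The vector `n` of the definition of Ξ, computed by recursion so that the induction over
    -- thresholds can split off its head.
    steps : ∀ {n} → Vec ℕ (suc n) → Vec ℕ n
    steps (m ∷ [])      = []
    steps (m ∷ m′ ∷ ms) = m ℕ.+ #neg m m′ ∷ steps (m′ ∷ ms)

    steps-tabulate : ∀ {n} (ms : Vec ℕ (suc n)) →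
      tabulate (λ a → lookup ms (inject₁ a) ℕ.+ #neg (lookup ms (inject₁ a)) (lookup ms (suc a))) ≡ steps ms
    steps-tabulate (m ∷ []) = refl
    steps-tabulate (m ∷ m′ ∷ ms) = cong (m ℕ.+ #neg m m′ ∷_) (steps-tabulate (m′ ∷ ms))

    split-at : ∀ q → els X ≡ below q (els X) ++ notBelow q (els X)
    split-at q = sym (filter-split (λ j → dᵏ j ℚₚ.<? q) (λ i<j dj<q → ℚₚ.≤-<-trans (d-mono i<j) dj<q) (sorted X))

    prefix-length : ∀ F G → els X ≡ F ++ G → prefix (length F) ≡ vertex F
    prefix-length F G e = cong (w ++_) (trans (Listₚ.take-map (length F) (els X))
      (cong (List.map Label) (trans (cong (take (length F)) e) (take-++-length F G))))

    prefix-count : ∀ q → prefix (count q) ≡ vertex (below q (els X))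
    prefix-count q = prefix-length (below q (els X)) (notBelow q (els X)) (split-at q)

    -- The invariant of the induction over thresholds: an interior value of d has been passed or is
    -- still among the thresholds ahead.
    Covered : ∀ {n} → Vec ℚ (suc n) → Fin r → Set
    Covered T j = 0ℚ ℚ.< dᵏ j → dᵏ j ℚ.< 1ℚ → dᵏ j ℚ.< Vec.head T ⊎ VecAny (dᵏ j ≡_) T

    module Step {q q′ : ℚ} (q<q′ : q ℚ.< q′) where

      -- For consecutive thresholds, `N` is the stretch from u_{m_a} to u_{n_a}, and `P` the stretch
      -- from there to u_{m_{a+1}}.
      S N P : List (Fin r)
      S = notBelow q (below q′ (els X))
      N = filter negative? S
      P = filter (λ j → ¬? (negative? j)) S

      below-step : below q′ (els X) ≡ below q (els X) ++ S
      below-step = trans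
        (sym (filter-split (λ j → dᵏ j ℚₚ.<? q) (λ i<j dj<q → ℚₚ.≤-<-trans (d-mono i<j) dj<q)
          (AllPairsₚ.filter⁺ (λ j → dᵏ j ℚₚ.<? q′) (sorted X))))
        (cong (_++ S) (filter-filter (λ j → dᵏ j ℚₚ.<? q) (λ j → dᵏ j ℚₚ.<? q′) (λ h → ℚₚ.<-trans h q<q′) (els X)))

      S-sorted : AllPairs Fin._<_ S
      S-sorted = AllPairsₚ.filter⁺ (λ j → ¬? (dᵏ j ℚₚ.<? q)) (AllPairsₚ.filter⁺ (λ j → dᵏ j ℚₚ.<? q′) (sorted X))

      S-split : All (λ j → dᵏ j ≡ q) S → N ++ P ≡ S
      S-split h = filter-split negative? (λ { (i<j , e) → neg-down i<j e }) (pairs S-sorted h)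
        where
        pairs : ∀ {xs} → AllPairs Fin._<_ xs → All (λ j → dᵏ j ≡ q) xs → AllPairs (λ i j → i Fin.< j × dᵏ i ≡ dᵏ j) xs
        pairs [] [] = []
        pairs (l ∷ ls) (e ∷ es) = All.zipWith (λ { (i<j , e′) → i<j , trans e (sym e′) }) (l , es) ∷ pairs ls es

      els-step : els X ≡ below q (els X) ++ S ++ notBelow q′ (els X)
      els-step = trans (split-at q′) (trans (cong (_++ notBelow q′ (els X)) below-step) (Listₚ.++-assoc (below q (els X)) S _))

      #neg-step : #neg (count q) (count q′) ≡ length N
      #neg-step = cong (length ∘ filter negative?) (trans
        (cong₂ take
          (trans (cong (λ xs → length xs ∸ count q) below-step) (trans (cong (_∸ count q) (Listₚ.length-++ (below q (els X)))) (ℕₚ.m+n∸m≡n (count q) (length S))))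
          (trans (cong (drop (count q)) els-step) (drop-++-length (below q (els X)) (S ++ notBelow q′ (els X)))))
        (take-++-length S (notBelow q′ (els X))))

      module _ (h : All (λ j → dᵏ j ≡ q) S) where

        els-N : els X ≡ below q (els X) ++ N ++ P ++ notBelow q′ (els X)
        els-N = trans els-step (cong (below q (els X) ++_) (trans (cong (_++ notBelow q′ (els X)) (sym (S-split h))) (Listₚ.++-assoc N P _)))

        els-P : els X ≡ (below q (els X) ++ N) ++ P ++ notBelow q′ (els X)
        els-P = trans els-N (sym (Listₚ.++-assoc (below q (els X)) N _))

        below-NP : below q′ (els X) ≡ (below q (els X) ++ N) ++ P
        below-NP = trans below-step (trans (cong (below q (els X) ++_) (sym (S-split h))) (sym (Listₚ.++-assoc (below q (els X)) N P)))

        N-homogeneous : All (Homogeneous q Sign.-) N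
        N-homogeneous = All.zip (Allₚ.filter⁺ negative? h , Allₚ.all-filter negative? S)

        P-homogeneous : All (Homogeneous q Sign.+) P
        P-homogeneous = All.zipWith (λ { (e , ¬n) → e , positive ¬n })
            (Allₚ.filter⁺ (λ j → ¬? (negative? j)) h , Allₚ.all-filter (λ j → ¬? (negative? j)) S)
          where
          positive : ∀ {α} → ¬ Neg α → Pos α
          positive {α} ¬n with pos⊎neg α
          ... | inj₁ p = p
          ... | inj₂ n = ⊥-elim (¬n n)

        prefix-steps : prefix (count q ℕ.+ #neg (count q) (count q′)) ≡ vertex (below q (els X) ++ N)
        prefix-steps = trans (cong prefix (trans (cong (count q ℕ.+_) #neg-step) (sym (Listₚ.length-++ (below q (els X))))))
          (prefix-length (below q (els X) ++ N) (P ++ notBelow q′ (els X)) els-P)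

  Ascending : ∀ {n} → Vec ℚ (suc n) → Set
  Ascending (q ∷ [])     = q ≡ 1ℚ
  Ascending (q ∷ q′ ∷ T) = q ℚ.< q′ × Ascending (q′ ∷ T)

  head≤1 : ∀ {n} (T : Vec ℚ (suc n)) → Ascending T → Vec.head T ℚ.≤ 1ℚ
  head≤1 (q ∷ []) e = ℚₚ.≤-reflexive e
  head≤1 (q ∷ q′ ∷ T) (lt , a) = ℚₚ.≤-trans (ℚₚ.<⇒≤ lt) (head≤1 (q′ ∷ T) a)

  head≤ : ∀ {n} (T : Vec ℚ (suc n)) {x} → Ascending T → VecAny (x ≡_) T → Vec.head T ℚ.≤ x
  head≤ (q ∷ T) a (hereᵛ e) = ℚₚ.≤-reflexive (sym e)
  head≤ (q ∷ q′ ∷ T) (lt , a) (thereᵛ m) = ℚₚ.≤-trans (ℚₚ.<⇒≤ lt) (head≤ (q′ ∷ T) a m)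

  Covered-tail : ∀ X {n q} (T : Vec ℚ (suc n)) → q ℚ.< Vec.head T → ∀ {j} → Covered X (q ∷ T) j → Covered X T j
  Covered-tail X T lt cov 0<d d<1 with cov 0<d d<1
  ... | inj₁ d<q = inj₁ (ℚₚ.<-trans d<q lt)
  ... | inj₂ (hereᵛ refl) = inj₁ lt
  ... | inj₂ (thereᵛ m) = inj₂ m

  -- Such a value of d is interior, hence one of the thresholds; it is not below `q`, and all
  -- thresholds after `q` are too large.
  between : ∀ X {n q} (T : Vec ℚ (suc n)) → 0ℚ ℚ.< q → Ascending (q ∷ T) → All (Covered X (q ∷ T)) (els X) →
    All (λ j → dᵏ j ≡ q) (notBelow q (below (Vec.head T) (els X)))
  between X {q = q} T@(q′ ∷ _) 0<q (lt , a) cov = All.zipWith (λ { (¬d<q , (d<q′ , c)) → go ¬d<q d<q′ c })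
    ( Allₚ.all-filter (λ j → ¬? (dᵏ j ℚₚ.<? q)) (below q′ (els X))
    , Allₚ.filter⁺ (λ j → ¬? (dᵏ j ℚₚ.<? q)) (All.zip
        (Allₚ.all-filter (λ j → dᵏ j ℚₚ.<? q′) (els X) , Allₚ.filter⁺ (λ j → dᵏ j ℚₚ.<? q′) cov)))
    where
    go : ∀ {j} → ¬ dᵏ j ℚ.< q → dᵏ j ℚ.< q′ → Covered X (q ∷ T) j → dᵏ j ≡ q
    go ¬d<q d<q′ c with c (ℚₚ.<-≤-trans 0<q (ℚₚ.≮⇒≥ ¬d<q)) (ℚₚ.<-≤-trans d<q′ (head≤1 T a))
    ... | inj₁ d<q = ⊥-elim (¬d<q d<q)
    ... | inj₂ (hereᵛ e) = e
    ... | inj₂ (thereᵛ m) = ⊥-elim (ℚₚ.<-irrefl refl (ℚₚ.<-≤-trans d<q′ (head≤ T a m)))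

  module _ (X Y : Selection) (end~ : vertex (els X) ~ vertex (els Y)) where

    recover : ∀ {n} (T : Vec ℚ (suc n)) → Ascending T → 0ℚ ℚ.< Vec.head T →
      All (Covered X T) (els X) → All (Covered Y T) (els Y) →
      below (Vec.head T) (els X) ≡ below (Vec.head T) (els Y) →
      Pointwise _~_ (Vec.map (prefix X) (Vec.map (count X) T)) (Vec.map (prefix Y) (Vec.map (count Y) T)) →
      Pointwise _~_ (Vec.map (prefix X) (steps X (Vec.map (count X) T))) (Vec.map (prefix Y) (steps Y (Vec.map (count Y) T))) →
      els X ≡ els Y
    -- Only d = 1 is left beyond the last threshold, where all roots are negative; the far end of
    -- this segment is the common end of the two paths.
    recover (q ∷ []) refl _ _ _ e _ _ = trans (split-at X q) (trans (cong₂ _++_ e rest) (sym (split-at Y q)))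
      where
      last : ∀ xs → All (Homogeneous 1ℚ Sign.-) (notBelow 1ℚ xs)
      last xs = All.map (λ {j} ¬d<1 → let d≡1 = ℚₚ.≤-antisym (d≤1 j) (ℚₚ.≮⇒≥ ¬d<1) in d≡1 , d≡1⇒neg j d≡1)
        (Allₚ.all-filter (λ j → ¬? (dᵏ j ℚₚ.<? 1ℚ)) xs)
      ++[] : ∀ F G → F ++ G ≡ F ++ G ++ []
      ++[] F G = cong (F ++_) (sym (Listₚ.++-identityʳ G))
      rest : notBelow 1ℚ (els X) ≡ notBelow 1ℚ (els Y)
      rest = segment-unique X Y 1ℚ Sign.- (below 1ℚ (els X)) _ _ [] [] (trans (split-at X 1ℚ) (++[] (below 1ℚ (els X)) (notBelow 1ℚ (els X))))
        (trans (split-at Y 1ℚ) (trans (cong (_++ notBelow 1ℚ (els Y)) (sym e)) (++[] (below 1ℚ (els X)) (notBelow 1ℚ (els Y)))))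
        (last (els X)) (last (els Y))
        (~-trans (~-reflexive (cong vertex (sym (split-at X 1ℚ)))) (~-trans end~ (~-reflexive (cong vertex
          (trans (split-at Y 1ℚ) (cong (_++ notBelow 1ℚ (els Y)) (sym e)))))))
    -- The y-checkpoint `v′` closes the negative segment, and the next x-checkpoint `v` closes the
    -- positive one that follows it.
    recover (q ∷ T@(q′ ∷ _)) asc@(lt , asc′) 0<q covX covY e (_ ∷ vx@(v ∷ _)) (v′ ∷ vy) =
      recover T asc′ (ℚₚ.<-trans 0<q lt) (All.map (Covered-tail X T lt) covX) (All.map (Covered-tail Y T lt) covY)
        (trans (SX.below-NP hX) (trans (cong₂ _++_ (cong₂ _++_ e N≡) P≡) (sym (SY.below-NP hY)))) vx vy
      where
      module SX = Step X lt
      module SY = Step Y lt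
      hX : All (λ j → dᵏ j ≡ q) SX.S
      hX = between X T 0<q asc covX
      hY : All (λ j → dᵏ j ≡ q) SY.S
      hY = between Y T 0<q asc covY
      N≡ : SX.N ≡ SY.N
      N≡ = segment-unique X Y q Sign.- (below q (els X)) _ _ _ _ (SX.els-N hX)
        (trans (SY.els-N hY) (cong (_++ SY.N ++ SY.P ++ notBelow q′ (els Y)) (sym e)))
        (SX.N-homogeneous hX) (SY.N-homogeneous hY)
        (~-trans (~-reflexive (sym (SX.prefix-steps hX))) (~-trans v′ (~-reflexive (trans (SY.prefix-steps hY) (cong (λ F → vertex (F ++ SY.N)) (sym e))))))
      F≡ : below q (els Y) ++ SY.N ≡ below q (els X) ++ SX.N
      F≡ = cong₂ _++_ (sym e) (sym N≡)
      P≡ : SX.P ≡ SY.P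
      P≡ = segment-unique X Y q Sign.+ (below q (els X) ++ SX.N) _ _ _ _ (SX.els-P hX)
        (trans (SY.els-P hY) (cong (_++ SY.P ++ notBelow q′ (els Y)) F≡))
        (SX.P-homogeneous hX) (SY.P-homogeneous hY)
        (~-trans (~-reflexive (trans (cong vertex (sym (SX.below-NP hX))) (sym (prefix-count X q′))))
          (~-trans v (~-reflexive (trans (prefix-count Y q′) (cong vertex (trans (SY.below-NP hY) (cong (_++ SY.P) F≡)))))))

    -- At d = 0 all roots of the chain are positive, so there is one more segment.
    recover-start : ∀ {n} (T : Vec ℚ (suc n)) → Ascending T → 0ℚ ℚ.< Vec.head T →
      All (λ j → 0ℚ ℚ.< dᵏ j → dᵏ j ℚ.< 1ℚ → VecAny (dᵏ j ≡_) T) (els X) →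
      All (λ j → 0ℚ ℚ.< dᵏ j → dᵏ j ℚ.< 1ℚ → VecAny (dᵏ j ≡_) T) (els Y) →
      Pointwise _~_ (Vec.map (prefix X) (Vec.map (count X) T)) (Vec.map (prefix Y) (Vec.map (count Y) T)) →
      Pointwise _~_ (Vec.map (prefix X) (steps X (Vec.map (count X) T))) (Vec.map (prefix Y) (steps Y (Vec.map (count Y) T))) →
      els X ≡ els Y
    recover-start T@(q ∷ _) asc 0<q covX covY vx@(v ∷ _) vy = recover T asc 0<q
        (All.map (λ c 0<d d<1 → inj₂ (c 0<d d<1)) covX) (All.map (λ c 0<d d<1 → inj₂ (c 0<d d<1)) covY)
        (segment-unique X Y 0ℚ Sign.+ [] _ _ _ _ (split-at X q) (split-at Y q) (start covX) (start covY)
          (~-trans (~-reflexive (sym (prefix-count X q))) (~-trans v (~-reflexive (prefix-count Y q))))) vx vy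
      where
      start : ∀ {xs} → All (λ j → 0ℚ ℚ.< dᵏ j → dᵏ j ℚ.< 1ℚ → VecAny (dᵏ j ≡_) T) xs → All (Homogeneous 0ℚ Sign.+) (below q xs)
      start {xs} cov = All.zipWith (λ {j} → λ { (d<q , c) → zero-degree j d<q c })
          (Allₚ.all-filter (λ j → dᵏ j ℚₚ.<? q) xs , Allₚ.filter⁺ (λ j → dᵏ j ℚₚ.<? q) cov)
        where
        zero-degree : ∀ j → dᵏ j ℚ.< q → (0ℚ ℚ.< dᵏ j → dᵏ j ℚ.< 1ℚ → VecAny (dᵏ j ≡_) T) → Homogeneous 0ℚ Sign.+ j
        zero-degree j d<q c with 0ℚ ℚₚ.<? dᵏ j
        ... | yes 0<d = ⊥-elim (ℚₚ.<-irrefl refl (ℚₚ.<-≤-trans d<q (head≤ T asc (c 0<d (ℚₚ.<-≤-trans d<q (head≤1 T asc))))))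
        ... | no ¬0<d = let d≡0 = ℚₚ.≤-antisym (ℚₚ.≮⇒≥ ¬0<d) (0≤d j) in d≡0 , d≡0⇒pos j d≡0

  thresholds : (cs : List ℚ) → Vec ℚ (suc (length cs))
  thresholds cs = fromList cs ∷ʳ 1ℚ

  thresholds-ascending : ∀ cs → AllPairs ℚ._<_ cs → All (ℚ._< 1ℚ) cs → Ascending (thresholds cs)
  thresholds-ascending [] _ _ = refl
  thresholds-ascending (c ∷ []) _ (h ∷ _) = h , refl
  thresholds-ascending (c ∷ c′ ∷ cs) ((lt ∷ _) ∷ l) (_ ∷ h) = lt , thresholds-ascending (c′ ∷ cs) l h

  thresholds-positive : ∀ cs → All (0ℚ ℚ.<_) cs → 0ℚ ℚ.< Vec.head (thresholds cs)
  thresholds-positive [] _ = ℚₚ.positive⁻¹ 1ℚ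
  thresholds-positive (c ∷ cs) (h ∷ _) = h

  ∈-thresholds : ∀ cs {x} → x ∈ cs → VecAny (x ≡_) (thresholds cs)
  ∈-thresholds (c ∷ cs) (here e) = hereᵛ e
  ∈-thresholds (c ∷ cs) (there m) = thereᵛ (∈-thresholds cs m)

  private
    inside? : ∀ q → Dec (0ℚ ℚ.< q × q ℚ.< 1ℚ)
    inside? q = (0ℚ ℚₚ.<? q) ×-dec (q ℚₚ.<? 1ℚ)

  interior-bounds : ∀ A → All (λ q → 0ℚ ℚ.< q × q ℚ.< 1ℚ) (interior A)
  interior-bounds A = Allₚ.deduplicate⁺ ℚₚ._≟_ (Allₚ.all-filter inside? (List.map dᵏ (elements A)))

  interior-increasing : ∀ 𝐀 → AllPairs ℚ._<_ (interior (proj₁ 𝐀))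
  interior-increasing 𝐀 = deduplicate-increasing (AllPairsₚ.filter⁺ inside? (AllPairsₚ.map⁺ (AllPairs.map d-mono (sorted (selection 𝐀)))))

  interior-covers : ∀ A → All (λ j → 0ℚ ℚ.< dᵏ j → dᵏ j ℚ.< 1ℚ → dᵏ j ∈ interior A) (elements A)
  interior-covers A = All.tabulate λ j∈A 0<d d<1 → ∈-deduplicate⁺ ℚₚ._≟_ (∈-filter⁺ inside? (∈-map⁺ dᵏ j∈A) (0<d , d<1))

  Pointwise-≈⇒~ : ∀ {m n} {xs : Vec W m} {ys : Vec W n} → Pointwise _≈_ xs ys → Pointwise _~_ xs ys
  Pointwise-≈⇒~ [] = []
  Pointwise-≈⇒~ {xs = x ∷ _} {y ∷ _} (h ∷ hs) = ≈⇒~ {x} {y} h ∷ Pointwise-≈⇒~ hs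

  elements-injective : ∀ A B → elements A ≡ elements B → A ≡ B
  elements-injective A B e = ⊆-antisym (sub A B e) (sub B A (sym e))
    where
    sub : ∀ A B → elements A ≡ elements B → A Subset.⊆ B
    sub A B e {j} j∈A = proj₂ (∈-filter⁻ (_∈? B) {xs = allFin r} (subst (j ∈_) e (∈-filter⁺ (_∈? A) (∈-allFin j) j∈A)))

  interior-equal : ∀ 𝐀 𝐁 → Ξ̃ 𝐀 ≈̃ Ξ̃ 𝐁 → interior (proj₁ 𝐀) ≡ interior (proj₁ 𝐁)
  interior-equal 𝐀@(A , _) 𝐁@(B , _) (record { σ≡ = σ≡ } , _) with Pointwise-reverse⁻
      (Vec.map (λ q → 1ℚ ℚ.- q) (0ℚ ∷ c A)) (Vec.map (λ q → 1ℚ ℚ.- q) (0ℚ ∷ c B)) (reverse-length σ≡) σ≡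
    where
    reverse-length : ∀ {m n} {xs : Vec ℚ m} {ys : Vec ℚ n} → Pointwise _≡_ xs ys → m ≡ n
    reverse-length = VecPw.length-equal
  ... | _ ∷ h = fromList-injective (interior A) (interior B) h

  -- The interior values appear as variables, so that their equality, which also identifies the
  -- lengths of the vectors, can be matched with `refl`.
  selections-equal : ∀ (X Y : Selection) cs ds → cs ≡ ds → vertex (els X) ~ vertex (els Y) →
    Ascending (thresholds cs) → 0ℚ ℚ.< Vec.head (thresholds cs) →
    All (λ j → 0ℚ ℚ.< dᵏ j → dᵏ j ℚ.< 1ℚ → dᵏ j ∈ cs) (els X) →
    All (λ j → 0ℚ ℚ.< dᵏ j → dᵏ j ℚ.< 1ℚ → dᵏ j ∈ ds) (els Y) →
    Pointwise _≈_ (reverse (Vec.map (prefix X) (Vec.map (count X) (thresholds cs))))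
                  (reverse (Vec.map (prefix Y) (Vec.map (count Y) (thresholds ds)))) →
    Pointwise _≈_ (reverse (Vec.map (prefix X) (steps X (Vec.map (count X) (thresholds cs)))))
                  (reverse (Vec.map (prefix Y) (steps Y (Vec.map (count Y) (thresholds ds))))) →
    els X ≡ els Y
  selections-equal X Y cs .cs refl end~ asc 0<q covX covY x≈ y≈ = recover-start X Y end~ (thresholds cs) asc 0<q
    (All.map (λ h 0<d d<1 → ∈-thresholds cs (h 0<d d<1)) covX) (All.map (λ h 0<d d<1 → ∈-thresholds cs (h 0<d d<1)) covY)
    (Pointwise-reverse⁻ _ _ refl (Pointwise-≈⇒~ x≈)) (Pointwise-reverse⁻ _ _ refl (Pointwise-≈⇒~ y≈))

  Ξ̃-injective : ∀ {𝐀 𝐁} → Ξ̃ 𝐀 ≈̃ Ξ̃ 𝐁 → proj₁ 𝐀 ≡ proj₁ 𝐁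
  Ξ̃-injective {𝐀@(A , _)} {𝐁@(B , _)} h@(record { x≈ = x≈ ; y≈ = y≈ } , end≈) = elements-injective A B
    (selections-equal X Y (interior A) (interior B) (interior-equal 𝐀 𝐁 h) end~
      (thresholds-ascending (interior A) (interior-increasing 𝐀) (All.map proj₂ (interior-bounds A)))
      (thresholds-positive (interior A) (All.map proj₁ (interior-bounds A)))
      (interior-covers A) (interior-covers B) x≈
      (subst₂ (λ ns ns′ → Pointwise _≈_ (reverse (Vec.map (u A) ns)) (reverse (Vec.map (u B) ns′)))
        (steps-tabulate X (m A)) (steps-tabulate Y (m B)) y≈))
    where
    X Y : Selection
    X = selection 𝐀
    Y = selection 𝐁
    take-all : ∀ {a} {A : Set a} (xs : List A) → take (length xs) xs ≡ xs
    take-all [] = refl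
    take-all (x ∷ xs) = cong (x ∷_) (take-all xs)
    end~ : vertex (elements A) ~ vertex (elements B)
    end~ = ~-trans (~-reflexive (cong (w ++_) (sym (take-all (labels A)))))
      (~-trans (≈⇒~ {end 𝐀} {end 𝐁} end≈) (~-reflexive (cong (w ++_) (take-all (labels B)))))

theorem5p7 : (Φ : RootSystem) (Π : Base Φ) (Λ : Weight Φ)
    (_◁_ : Rel (RootSystem.Root Φ) 0ℓ) →
    ReflectionOrders.IsReflectionOrder Φ Π Λ _◁_ →
    (Γ : SuitableChains.SuitableChain Φ Π Λ _◁_)
    (w : WeylGroup.W Φ) →
    let open AdmissibleSubsets Φ Π Λ _◁_ Γ w in
    Injective _≈𝒜_ _≈̃_ Ξ̃
theorem5p7 Φ Π Λ _◁_ R Γ w {𝐀} {𝐁} = Recovery.Ξ̃-injective Φ Π Λ _◁_ R Γ w {𝐀} {𝐁}
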